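{- Let $k>3$ be an integer and let $G=(V,E)$ be a directed acyclic graph with $n=|V|$ and $m=|E|$, oriented by a total order on $V$, such that its largest community has size $\gamma$ and its largest out-degree is $\tilde s$. Then the work performed by the algorithm $\mathrm{CliqueList}(G,k)$ (described in the context), which lists all $k$-cliques of $G$, is $$O\left(m(\tilde s+\gamma^2) + k\, m \left(\frac{\gamma+4-k}{2}\right)^{k-2}\right),$$ and its depth is $$O\left(\log^2 n + k\log\gamma\right).$$
   Context: Model: CREW PRAM (shared memory, concurrent reads, exclusive writes). Work is the total number of elementary operations; depth is the length of a critical path. Graphs are assumed connected, so $m=\Omega(n)$. A graph is oriented by a total order on its vertices if each edge is directed from its lower endpoint to its higher endpoint. $N^+(u)$ and $N^-(v)$ denote the out-neighbors of $u$ and the in-neighbors of $v$. The community of a directed edge $e=(u,v)$ is $C(e)=C(u,v)=N^+(u)\cap N^-(v)$. A $k$-clique is a set of $k$ vertices inducing a complete graph (ignoring directions). For $I\subseteq V$ and $u,v\in I$, $\delta_I(u,v)$ is the number of elements of $I$ lying strictly between $u$ and $v$ in the total order. Procedure $\mathrm{RecursiveCount}(G,I,c)$, for a candidate set $I\subseteq V$ and integer $c\ge 1$: if $c=1$, report one clique for every vertex of $I$; if $c=2$, report one clique for every edge of the induced subgraph $G[I]$; if $c\geq 3$, for all pairs $(u,v)\in I\times I$, with $u$ before $v$, such that $\delta_I(u,v)\ge c-2$: if $(u,v)$ is an edge of $G$, set $I'=I\cap C(u,v)$ and call $\mathrm{RecursiveCount}(G,I',c-2)$. Algorithm $\mathrm{CliqueList}(G,k)$: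 build the communities of all edges of $G$ and sort them; then, for all edges $e$ with $|C(e)|\ge k-2$ in parallel, call $\mathrm{RecursiveCount}(G,C(e),k-2)$. (A reported clique consists of the vertices of the edges chosen along the recursion together with the vertex or edge found at the base case; reporting a $k$-clique costs $O(k)$ work.) As part of the preprocessing, the algorithm computes all triangles to obtain the communities, builds for each edge $e$ an adjacency matrix of $G[C(e)]$, and, for each edge $e'$ of $G[C(e)]$, a boolean indicator table of the community of $e'$ in $G[C(e)]$. Edge tests then take $O(1)$ time, and each intersection $I\cap C(e')$ is computed by table lookups and a parallel prefix sum.
   Formalization: The indicator table of C(e') is built once per edge e' of G and shared by all G[C(e)]; separate tables for each e would cost order n^5 on the complete graph with k=4, above the claimed O(n^4). Also γ+4-k is read as 0 when negative, and n≥2. -}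

module Defs where

import Algebra.Definitions.RawSemiring as Semiring
open import Data.Bool using (Bool; true; false; if_then_else_; _∧_)
open import Data.Fin using (Fin; toℕ)
import Data.Fin as Fin
import Data.Fin.Properties as Fin
open import Data.Integer using (+_)
open import Data.List
  using (List; []; _∷_; _++_; map; length; filter; concatMap; allFin;
         applyUpTo; catMaybes)
open import Data.List.Extrema.Nat using (max)
open import Data.List.Membership.Propositional using (_∈_)
open import Data.List.Relation.Binary.Permutation.Propositional using (_↭_)
open import Data.List.Relation.Unary.All using (All; all?)
open import Data.List.Relation.Unary.AllPairs using (AllPairs)
open import Data.List.Relation.Unary.Any using (Any)
open import Data.List.Relation.Unary.Unique.Propositional using (Unique)
open import Data.Maybe using (Maybe; just; nothing; is-just; maybe′)
open import Data.Nat
  using (ℕ; zero; suc; _+_; _∸_; _⊔_; _<?_; _<ᵇ_; _≡ᵇ_; ⌊_/2⌋)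
open import Data.Nat.Properties using (_≟_)
open import Data.Product using (_×_; _,_; proj₁; proj₂; ∃-syntax)
open import Data.Rational using (ℚ; _/_; +-*-rawSemiring)
open import Data.Sum using (_⊎_)
open import Data.Unit using (⊤; tt)
open import Relation.Binary.Construct.Closure.Equivalence using (EqClosure)
open import Relation.Binary.PropositionalEquality using (_≡_)
open import Relation.Nullary using (¬_; does)

import Data.List.Membership.DecPropositional as DecMembership
import Data.List.Relation.Unary.Unique.DecPropositional as DecUnique

------------------------------------------------------------------------
-- Graphs

-- A graph oriented by a total order on its vertices.  The vertices are
-- identified with their ranks in that order, so the order is the one of
-- Fin n.  The out-neighbours of a vertex are listed in arbitrary order:
-- this list is both N⁺ and the adjacency array the algorithm is given.
record OrientedGraph (n : ℕ) : Set where
  field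
    N⁺        : Fin n → List (Fin n)
    N⁺-unique : ∀ u → Unique (N⁺ u)
    N⁺-above  : ∀ u → All (u Fin.<_) (N⁺ u)

module _ {n : ℕ} (G : OrientedGraph n) where
  open OrientedGraph G
  open DecMembership (Fin._≟_ {n}) using (_∈?_)

  Edge : Fin n → Fin n → Set
  Edge u v = v ∈ N⁺ u

  Adjacent : Fin n → Fin n → Set
  Adjacent u v = Edge u v ⊎ Edge v u

  Connected : Set
  Connected = ∀ u v → EqClosure Edge u v

  edges : List (Fin n × Fin n)
  edges = concatMap (λ u → map (u ,_) (N⁺ u)) (allFin n)

  edgeCount : ℕ
  edgeCount = length edges

  N⁻ : Fin n → List (Fin n)
  N⁻ v = filter (λ u → v ∈? N⁺ u) (allFin n)

  community : Fin n → Fin n → List (Fin n)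
  community u v = filter (_∈? N⁻ v) (N⁺ u)

  maxCommunitySize : ℕ
  maxCommunitySize =
    max 0 (map (λ e → length (community (proj₁ e) (proj₂ e))) edges)

  maxOutDegree : ℕ
  maxOutDegree = max 0 (map (λ u → length (N⁺ u)) (allFin n))

  -- A set of vertices is given by any enumeration of it.  Adjacent is
  -- irreflexive, so the entries of a clique are pairwise distinct.
  IsClique : ℕ → List (Fin n) → Set
  IsClique k vs = length vs ≡ k × AllPairs Adjacent vs

  -- Every report is a k-clique, and every k-clique is reported, once.
  ListsAllCliques : ℕ → List (List ℕ) → Set
  ListsAllCliques k out =
      All (λ o → ∃[ vs ] (IsClique k vs × o ≡ map toℕ vs)) out
    × (∀ vs → IsClique k vs → Any (map toℕ vs ↭_) out)
    × AllPairs (λ o o′ → ¬ (o ↭ o′)) out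

------------------------------------------------------------------------
-- The CREW PRAM, as a work-depth cost semantics
--
-- A program of type PRAM A either crashes (nothing) or yields a result
-- together with the reported lists of vertices, in order, and the work
-- and depth spent.  Programs are composed only of the instructions
-- below, of return (a value held in registers), and of branching on
-- register values; every instruction has a positive cost.

record Outcome (A : Set) : Set where
  constructor outcome
  field
    value   : A
    reports : List (List ℕ)
    work    : ℕ
    depth   : ℕ

PRAM : Set → Set
PRAM A = Maybe (Outcome A)

private variable A B : Set

crash : PRAM A
crash = nothing

return : A → PRAM A
return x = just (outcome x [] 0 0)

infixl 1 _>>=_ _>>_

after : List (List ℕ) → ℕ → ℕ → PRAM B → PRAM B
after r w d nothing                     = nothing
after r w d (just (outcome y r′ w′ d′)) =
  just (outcome y (r ++ r′) (w + w′) (d + d′))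

_>>=_ : PRAM A → (A → PRAM B) → PRAM B
nothing                >>= f = nothing
just (outcome x r w d) >>= f = after r w d (f x)

_>>_ : PRAM A → PRAM B → PRAM B
p >> q = p >>= λ _ → q

whenJust : Maybe A → (A → PRAM ⊤) → PRAM ⊤
whenJust r f = maybe′ f (return tt) r

step : A → PRAM A
step x = just (outcome x [] 1 1)

-- Unit-cost arithmetic and tests on machine words.

infixl 6 _+!_ _∸!_
infix  4 _<!_ _≡!_

_+!_ _∸!_ : ℕ → ℕ → PRAM ℕ
x +! y = step (x + y)
x ∸! y = step (x ∸ y)

_<!_ _≡!_ : ℕ → ℕ → PRAM Bool
x <! y = step (x <ᵇ y)
x ≡! y = step (x ≡ᵇ y)

half : ℕ → PRAM ℕ
half x = step ⌊ x /2⌋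

-- An array is a block of memory; each cell holds a word, a record of
-- constantly many words, or a reference to another block.

Array : Set → Set
Array = List

size : Array A → PRAM ℕ
size xs = step (length xs)

infix 8 _!_

_!_ : Array A → ℕ → PRAM A
[]       ! i     = crash
(x ∷ xs) ! zero  = step x
(x ∷ xs) ! suc i = xs ! i

both : PRAM A → PRAM (List A) → PRAM (List A)
both (just (outcome x r w d)) (just (outcome xs r′ w′ d′)) =
  just (outcome (x ∷ xs) (r ++ r′) (w + w′) (d ⊔ d′))
both _ _ = nothing

together : List (PRAM A) → PRAM (List A)
together []       = return []
together (p ∷ ps) = both p (together ps)

-- for i < n in parallel: processor i runs p i and writes its result to
-- cell i of a new array.  Works add up, depths are maximised, and
-- starting n processors costs work 1 + n and depth 1.
par : ℕ → (ℕ → PRAM A) → PRAM (Array A)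
par n p = just (outcome tt [] (suc n) 1) >> together (applyUpTo p n)

-- Reporting a list of k vertices takes work (and depth) O(k).
report : List ℕ → PRAM ⊤
report vs = just (outcome tt (vs ∷ []) (suc (length vs)) (suc (length vs)))

-- A step of concurrent writes, with one processor per entry of the
-- list: the entry just (a , x) writes x to cell a of a new block, the
-- entry nothing stays idle.  The new block is not initialised: a cell i
-- that is not written contains init i, for an arbitrary init.  Writing
-- outside of the block, or (exclusive writes) twice to the same cell,
-- crashes.
module Scatter (init : ℕ → ℕ) where

  contents : List (ℕ × ℕ) → ℕ → ℕ
  contents []             i = init i
  contents ((a , x) ∷ ws) i = if a ≡ᵇ i then x else contents ws i

  scatter : ℕ → Array (Maybe (ℕ × ℕ)) → PRAM (Array ℕ)
  scatter s ws =
    if does (all? (_<? s) targets) ∧ does (DecUnique.unique? _≟_ targets)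
    then just (outcome (applyUpTo (contents (catMaybes ws)) s)
                       [] (suc (length ws)) 1)
    else crash
    where targets = map proj₁ (catMaybes ws)

------------------------------------------------------------------------
-- Prefix sums

-- xs ↦ (x₀, x₀ + x₁, …).  Sums of consecutive pairs are formed, scanned
-- recursively, and expanded.  The first argument only bounds the
-- recursion; exhausting it crashes.
scan : ℕ → Array ℕ → PRAM (Array ℕ)
scan zero       xs = crash
scan (suc fuel) xs = do
  s     ← size xs
  small ← s <! 2
  if small then return xs else do
    s′ ← s +! 1
    h  ← half s′
    ys ← par h λ i → do
      a    ← i +! i
      b    ← a +! 1
      x    ← xs ! a
      pair ← b <! s
      if pair then (do
        y ← xs ! b
        x +! y)
       else return x
    zs ← scan fuel ys
    par s λ i → do
      q    ← half i
      q+q  ← q +! q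
      even ← i ≡! q+q
      if even then (do
        x     ← xs ! i
        first ← i ≡! 0
        if first then return x else do
          p ← q ∸! 1
          z ← zs ! p
          z +! x)
       else zs ! q

prefixSums : Array ℕ → PRAM (Array ℕ)
prefixSums xs = scan (suc (length xs)) xs

-- The sum of an array, given its prefix sums.
total : Array ℕ → PRAM ℕ
total sums = do
  s     ← size sums
  empty ← s ≡! 0
  if empty then return 0 else do
    p ← s ∸! 1
    sums ! p

bit : Bool → ℕ
bit b = if b then 1 else 0

------------------------------------------------------------------------
-- The algorithm

module Algorithm (init : ℕ → ℕ) where
  open Scatter init

  -- The entries of xs passing the test, in the order of xs.
  pack : Array ℕ → (ℕ → PRAM Bool) → PRAM (Array ℕ)
  pack xs test = do
    s     ← size xs
    flags ← par s λ i → do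
      x ← xs ! i
      b ← test x
      return (bit b)
    sums  ← prefixSums flags
    t     ← total sums
    ws    ← par s λ i → do
      f    ← flags ! i
      keep ← f ≡! 1
      if keep then (do
        x ← xs ! i
        q ← sums ! i
        a ← q ∸! 1
        return (just (a , x)))
       else return nothing
    scatter t ws

  -- Sorting of distinct words: each is moved to the position given by
  -- its rank.  For |C| words this is O(|C|²) work.
  sort : Array ℕ → PRAM (Array ℕ)
  sort xs = do
    s  ← size xs
    ws ← par s λ i → do
      x     ← xs ! i
      flags ← par s λ j → do
        y ← xs ! j
        b ← y <! x
        return (bit b)
      sums  ← prefixSums flags
      rank  ← total sums
      return (just (rank , x))
    scatter s ws

  -- An indicator table of a set of words below n, over a block of size
  -- n of which only the cells of members are ever written: x is a
  -- member precisely if slots[x] is a position of members holding x.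
  record Table : Set where
    constructor table
    field
      members : Array ℕ
      slots   : Array ℕ
  open Table

  buildTable : ℕ → Array ℕ → PRAM Table
  buildTable n xs = do
    s     ← size xs
    ws    ← par s λ p → do
      x ← xs ! p
      return (just (x , p))
    slots ← scatter n ws
    return (table xs slots)

  -- The position of x among the members, if it is one.
  find : Table → ℕ → PRAM (Maybe ℕ)
  find T x = do
    p     ← slots T ! x
    s     ← size (members T)
    valid ← p <! s
    if valid then (do
      y   ← members T ! p
      hit ← y ≡! x
      return (if hit then just p else nothing))
     else return nothing

  member : Table → ℕ → PRAM Bool
  member T x = do
    r ← find T x
    return (is-just r)

  -- The adjacency matrix of G[C(e)], indexed by positions in the sorted
  -- community C(e).  The entry of an edge e′ of G[C(e)] refers to the
  -- indicator table of C(e′); restricted to the vertices of C(e), it is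
  -- the indicator table of the community of e′ in G[C(e)].
  Matrix : Set
  Matrix = Array (Array (Maybe Table))

  entry : Matrix → ℕ → ℕ → PRAM (Maybe Table)
  entry M a b = do
    row ← M ! a
    row ! b

  -- The candidate set I ⊆ C(e) is a sorted array of positions in C(e).
  -- Thus δ_I(u,v) = j ∸ i ∸ 1 for the entries u and v with indices i < j,
  -- and for c ≥ 3 the loops run over exactly the pairs i < j with
  -- δ_I ≥ c - 2, which are those with j = i + (c - 1) + t.  chosen is a
  -- linked list of the vertices of the edges chosen so far, extended by
  -- the two vertices read just before.  (There is no call with c = 0.)
  recursiveCount : (C : Array ℕ) → Matrix → ℕ → (I : Array ℕ) →
                   (chosen : List ℕ) → PRAM ⊤
  recursiveCount C M 0 I chosen = crash
  recursiveCount C M 1 I chosen = do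
    s ← size I
    par s λ i → do
      a ← I ! i
      x ← C ! a
      report (x ∷ chosen)
    return tt
  recursiveCount C M 2 I chosen = do
    s ← size I
    par s λ i → do
      i′   ← i +! 1
      rest ← s ∸! i′
      par rest λ t → do
        j      ← i′ +! t
        a      ← I ! i
        b      ← I ! j
        edge   ← entry M a b
        whenJust edge λ _ → do
          x ← C ! a
          y ← C ! b
          report (x ∷ y ∷ chosen)
    return tt
  recursiveCount C M c@(suc (suc c-2@(suc _))) I chosen = do
    s    ← size I
    gap  ← c ∸! 1
    rows ← s ∸! gap
    par rows λ i → do
      rest ← rows ∸! i
      i′   ← i +! gap
      par rest λ t → do
        j      ← i′ +! t
        a      ← I ! i
        b      ← I ! j
        edge   ← entry M a b
        whenJust edge λ T → do
          I′ ← pack I λ l → do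
            w ← C ! l
            member T w
          x  ← C ! a
          y  ← C ! b
          recursiveCount C M c-2 I′ (x ∷ y ∷ chosen)
    return tt

  -- The input adj is the array of the adjacency arrays N⁺ of the
  -- vertices 0, …, n - 1.  Edges are addressed by their lower endpoint u
  -- and an index into adj[u].
  cliqueListOn : (adj : Array (Array ℕ)) → ℕ → PRAM ⊤
  cliqueListOn adj k = do
    n    ← size adj

    N⁺s  ← par n λ u → do
      ns ← adj ! u
      buildTable n ns

    -- All triangles (u, w, v), grouped by their longest edge (u, v).
    Cs   ← par n λ u → do
      ns ← adj ! u
      d  ← size ns
      par d λ j → do
        v ← ns ! j
        C ← pack ns λ w → do
          T ← N⁺s ! w
          member T v
        C ← sort C
        buildTable n C

    Ms   ← par n λ u → do
      row ← Cs ! u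
      d   ← size row
      par d λ j → do
        T ← row ! j
        s ← size (members T)
        par s λ a → do
          x  ← members T ! a
          Tx ← N⁺s ! x
          rx ← Cs ! x
          par s λ b → do
            y ← members T ! b
            r ← find Tx y
            maybe′ (λ i → do T′ ← rx ! i
                             return (just T′))
                   (return nothing) r

    c    ← k ∸! 2
    par n λ u → do
      ns   ← adj ! u
      row  ← Cs ! u
      mrow ← Ms ! u
      d    ← size ns
      par d λ j → do
        v     ← ns ! j
        T     ← row ! j
        M     ← mrow ! j
        s     ← size (members T)
        small ← s <! c
        if small then return tt else do
          I ← par s λ i → return i
          recursiveCount (members T) M c I (u ∷ v ∷ [])
    return tt

cliqueList : (init : ℕ → ℕ) {n : ℕ} → OrientedGraph n → ℕ → PRAM ⊤
cliqueList init {n} G k =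
  Algorithm.cliqueListOn init
    (map (λ u → map toℕ (OrientedGraph.N⁺ G u)) (allFin n)) k

------------------------------------------------------------------------
-- Bounds

infixr 8 _^ℚ_

_^ℚ_ : ℚ → ℕ → ℚ
_^ℚ_ = Semiring._^_ +-*-rawSemiring

ℕ→ℚ : ℕ → ℚ
ℕ→ℚ x = + x / 1

-- Up to constants, the preprocessing costs s̃ + γ² per edge.  A call on s
-- candidates with parameter c ≥ 3 looks at the pairs i < j with j − i ≥ c − 1,
-- and recurses on at most j − i − 1 candidates, since the community of (u , v) lies
-- strictly between u and v.  With r = s + 1 − c rows of pairs, Pascal's rule
-- turns the recurrence into the bound O((c + k) (r + c choose c)): the
-- candidates of all pairs are paid for because r³ and c r² are O((r + c choose c)) for
-- c ≥ 3.  At the top level, c = k − 2 and r + 1 = γ + 4 − k, and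
-- (r + c choose c) ≤ 4 ((r + 1)/2)^c for r ≥ 2, while for r = 1 it is c + 1, so
-- that the term γ² pays.
--
-- A clique v₁ < … < v_k is reported along the edges (v₁ , v_k), (v₂ , v_{k-1}), …
-- only.  So reports that are permutations of each other are equal, and it
-- suffices that the list of reports has no duplicates.
module Submission where

open import Defs
import Algebra.Properties.CommutativeSemigroup as CommutativeSemigroup
open import Algebra.Bundles using (CommutativeMonoid)
open import Data.Bool using (true; false; if_then_else_; T)
open import Data.Fin as Fin using (Fin; toℕ; fromℕ<)
import Data.Fin.Properties as Fin
import Data.Integer as ℤ
import Data.Integer.Properties as ℤ
open import Data.List
  using (List; []; _∷_; _++_; map; length; filter; applyUpTo; catMaybes; allFin; tabulate; concatMap; _∷ʳ_; initLast; _∷ʳ′_)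
open import Data.List.Extrema.Nat using (xs≤max)
import Data.List.Membership.DecPropositional as DecMembership
open import Data.List.Membership.Propositional using (_∈_; _∉_; lose)
open import Data.List.Membership.Propositional.Properties
  using (∈-concatMap⁺; ∈-allFin; ∈-filter⁺; ∈-filter⁻; ∈-map⁺; ∈-map⁻; ∈-∃++; ∈-++⁺ˡ; ∈-++⁺ʳ; ∈-++⁻;
         ∈-upTo⁺; ∈-upTo⁻; ∈-applyUpTo⁺)
import Data.List.Properties as List
open import Data.List.Relation.Binary.Permutation.Propositional using (_↭_; prep; ↭-refl; ↭-sym; ↭-trans; ↭⇒↭ₛ)
open import Data.List.Relation.Binary.Permutation.Propositional.Properties
  using (∈-resp-↭; ↭-length; filter-↭; drop-mid; shift; ++⁺ʳ)
import Data.List.Relation.Binary.Permutation.Setoid.Properties as PermutationSetoid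
open import Data.List.Relation.Unary.All as All using (All; []; _∷_; all?)
import Data.List.Relation.Unary.All.Properties as All
open import Data.List.Relation.Unary.AllPairs as AllPairs using (AllPairs; []; _∷_)
import Data.List.Relation.Unary.AllPairs.Properties as AllPairs
open import Data.List.Relation.Unary.Any using (here; there)
open import Data.List.Relation.Unary.Linked.Properties using (Linked⇒AllPairs)
import Data.List.Relation.Unary.Unique.DecPropositional as DecUnique
open import Data.List.Relation.Unary.Unique.Propositional using (Unique)
import Data.List.Relation.Unary.Unique.Propositional.Properties as Unique
open import Data.Maybe using (Maybe; just; nothing; is-just)
open import Data.Maybe.Properties using (just-injective)
open import Data.Nat hiding (_/_)
open import Data.Nat.Logarithm using (⌈log₂_⌉; ⌈log₂⌉-mono-≤; ⌈log₂⌈n/2⌉⌉≡⌈log₂n⌉∸1)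
open import Data.Nat.Properties
open import Data.Nat.Tactic.RingSolver using (solve-∀)
open import Data.Product using (_×_; _,_; proj₁; proj₂; ∃-syntax)
open import Data.Rational as ℚ using (_/_; toℚᵘ)
import Data.Rational.Properties as ℚ
open import Data.Rational.Unnormalised as ℚᵘ using (mkℚᵘ)
import Data.Rational.Unnormalised.Properties as ℚᵘ
open import Data.Sum using (_⊎_; inj₁; inj₂)
open import Data.Unit using (⊤; tt)
open import Function using (_∘_; id; _$_)
open import Relation.Binary.Construct.Closure.ReflexiveTransitive using (ε; _◅_)
open import Relation.Binary.Construct.Closure.Symmetric using (fwd; bwd)
open import Relation.Binary.Definitions using (tri<; tri≈; tri>)
open import Relation.Binary.PropositionalEquality
open import Relation.Nullary using (¬_; Dec; yes; no; does; Reflects; ofʸ; ofⁿ; contradiction)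
open import Relation.Nullary.Decidable using (dec-true)
open import Relation.Nullary.Reflects using (det)
open import Relation.Unary using (Decidable)
open import Data.List.Membership.DecPropositional _≟_ using (_∈?_)
import Data.List.Sort ≤-decTotalOrder as Sort

-- The obstacle is uniformity of the constants: the recursion is about k/2 levels deep, so a
-- constant that grew from level to level would not be hidden by O. The recursive lemmas therefore
-- carry fixed numerals, and the room for one more level comes from the summand c in the factor c +
-- k. Each level lowers c by 2, which frees 2 · 400 · (r + c choose c) units of work for the pairs
-- of that level, while k pays for the reports. In the depth, the summand `suc c * suc L` has the
-- same purpose. Cost and correctness are derived together. A bound is always attached to an
-- equation that gives the outcome of the program, so that the absence of crashes, in particular of
-- write conflicts, needs no separate argument. Since fresh memory is arbitrary, nothing is ever
-- claimed about cells that were not written. All estimates are kept in natural numbers, with powers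
-- of 2 as cleared denominators; rationals enter at the very end. Truncated subtraction then makes
-- the case γ < k - 2, in which no call takes place, a case of its own.

variable
  A B : Set
  a a′ b b′ d i n w x x′ y y′ : ℕ

-- Finite sums

∑ : (ℕ → ℕ) → ℕ → ℕ
∑ f zero    = 0
∑ f (suc n) = ∑ f n + f n

∑-suc : ∀ (f : ℕ → ℕ) n → ∑ f (suc n) ≡ f 0 + ∑ (f ∘ suc) n
∑-suc f zero    = sym (+-identityʳ (f 0))
∑-suc f (suc n) = begin
  ∑ f (suc n) + f (suc n)              ≡⟨ cong (_+ f (suc n)) (∑-suc f n) ⟩
  f 0 + ∑ (f ∘ suc) n + f (suc n)      ≡⟨ +-assoc (f 0) _ _ ⟩
  f 0 + (∑ (f ∘ suc) n + f (suc n))    ∎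
  where open ≡-Reasoning

∑-mono : ∀ {f g : ℕ → ℕ} n → (∀ {i} → i < n → f i ≤ g i) → ∑ f n ≤ ∑ g n
∑-mono zero    f≤g = z≤n
∑-mono (suc n) f≤g = +-mono-≤ (∑-mono n (f≤g ∘ m<n⇒m<1+n)) (f≤g (n<1+n n))

∑-cong : ∀ {f g : ℕ → ℕ} n → (∀ {i} → i < n → f i ≡ g i) → ∑ f n ≡ ∑ g n
∑-cong n f≡g = ≤-antisym (∑-mono n (≤-reflexive ∘ f≡g)) (∑-mono n (≤-reflexive ∘ sym ∘ f≡g))

∑-const : ∀ c n → ∑ (λ _ → c) n ≡ n * c
∑-const c zero    = refl
∑-const c (suc n) = trans (cong (_+ c) (∑-const c n)) (+-comm (n * c) c)

∑-≤ : ∀ {f : ℕ → ℕ} {c} n → (∀ {i} → i < n → f i ≤ c) → ∑ f n ≤ n * c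
∑-≤ {c = c} n f≤c = ≤-trans (∑-mono n f≤c) (≤-reflexive (∑-const c n))

∑-+ : ∀ (f g : ℕ → ℕ) n → ∑ (λ i → f i + g i) n ≡ ∑ f n + ∑ g n
∑-+ f g zero    = refl
∑-+ f g (suc n) = trans (cong (_+ (f n + g n)) (∑-+ f g n)) (interchange (∑ f n) (∑ g n) (f n) (g n))
  where
  interchange : ∀ p q r s → p + q + (r + s) ≡ p + r + (q + s)
  interchange = solve-∀

∑-*ʳ : ∀ (f : ℕ → ℕ) c n → ∑ (λ i → f i * c) n ≡ ∑ f n * c
∑-*ʳ f c zero    = refl
∑-*ʳ f c (suc n) = trans (cong (_+ f n * c) (∑-*ʳ f c n)) (sym (*-distribʳ-+ c (∑ f n) (f n)))

∑-reverse : ∀ (f : ℕ → ℕ) n → ∑ (λ i → f (n ∸ i)) n ≡ ∑ (f ∘ suc) n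
∑-reverse f zero    = refl
∑-reverse f (suc n) = begin
  ∑ (λ i → f (suc n ∸ i)) (suc n)    ≡⟨ ∑-suc (λ i → f (suc n ∸ i)) n ⟩
  f (suc n) + ∑ (λ i → f (n ∸ i)) n  ≡⟨ cong (f (suc n) +_) (∑-reverse f n) ⟩
  f (suc n) + ∑ (f ∘ suc) n          ≡⟨ +-comm (f (suc n)) _ ⟩
  ∑ (f ∘ suc) n + f (suc n)          ∎
  where open ≡-Reasoning

-- A calculus of cost bounds

-- In Runs x y p a b Q the numbers a and b are the constants hidden in the
-- bounds O(x) on the work and O(y) on the depth of p.
record Runs (x y : ℕ) (p : PRAM A) (a b : ℕ) (Q : A → List (List ℕ) → Set) : Set where
  constructor runs
  field
    {value}      : A
    {reported}   : List (List ℕ)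
    {work depth} : ℕ
    equation     : p ≡ just (outcome value reported work depth)
    work≤        : work ≤ x * a
    depth≤       : depth ≤ y * b
    holds        : Q value reported

-- Apart from the loops that end in `report`, code reports nothing. `_≫=_` asks this of its first
-- program, so that the reports of a composition are those of the second one and no concatenation
-- arises.
Silent : (A → Set) → A → List (List ℕ) → Set
Silent Q v rs = rs ≡ [] × Q v

private variable
  p q   : PRAM A
  f     : A → PRAM B
  P     : Set
  Q R   : A → List (List ℕ) → Set
  Q′ R′ : A → Set

widen : x ≤ x′ → y ≤ y′ → Runs x y p a b Q → Runs x′ y′ p a b Q
widen {a = a} {b = b} x≤x′ y≤y′ (runs e w≤ d≤ h) =
  runs e (≤-trans w≤ (*-monoˡ-≤ a x≤x′)) (≤-trans d≤ (*-monoˡ-≤ b y≤y′)) h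

within : a ≤ a′ → b ≤ b′ → Runs x y p a b Q → Runs x y p a′ b′ Q
within {x = x} {y = y} a≤a′ b≤b′ (runs e w≤ d≤ h) =
  runs e (≤-trans w≤ (*-monoʳ-≤ x a≤a′)) (≤-trans d≤ (*-monoʳ-≤ y b≤b′)) h

-- The rules assemble the constants along the shape of the program. They are closed numbers, so
-- rounding them up to a numeral is left to evaluation.
upTo : Runs x y p a b Q → {T (a ≤ᵇ a′)} → {T (b ≤ᵇ b′)} → Runs x y p a′ b′ Q
upTo r {a≤a′} {b≤b′} = within (≤ᵇ⇒≤ _ _ a≤a′) (≤ᵇ⇒≤ _ _ b≤b′) r

-- The rules add constants under one common unit, but a recursive call is measured in a unit of its
-- own. With units 1 the constants are the actual numbers, and costs of different shapes can be
-- added; `bounded` returns to a proper unit.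
exactly : Runs x y p a b Q → Runs 1 1 p (x * a) (y * b) Q
exactly (runs e w≤ d≤ h) = runs e (≤-trans w≤ (≤-reflexive (sym (*-identityˡ _))))
                                  (≤-trans d≤ (≤-reflexive (sym (*-identityˡ _)))) h

bounded : w ≤ x * a → d ≤ y * b → Runs 1 1 p w d Q → Runs x y p a b Q
bounded w≤ d≤ (runs e w≤′ d≤′ h) = runs e (≤-trans w≤′ (≤-trans (≤-reflexive (*-identityˡ _)) w≤))
                                          (≤-trans d≤′ (≤-trans (≤-reflexive (*-identityˡ _)) d≤)) h

mapPost : (∀ {v rs} → Q v rs → R v rs) → Runs x y p a b Q → Runs x y p a b R
mapPost Q⇒R (runs e w≤ d≤ h) = runs e w≤ d≤ (Q⇒R h)

1+-≤-* : ∀ x c {w} → .{{NonZero x}} → w ≤ x * c → suc w ≤ x * suc c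
1+-≤-* x@(suc m) c w≤ = ≤-trans (+-mono-≤ (s≤s (z≤n {m})) w≤) (≤-reflexive (sym (*-suc x c)))

ret : ∀ {v : A} → Q′ v → Runs x y (return v) 0 0 (Silent Q′)
ret h = runs refl z≤n z≤n (refl , h)

-- Unit-cost instructions are all a `step`, and `step v >>= f` evaluates to `after [] 1 1 (f v)`;
-- hence one rule serves them all.
tick : .{{NonZero x}} → .{{NonZero y}} → Runs x y q a b Q → Runs x y (after [] 1 1 q) (suc a) (suc b) Q
tick {x = x} {y = y} (runs refl w≤ d≤ h) = runs refl (1+-≤-* x _ w≤) (1+-≤-* y _ d≤) h

infixr 1 _≫=_
_≫=_ : Runs x y p a b (Silent Q′) → (∀ {v} → Q′ v → Runs x y (f v) a′ b′ R) →
       Runs x y (p >>= f) (a + a′) (b + b′) R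
_≫=_ {x = x} {y = y} {a = a} {b = b} {a′ = a′} {b′ = b′} (runs refl w≤ d≤ (refl , h)) k with k h
... | runs e w≤′ d≤′ h′ = runs (cong (after [] _ _) e)
  (≤-trans (+-mono-≤ w≤ w≤′) (≤-reflexive (sym (*-distribˡ-+ x a a′))))
  (≤-trans (+-mono-≤ d≤ d≤′) (≤-reflexive (sym (*-distribˡ-+ y b b′)))) h′

branch : ∀ {t} → Reflects P t → (P → Runs x y p a b Q) → (¬ P → Runs x y q a′ b′ Q) →
         Runs x y (if t then p else q) (a ⊔ a′) (b ⊔ b′) Q
branch (ofʸ h) k l = within (m≤m⊔n _ _) (m≤m⊔n _ _) (k h)
branch (ofⁿ h) k l = within (m≤n⊔m _ _) (m≤n⊔m _ _) (l h)

branchYes : ∀ {t} → Reflects P t → P → Runs x y p a b Q → Runs x y (if t then p else q) a b Q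
branchYes (ofʸ _) _ r = r
branchYes (ofⁿ ¬h) h r = contradiction h ¬h

branchNo : ∀ {t} → Reflects P t → ¬ P → Runs x y q a b Q → Runs x y (if t then p else q) a b Q
branchNo (ofʸ h) ¬h r = contradiction h ¬h
branchNo (ofⁿ _) _ r = r

≡ᵇ-reflects-≡ : ∀ m n → Reflects (m ≡ n) (m ≡ᵇ n)
≡ᵇ-reflects-≡ m n = Dec.proof (m ≟ n)

-- Describing a cell by the outcome of reading it requires no default element and includes that the
-- read does not crash.
record Cells (Q : ℕ → A → Set) (n : ℕ) (xs : List A) : Set where
  constructor cells
  field
    extent : length xs ≡ n
    cell   : ∀ {i} → i < n → ∃[ v ] (xs ! i ≡ step v × Q i v)
open Cells public

read : {Q : ℕ → A → Set} {xs : List A} → .{{NonZero x}} → .{{NonZero y}} →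
       Cells Q n xs → i < n → Runs x y (xs ! i) 1 1 (Silent (Q i))
read {x = x} {y = y} c i<n with cell c i<n
... | v , e , h rewrite e = runs refl (1+-≤-* x 0 z≤n) (1+-≤-* y 0 z≤n) (refl , h)

-- Retains which stretch of the reports stems from which processor, so that reports of different
-- processors can be compared later.
data Gathered {A : Set} : (ℕ → A → List (List ℕ) → Set) → ℕ → List A → List (List ℕ) → Set₁ where
  []  : ∀ {Q} → Gathered Q 0 [] []
  _∷_ : ∀ {Q n v vs rs rs′} → Q 0 v rs → Gathered (λ i → Q (suc i)) n vs rs′ →
        Gathered Q (suc n) (v ∷ vs) (rs ++ rs′)

record Gathers (w d n : ℕ) (p : ℕ → PRAM A) (Q : ℕ → A → List (List ℕ) → Set) : Set₁ where
  constructor gathers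
  field
    {values}     : List A
    {reported}   : List (List ℕ)
    {work depth} : ℕ
    equation     : together (applyUpTo p n) ≡ just (outcome values reported work depth)
    work≤        : work ≤ w
    depth≤       : depth ≤ d
    holds        : Gathered Q n values reported

gather : ∀ {X : ℕ → ℕ} {y} {p : ℕ → PRAM A} {a b} {Q : ℕ → A → List (List ℕ) → Set} n →
         (∀ {i} → i < n → Runs (X i) y (p i) a b (Q i)) → Gathers (∑ X n * a) (y * b) n p Q
gather zero    h = gathers refl z≤n z≤n []
gather {X = X} {y = y} {p = p} {a = a} {b = b} (suc n) h with h (s≤s z≤n) | gather n (λ i<n → h (s≤s i<n))
... | runs e w≤ d≤ q | gathers e′ w≤′ d≤′ qs =
  gathers (cong₂ both e e′) (≤-trans (+-mono-≤ w≤ w≤′) (≤-reflexive (trans (sym (*-distribʳ-+ a (X 0) _)) (cong (_* a) (sym (∑-suc X n))))))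
               (⊔-lub d≤ d≤′) (q ∷ qs)

gathered-cells : ∀ {Q : ℕ → A → Set} {n vs rs} → Gathered (λ i → Silent (Q i)) n vs rs → rs ≡ [] × Cells Q n vs
gathered-cells []               = refl , cells refl λ ()
gathered-cells ((refl , q) ∷ g) with gathered-cells g
... | refl , cells e c = refl , cells (cong suc e)
  λ { {zero} _ → _ , refl , q ; {suc i} (s≤s i<n) → c i<n }

parallel : ∀ {X : ℕ → ℕ} {p : ℕ → PRAM A} {Q : ℕ → A → List (List ℕ) → Set} → .{{NonZero y}} → ∀ n →
           suc n ≤ x → ∑ X n ≤ x → (∀ {i} → i < n → Runs (X i) y (p i) a b (Q i)) →
           (∀ {vs rs} → Gathered Q n vs rs → R vs rs) → Runs x y (par n p) (suc a) (suc b) R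
parallel {y = y} {x = x} {a = a} {b = b} n n<x X≤x h Q⇒R with gather n h
... | gathers e w≤ d≤ g rewrite e =
  runs refl (≤-trans (+-mono-≤ n<x (≤-trans w≤ (*-monoˡ-≤ a X≤x))) (≤-reflexive (sym (*-suc x a)))) (1+-≤-* y b d≤) (Q⇒R g)

-- `gather` lets only the units vary with the processor, whereas exact bounds keep the varying work
-- among the constants; here the two trade places.
rescale : Runs 1 1 p w d Q → Runs w d p 1 1 Q
rescale (runs e w≤ d≤ h) = runs e (≤-trans w≤ (≤-reflexive (*-comm 1 _))) (≤-trans d≤ (≤-reflexive (*-comm 1 _))) h

parallelExactly : ∀ {Z : ℕ → ℕ} {p : ℕ → PRAM A} {Q : ℕ → A → List (List ℕ) → Set} n →
                  (∀ {i} → i < n → Runs 1 1 (p i) (Z i) d (Q i)) →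
                  (∀ {vs rs} → Gathered Q n vs rs → R vs rs) → Runs 1 1 (par n p) (suc n + ∑ Z n) (suc d) R
parallelExactly {d = d} n h Q⇒R with gather n (λ i<n → rescale (h i<n))
... | gathers e w≤ d≤ g rewrite e = runs refl
  (≤-trans (+-monoʳ-≤ (suc n) (≤-trans w≤ (≤-reflexive (*-identityʳ _)))) (≤-reflexive (sym (*-identityˡ _))))
  (≤-trans (s≤s (≤-trans d≤ (≤-reflexive (*-identityʳ d)))) (≤-reflexive (sym (*-identityˡ _)))) (Q⇒R g)

parSum : ∀ {x y} {X : ℕ → ℕ} {p : ℕ → PRAM A} {Q : ℕ → A → Set} → .{{NonZero y}} → ∀ n →
         suc n ≤ x → ∑ X n ≤ x → (∀ {i} → i < n → Runs (X i) y (p i) a b (Silent (Q i))) →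
         Runs x y (par n p) (suc a) (suc b) (Silent (Cells Q n))
parSum n n<x X≤x h = parallel n n<x X≤x h gathered-cells

parEach : ∀ {x y} {p : ℕ → PRAM A} {Q : ℕ → A → Set} x₁ → .{{NonZero x₁}} → .{{NonZero y}} → ∀ n →
          suc n * x₁ ≤ x → (∀ {i} → i < n → Runs x₁ y (p i) a b (Silent (Q i))) →
          Runs x y (par n p) (suc a) (suc b) (Silent (Cells Q n))
parEach x₁ n n*x₁≤x h = parSum n
  (≤-trans (m≤m*n (suc n) x₁) n*x₁≤x)
  (≤-trans (≤-reflexive (∑-const x₁ n)) (≤-trans (m≤n+m (n * x₁) x₁) n*x₁≤x)) h

parConst : ∀ {x y} {p : ℕ → PRAM A} {Q : ℕ → A → Set} → .{{NonZero y}} → ∀ n →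
           n < x → (∀ {i} → i < n → Runs 1 y (p i) a b (Silent (Q i))) →
           Runs x y (par n p) (suc a) (suc b) (Silent (Cells Q n))
parConst n n<x = parEach 1 n (≤-trans (≤-reflexive (*-identityʳ _)) n<x)

-- Serves the closing `return tt` of a reporting loop, which is not silent and hence out of reach of
-- `_≫=_`.
thenReturn : {Q : List (List ℕ) → Set} → Runs x y p a b (λ _ → Q) → Runs x y (p >> return tt) a b (λ _ → Q)
thenReturn {x = x} {y = y} {a = a} {b = b} {Q = Q} (runs {reported = rs} {w} {d} refl w≤ d≤ h) = runs refl
  (≤-trans (≤-reflexive (+-identityʳ w)) w≤) (≤-trans (≤-reflexive (+-identityʳ d)) d≤) (subst Q (sym (List.++-identityʳ rs)) h)

report-runs : ∀ {vs} → length vs < x → length vs < y → Runs x y (report vs) 1 1 (λ _ rs → rs ≡ vs ∷ [])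
report-runs <x <y = runs refl (≤-trans <x (≤-reflexive (sym (*-identityʳ _)))) (≤-trans <y (≤-reflexive (sym (*-identityʳ _)))) refl

-- Arrays and prefix sums

-- The default is the neutral element of addition, so an array of odd length is summed in pairs as
-- if it were padded by a zero.
at : List ℕ → ℕ → ℕ
at []       i       = 0
at (x ∷ xs) zero    = x
at (x ∷ xs) (suc i) = at xs i

at-≥ : ∀ xs {i} → length xs ≤ i → at xs i ≡ 0
at-≥ []                   _         = refl
at-≥ (x ∷ xs) {suc i} (s≤s n≤i) = at-≥ xs n≤i

elements : ∀ (xs : List A) → Cells (λ i v → xs ! i ≡ step v) (length xs) xs
elements []       = cells refl λ ()
elements (x ∷ xs) = cells refl λ
  { {zero} _ → x , refl , refl ; {suc i} (s≤s i<n) → cell (elements xs) i<n }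

!-at : ∀ xs {i v} → xs ! i ≡ step v → at xs i ≡ v
!-at (x ∷ xs) {zero}  refl = refl
!-at (x ∷ xs) {suc i} e    = !-at xs e

mapCells : ∀ {Q R : ℕ → A → Set} {xs} → (∀ {i v} → i < n → Q i v → R i v) → Cells Q n xs → Cells R n xs
mapCells Q⇒R (cells e c) = cells e λ i<n → let v , e′ , q = c i<n in v , e′ , Q⇒R i<n q

words : ∀ xs → Cells (λ i v → v ≡ at xs i) (length xs) xs
words xs = mapCells (λ _ e → sym (!-at xs e)) (elements xs)

at-cell : ∀ {Q : ℕ → ℕ → Set} {xs} → Cells Q n xs → i < n → Q i (at xs i)
at-cell {xs = xs} c i<n with cell c i<n
... | v , e , q rewrite !-at xs e = q

⌊n/2⌋+⌊n/2⌋≤n : ∀ n → ⌊ n /2⌋ + ⌊ n /2⌋ ≤ n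
⌊n/2⌋+⌊n/2⌋≤n n = ≤-trans (+-monoʳ-≤ ⌊ n /2⌋ (⌊n/2⌋≤⌈n/2⌉ n)) (≤-reflexive (⌊n/2⌋+⌈n/2⌉≡n n))

odd-half : ∀ i → i ≢ ⌊ i /2⌋ + ⌊ i /2⌋ → i ≡ suc (⌊ i /2⌋ + ⌊ i /2⌋)
odd-half 0             i≢ = contradiction refl i≢
odd-half 1             i≢ = refl
odd-half (suc (suc i)) i≢ rewrite +-suc ⌊ i /2⌋ ⌊ i /2⌋ =
  cong (suc ∘ suc) (odd-half i (i≢ ∘ cong (suc ∘ suc)))

∑-pairs : ∀ g i → ∑ (λ j → g (j + j) + g (j + j + 1)) i ≡ ∑ g (i + i)
∑-pairs g zero    = refl
∑-pairs g (suc i) rewrite +-suc i i | +-comm (i + i) 1 | ∑-pairs g i = sym (+-assoc (∑ g (i + i)) (g (i + i)) _)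

private module Scan (s : ℕ) (1<s : 1 < s) where
  h : ℕ
  h = ⌊ s + 1 /2⌋

  i+i<s : i < h → i + i < s
  i+i<s {i} i<h = ≤-pred (begin
    suc (suc (i + i))       ≡⟨ cong suc (sym (+-suc i i)) ⟩
    suc i + suc i           ≤⟨ +-mono-≤ i<h i<h ⟩
    h + h                   ≤⟨ ⌊n/2⌋+⌊n/2⌋≤n (s + 1) ⟩
    s + 1                   ≡⟨ +-comm s 1 ⟩
    suc s                   ∎)
    where open ≤-Reasoning

  ⌊i/2⌋<h : i < s → ⌊ i /2⌋ < h
  ⌊i/2⌋<h {i} i<s = ⌊n/2⌋-mono {suc (suc i)} (≤-trans (s≤s i<s) (≤-reflexive (+-comm 1 s)))

  h≡ : h ≡ ⌈ s /2⌉
  h≡ = cong ⌊_/2⌋ (+-comm s 1)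

  h<s : h < s
  h<s = subst (_< s) (sym h≡) (⌈n/2⌉<n′ s 1<s)
    where
    ⌈n/2⌉<n′ : ∀ n → 1 < n → ⌈ n /2⌉ < n
    ⌈n/2⌉<n′ (suc (suc n)) _        = ⌈n/2⌉<n n
    ⌈n/2⌉<n′ (suc zero)    (s≤s ())

  log-h : ⌈log₂ s ⌉ ≡ suc ⌈log₂ h ⌉
  log-h rewrite h≡ | ⌈log₂⌈n/2⌉⌉≡⌈log₂n⌉∸1 s = sym (m+[n∸m]≡n {1} (⌈log₂⌉-mono-≤ {2} 1<s))

  1≤⌊s/2⌋ : 1 ≤ ⌊ s /2⌋
  1≤⌊s/2⌋ = ⌊n/2⌋-mono 1<s

  -- The recursion is geometric: ⌊s/2⌋ of the s units pay for the work outside of the recursive call.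
  work-bound : ∀ c {w} → w ≤ suc h * (4 * c) + suc s * c → w ≤ suc s * (4 * c)
  work-bound c {w} w≤ = begin
    w                                            ≤⟨ w≤ ⟩
    suc h * (4 * c) + suc s * c                  ≤⟨ +-monoʳ-≤ (suc h * (4 * c)) (*-monoˡ-≤ c s<4r) ⟩
    suc h * (4 * c) + r * 4 * c                  ≡⟨ regroup h r c ⟩
    suc (r + h) * (4 * c)                        ≡⟨ cong (λ t → suc t * (4 * c)) r+h ⟩
    suc s * (4 * c)                              ∎
    where
    open ≤-Reasoning
    r = ⌊ s /2⌋
    r+h : r + h ≡ s
    r+h = trans (cong (r +_) h≡) (⌊n/2⌋+⌈n/2⌉≡n s)
    regroup : ∀ h r c → suc h * (4 * c) + r * 4 * c ≡ suc (r + h) * (4 * c)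
    regroup = solve-∀
    4r : ∀ r → r + r + (r + r) ≡ r * 4
    4r = solve-∀
    h≤1+r : h ≤ suc r
    h≤1+r = subst (_≤ suc r) (sym h≡) (⌊n/2⌋-mono (n≤1+n (suc s)))
    s<4r : suc s ≤ r * 4
    s<4r = begin
      suc s               ≡⟨ cong suc (sym r+h) ⟩
      suc (r + h)         ≤⟨ s≤s (+-monoʳ-≤ r h≤1+r) ⟩
      suc (r + suc r)     ≡⟨ trans (cong suc (+-suc r r)) (+-comm 2 (r + r)) ⟩
      r + r + 2           ≤⟨ +-monoʳ-≤ (r + r) (+-mono-≤ 1≤⌊s/2⌋ 1≤⌊s/2⌋) ⟩
      r + r + (r + r)     ≡⟨ 4r r ⟩
      r * 4               ∎

-- Besides the recursive call, one level costs 4 + 7 + 9 = 20 units: for the instructions outside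
-- the loops, the pair sums and the expansion. The sizes halve, so the work is a geometric series,
-- whence 80 = 4 · 20; the depth pays 20 for each halving.
scan-runs : ∀ fuel xs → length xs < fuel →
            Runs (suc (length xs)) (suc ⌈log₂ length xs ⌉) (scan fuel xs) 80 20
                 (Silent (Cells (λ i z → z ≡ ∑ (at xs) (suc i)) (length xs)))
scan-runs (suc fuel) xs s<fuel with length xs <? 2
... | yes s<2 = upTo $ tick $ tick $ branchYes (<ᵇ-reflects-< _ 2) s<2 $ ret (mapCells (short (≤-pred s<2)) (words xs))
  where
  short : ∀ {s i v} → s ≤ 1 → i < s → v ≡ at xs i → v ≡ ∑ (at xs) (suc i)
  short {i = zero}              _        _        e = e
  short {suc zero}    {suc i}   _        (s≤s ()) _
  short {suc (suc s)} {suc i}   (s≤s ())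
... | no s≮2 = bounded (work-bound 20 work≤) depth≤ $
  tick $ tick $ branchNo (<ᵇ-reflects-< _ 2) s≮2 $ tick $ tick $
  exactly (parConst {x = suc s} {y = 1} {Q = λ i z → z ≡ at xs (i + i) + at xs (i + i + 1)} h (<⇒≤ (s≤s h<s)) λ {i} i<h →
    tick $ tick $ read (words xs) (i+i<s i<h) ≫= λ { refl → tick $
    branch (<ᵇ-reflects-< (i + i + 1) s)
      (λ b<s → read (words xs) b<s ≫= λ { refl → tick (ret refl) })
      (λ b≮s → ret (sym (trans (cong (at xs (i + i) +_) (at-≥ xs (≮⇒≥ b≮s))) (+-identityʳ _)))) }) ≫= λ {ys} ys-cells →
  recurse (extent ys-cells) (≤-trans h<s (≤-pred s<fuel)) ≫= λ {zs} zs-cells →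
  exactly (parConst {x = suc s} {y = 1} s ≤-refl λ {i} i<s → let q = ⌊ i /2⌋ in
    tick $ tick $ tick $ branch (≡ᵇ-reflects-≡ i (q + q))
      (λ i≡q+q → read (words xs) i<s ≫= λ { refl → tick $ branch (≡ᵇ-reflects-≡ i 0)
        (λ i≡0 → ret (first i≡0))
        (λ i≢0 → tick $ read zs-cells (≤-<-trans (m∸n≤m q 1) (⌊i/2⌋<h i<s)) ≫= λ { refl → tick $ ret $
          cong (_+ at xs i) (trans (pairs ys-cells (≤-trans (≤-reflexive (m+[n∸m]≡n (pos i i≢0 i≡q+q))) (<⇒≤ (⌊i/2⌋<h i<s))))
            (cong (∑ (at xs)) (trans (cong (λ t → t + t) (m+[n∸m]≡n (pos i i≢0 i≡q+q))) (sym i≡q+q)))) }) })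
      -- For odd `i` the first `i + 1` entries form `q + 1` complete pairs, so cell `q` of the
      -- recursive scan is already the answer.
      (λ i≢q+q → mapPost (λ { (refl , refl) → refl ,
          trans (pairs ys-cells (⌊i/2⌋<h i<s))
            (cong (∑ (at xs)) (trans (cong suc (+-suc q q)) (cong suc (sym (odd-half i i≢q+q))))) })
        (read zs-cells (⌊i/2⌋<h i<s))))
  where
  s = length xs
  open Scan s (≮⇒≥ s≮2)
  recurse : ∀ {ys h} → length ys ≡ h → h < fuel →
            Runs 1 1 (scan fuel ys) (suc h * 80) (suc ⌈log₂ h ⌉ * 20)
                 (Silent (Cells (λ i z → z ≡ ∑ (at ys) (suc i)) h))
  recurse {ys} refl h<fuel = exactly (scan-runs fuel ys h<fuel)
  pairs : ∀ {h ys} → Cells (λ i z → z ≡ at xs (i + i) + at xs (i + i + 1)) h ys → ∀ {j} → j ≤ h → ∑ (at ys) j ≡ ∑ (at xs) (j + j)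
  pairs ys-cells {j} j≤h = trans (∑-cong j (λ i<j → at-cell ys-cells (<-≤-trans i<j j≤h))) (∑-pairs (at xs) j)
  first : ∀ {i} → i ≡ 0 → at xs i ≡ ∑ (at xs) (suc i)
  first refl = refl
  pos : ∀ i → i ≢ 0 → i ≡ ⌊ i /2⌋ + ⌊ i /2⌋ → 1 ≤ ⌊ i /2⌋
  pos 0             i≢0 _ = contradiction refl i≢0
  pos (suc (suc i)) _   _ = s≤s z≤n
  work≤ : 4 + (suc s * 7 + (suc h * 80 + suc s * 9)) ≤ suc h * 80 + suc s * 20
  work≤ = begin
    4 + (suc s * 7 + (suc h * 80 + suc s * 9))             ≤⟨ +-monoˡ-≤ _ (*-monoˡ-≤ 4 (s≤s (z≤n {s}))) ⟩
    suc s * 4 + (suc s * 7 + (suc h * 80 + suc s * 9))     ≡⟨ regroup (suc s) (suc h * 80) ⟩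
    suc h * 80 + suc s * 20                                ∎
    where
    open ≤-Reasoning
    regroup : ∀ s t → s * 4 + (s * 7 + (t + s * 9)) ≡ t + s * 20
    regroup = solve-∀
  depth≤ : 4 + (7 + (suc ⌈log₂ h ⌉ * 20 + 9)) ≤ suc ⌈log₂ s ⌉ * 20
  depth≤ rewrite log-h = ≤-reflexive (regroup (suc ⌈log₂ h ⌉ * 20))
    where
    regroup : ∀ t → 4 + (7 + (t + 9)) ≡ 20 + t
    regroup = solve-∀

prefixSums-runs : ∀ {f xs} → Cells (λ i v → v ≡ f i) n xs →
                  Runs (suc n) (suc ⌈log₂ n ⌉) (prefixSums xs) 80 20 (Silent (Cells (λ i z → z ≡ ∑ f (suc i)) n))
prefixSums-runs {xs = xs} c with refl ← extent c =
  mapPost (λ { (refl , sums) → refl , mapCells (λ i<n e → trans e (∑-cong _ λ j≤i → at-cell c (<-≤-trans j≤i i<n))) sums })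
          (scan-runs (suc (length xs)) xs ≤-refl)

total-runs : ∀ {x y f sums} → .{{NonZero x}} → .{{NonZero y}} → Cells (λ i z → z ≡ ∑ f (suc i)) n sums →
             Runs x y (total sums) 4 4 (Silent (_≡ ∑ f n))
total-runs {f = f} {sums} c with refl ← extent c =
  tick $ tick $ branch (≡ᵇ-reflects-≡ (length sums) 0)
    (λ s≡0 → ret (cong (∑ f) (sym s≡0)))
    (λ s≢0 → tick $ mapPost (λ { (refl , refl) → refl , cong (∑ f) (m+[n∸m]≡n (n≢0⇒n>0 s≢0)) })
                            (read c (∸-monoʳ-< {o = 0} (s≤s z≤n) (n≢0⇒n>0 s≢0))))

-- Lists of words as functions of the index

at-∈ : ∀ xs → i < length xs → at xs i ∈ xs
at-∈ {zero}  (x ∷ xs) _         = here refl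
at-∈ {suc i} (x ∷ xs) (s≤s i<n) = there (at-∈ xs i<n)

∈-at : ∀ {xs x} → x ∈ xs → ∃[ i ] (i < length xs × at xs i ≡ x)
∈-at (here refl)  = 0 , s≤s z≤n , refl
∈-at (there x∈xs) with ∈-at x∈xs
... | i , i<n , e = suc i , s≤s i<n , e

at-injective : ∀ {xs i j} → Unique xs → i < length xs → j < length xs → at xs i ≡ at xs j → i ≡ j
at-injective {x ∷ xs} {zero}  {zero}  _       _         _         _ = refl
at-injective {x ∷ xs} {zero}  {suc j} (x≢ ∷ _) _        (s≤s j<n) e = contradiction e (All.lookup x≢ (at-∈ xs j<n))
at-injective {x ∷ xs} {suc i} {zero}  (x≢ ∷ _) (s≤s i<n) _        e = contradiction (sym e) (All.lookup x≢ (at-∈ xs i<n))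
at-injective {x ∷ xs} {suc i} {suc j} (_ ∷ u) (s≤s i<n) (s≤s j<n) e = cong suc (at-injective u i<n j<n e)

at-ext : ∀ xs ys → length xs ≡ length ys → (∀ {i} → i < length ys → at xs i ≡ at ys i) → xs ≡ ys
at-ext []       []       _ _ = refl
at-ext (x ∷ xs) (y ∷ ys) e h = cong₂ _∷_ (h (s≤s z≤n)) (at-ext xs ys (suc-injective e) (h ∘ s≤s))

at-applyUpTo : ∀ f → i < n → at (applyUpTo f n) i ≡ f i
at-applyUpTo {zero}  {suc n} f _         = refl
at-applyUpTo {suc i} {suc n} f (s≤s i<n) = at-applyUpTo (f ∘ suc) i<n

cells-applyUpTo : ∀ {A : Set} {g : ℕ → A} {xs} → Cells (λ i v → v ≡ g i) n xs → xs ≡ applyUpTo g n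
cells-applyUpTo {zero}  {xs = []}     (cells _ c) = refl
cells-applyUpTo {suc n} {xs = x ∷ xs} (cells e c) with c (s≤s z≤n)
... | _ , refl , h = cong₂ _∷_ h (cells-applyUpTo (cells (suc-injective e) (c ∘ s≤s)))

AllPairs-at : ∀ {R : ℕ → ℕ → Set} {xs i j} → AllPairs R xs → i < j → j < length xs → R (at xs i) (at xs j)
AllPairs-at {xs = x ∷ xs} {zero}  {suc j} (r ∷ _)  _         (s≤s j<n) = All.lookup r (at-∈ xs j<n)
AllPairs-at {xs = x ∷ xs} {suc i} {suc j} (_ ∷ rs) (s≤s i<j) (s≤s j<n) = AllPairs-at rs i<j j<n

bits : {P : ℕ → Set} → Decidable P → List ℕ → ℕ → ℕ
bits P? xs i = bit (does (P? (at xs i)))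

module _ {P : ℕ → Set} (P? : Decidable P) where

  ∑-bits : ∀ xs → ∑ (bits P? xs) (length xs) ≡ length (filter P? xs)
  ∑-bits []       = refl
  ∑-bits (x ∷ xs) rewrite ∑-suc (bits P? (x ∷ xs)) (length xs) with does (P? x)
  ... | true  = cong suc (∑-bits xs)
  ... | false = ∑-bits xs

  -- Fresh memory is arbitrary, so each cell `j` of a packed array needs a writer. It is the kept
  -- entry that is preceded by exactly `j` kept entries.
  filter-source : ∀ xs {j} → j < length (filter P? xs) →
                  ∃[ i ] (i < length xs × bits P? xs i ≡ 1 × ∑ (bits P? xs) i ≡ j × at xs i ≡ at (filter P? xs) j)
  filter-source (x ∷ xs) {j} j< with P? x in eq
  filter-source (x ∷ xs) {zero}  _        | yes _ = 0 , s≤s z≤n , cong (bit ∘ does) eq , refl , refl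
  filter-source (x ∷ xs) {suc j} (s≤s j<) | yes _ with filter-source xs j<
  ... | i , i<n , b , r , e =
    suc i , s≤s i<n , b , trans (∑-suc (bits P? (x ∷ xs)) i) (cong₂ _+_ (cong (bit ∘ does) eq) r) , e
  filter-source (x ∷ xs) {j} j< | no _ with filter-source xs j<
  ... | i , i<n , b , r , e =
    suc i , s≤s i<n , b , trans (∑-suc (bits P? (x ∷ xs)) i) (cong₂ _+_ (cong (bit ∘ does) eq) r) , e

∑-monoˡ : ∀ (f : ℕ → ℕ) {i j} → i ≤ j → ∑ f i ≤ ∑ f j
∑-monoˡ f z≤n = z≤n
∑-monoˡ f {suc i} {suc j} (s≤s i≤j) with m≤n⇒m<n∨m≡n i≤j
... | inj₁ i<j  = ≤-trans (∑-monoˡ f i<j) (m≤m+n _ (f j))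
... | inj₂ refl = ≤-refl

-- Concurrent writes

entries : (ℕ → Maybe (ℕ × ℕ)) → ℕ → List (ℕ × ℕ)
entries g n = catMaybes (applyUpTo g n)

∈-entries⁻ : ∀ g n {e} → e ∈ entries g n → ∃[ i ] (i < n × g i ≡ just e)
∈-entries⁻ g (suc n) e∈ with g 0 in eq
∈-entries⁻ g (suc n) (here refl) | just _  = 0 , s≤s z≤n , eq
∈-entries⁻ g (suc n) (there e∈)  | just _  with ∈-entries⁻ (g ∘ suc) n e∈
... | i , i<n , e = suc i , s≤s i<n , e
∈-entries⁻ g (suc n) e∈          | nothing with ∈-entries⁻ (g ∘ suc) n e∈
... | i , i<n , e = suc i , s≤s i<n , e

∈-entries⁺ : ∀ g n {i e} → i < n → g i ≡ just e → e ∈ entries g n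
∈-entries⁺ g (suc n) {zero}  _         eq rewrite eq = here refl
∈-entries⁺ g (suc n) {suc i} (s≤s i<n) eq with g 0
... | just _  = there (∈-entries⁺ (g ∘ suc) n i<n eq)
... | nothing = ∈-entries⁺ (g ∘ suc) n i<n eq

entries-unique : ∀ g n → (∀ {i j a x x′} → i < n → j < n → g i ≡ just (a , x) → g j ≡ just (a , x′) → i ≡ j) →
                 Unique (map proj₁ (entries g n))
entries-unique g zero    inj = []
entries-unique g (suc n) inj with g 0 in eq
... | nothing      = entries-unique (g ∘ suc) n (λ i<n j<n e e′ → suc-injective (inj (s≤s i<n) (s≤s j<n) e e′))
... | just (a , x) = All.tabulate fresh ∷ entries-unique (g ∘ suc) n (λ i<n j<n e e′ → suc-injective (inj (s≤s i<n) (s≤s j<n) e e′))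
  where
  fresh : ∀ {b} → b ∈ map proj₁ (entries (g ∘ suc) n) → a ≢ b
  fresh b∈ refl with ∈-map⁻ proj₁ b∈
  ... | e , e∈ , refl with ∈-entries⁻ (g ∘ suc) n e∈
  ... | i , i<n , e≡ with () ← inj (s≤s z≤n) (s≤s i<n) eq e≡

module Words (init : ℕ → ℕ) where
  open Scatter init
  open Algorithm init

  contents-∈ : ∀ {a x} ws → Unique (map proj₁ ws) → (a , x) ∈ ws → contents ws a ≡ x
  contents-∈ {a} ((b , y) ∷ ws) (b≢ ∷ u) e∈ with b ≡ᵇ a | ≡ᵇ-reflects-≡ b a
  contents-∈ ((b , y) ∷ ws) (b≢ ∷ u) (here refl) | true  | ofʸ _   = refl
  contents-∈ ((b , y) ∷ ws) (b≢ ∷ u) (there e∈)  | true  | ofʸ b≡a = contradiction b≡a (All.lookup b≢ (∈-map⁺ proj₁ e∈))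
  contents-∈ ((b , y) ∷ ws) (b≢ ∷ u) (here refl) | false | ofⁿ b≢a = contradiction refl b≢a
  contents-∈ ((b , y) ∷ ws) (b≢ ∷ u) (there e∈)  | false | ofⁿ _   = contents-∈ ws u e∈

  -- The two hypotheses about `g` exclude the two ways in which `scatter` crashes. The conclusion is
  -- silent about unwritten cells, which hold whatever `init` put there.
  scatter-runs : ∀ {x y g s ws} → .{{NonZero y}} → Cells (λ i m → m ≡ g i) n ws →
                 (∀ {i a v} → i < n → g i ≡ just (a , v) → a < s) →
                 (∀ {i j a v v′} → i < n → j < n → g i ≡ just (a , v) → g j ≡ just (a , v′) → i ≡ j) →
                 n < x →
                 Runs x y (scatter s ws) 1 1
                   (Silent λ out → length out ≡ s × (∀ {i a v} → i < n → g i ≡ just (a , v) → at out a ≡ v))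
  scatter-runs {n = n} {x} {y} {g} {s} {ws} ws-cells below inj n<x = runs equation
    (≤-trans (≤-reflexive (cong suc (extent ws-cells))) (≤-trans n<x (≤-reflexive (sym (*-identityʳ x)))))
    (1+-≤-* y 0 z≤n)
    (refl , List.length-applyUpTo _ s , λ i<n e → trans (at-applyUpTo _ (below i<n e))
      (contents-∈ (catMaybes ws) unique (subst (λ ws → _ ∈ catMaybes ws) (sym ws≡) (∈-entries⁺ g n i<n e))))
    where
    ws≡ = cells-applyUpTo ws-cells
    unique : Unique (map proj₁ (catMaybes ws))
    unique rewrite ws≡ = entries-unique g n inj
    targets-below : All (_< s) (map proj₁ (catMaybes ws))
    targets-below rewrite ws≡ = All.tabulate λ b∈ → case-target b∈
      where
      case-target : ∀ {b} → b ∈ map proj₁ (entries g n) → b < s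
      case-target b∈ with ∈-map⁻ proj₁ b∈
      ... | e , e∈ , refl with ∈-entries⁻ g n e∈
      ... | i , i<n , e≡ = below i<n e≡
    equation : scatter s ws ≡ just (outcome (applyUpTo (contents (catMaybes ws)) s) [] (suc (length ws)) 1)
    equation rewrite dec-true (all? (_<? s) (map proj₁ (catMaybes ws))) targets-below
                   | dec-true (DecUnique.unique? _≟_ (map proj₁ (catMaybes ws))) unique = refl

-- Packing, sorting and indicator tables

reflects-true : ∀ t → Reflects (t ≡ true) t
reflects-true true  = ofʸ refl
reflects-true false = ofⁿ λ ()

IsOrdered : List ℕ → Set
IsOrdered = AllPairs _<_

sort-ordered : ∀ {xs} → Unique xs → IsOrdered (Sort.sort xs)
sort-ordered {xs} u = AllPairs.zipWith (λ { (x≤y , x≢y) → ≤∧≢⇒< x≤y x≢y })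
  ( Linked⇒AllPairs ≤-trans (Sort.sort-↗ xs)
  , PermutationSetoid.Unique-resp-↭ (setoid ℕ) (↭⇒↭ₛ (↭-sym (Sort.sort-↭ xs))) u)

rank : List ℕ → ℕ → ℕ
rank xs x = length (filter (_<? x) xs)

rank-at : ∀ {zs} → IsOrdered zs → i < length zs → rank zs (at zs i) ≡ i
rank-at {zero} {z ∷ zs} (z< ∷ o) _ =
  cong length (List.filter-none (_<? z) {z ∷ zs} (<-irrefl refl ∷ All.map (λ z<w w<z → <-asym z<w w<z) z<))
rank-at {suc i} {z ∷ zs} (z< ∷ o) (s≤s i<n) =
  trans (cong length (List.filter-accept (_<? at zs i) {xs = zs} (All.lookup z< (at-∈ zs i<n)))) (cong suc (rank-at o i<n))

-- A rank counts the smaller entries and is thus invariant under permutations; in an increasing list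
-- it is the index.
sorted-at-rank : ∀ {xs x} → Unique xs → x ∈ xs → rank xs x < length xs × at (Sort.sort xs) (rank xs x) ≡ x
sorted-at-rank {xs} {x} u x∈xs with ∈-at (∈-resp-↭ (↭-sym (Sort.sort-↭ xs)) x∈xs)
... | i , i<n , refl rewrite trans (sym (↭-length (filter-↭ (_<? at (Sort.sort xs) i) (Sort.sort-↭ xs)))) (rank-at (sort-ordered u) i<n) =
  ≤-trans i<n (≤-reflexive (↭-length (Sort.sort-↭ xs))) , refl

module Blocks (init : ℕ → ℕ) where
  open Words init
  open Algorithm init
  open Table

  module _ {P : ℕ → Set} (P? : Decidable P) (xs : List ℕ) where
    private
      s = length xs

      position : ℕ → ℕ
      position = ∑ (bits P? xs)

      writes : ℕ → Maybe (ℕ × ℕ)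
      writes i = if bits P? xs i ≡ᵇ 1 then just (position i , at xs i) else nothing

      writes-just : ∀ i {a v} → writes i ≡ just (a , v) → bits P? xs i ≡ 1 × a ≡ position i × v ≡ at xs i
      writes-just i e with bits P? xs i ≡ᵇ 1 in eq
      writes-just i refl | true = ≡ᵇ⇒≡ _ _ (subst T (sym eq) tt) , refl , refl

      position-< : ∀ {i j} → bits P? xs i ≡ 1 → i < j → position i < position j
      position-< {i} b i<j = ≤-trans (≤-reflexive (trans (+-comm 1 _) (cong (position i +_) (sym b)))) (∑-monoˡ (bits P? xs) i<j)

      position-injective : ∀ {i j} → bits P? xs i ≡ 1 → bits P? xs j ≡ 1 → position i ≡ position j → i ≡ j
      position-injective {i} {j} bᵢ bⱼ e with <-cmp i j
      ... | tri< i<j _ _ = contradiction e (<⇒≢ (position-< bᵢ i<j))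
      ... | tri≈ _ i≡j _ = i≡j
      ... | tri> _ _ j<i = contradiction (sym e) (<⇒≢ (position-< bⱼ j<i))

    pack-runs : ∀ {test} → (∀ {w} → w ∈ xs → Runs 1 1 (test w) 10 10 (Silent (Reflects (P w)))) →
                Runs (suc s) (suc ⌈log₂ s ⌉) (pack xs test) 110 50 (Silent (_≡ filter P? xs))
    pack-runs {test} test-runs = upTo $ tick $
      parConst s ≤-refl (λ i<s → read (words xs) i<s ≫= λ { refl →
        widen ≤-refl (s≤s z≤n) (test-runs (at-∈ xs i<s)) ≫= λ r → ret (cong bit (det r (Dec.proof (P? _)))) }) ≫= λ flags-cells →
      prefixSums-runs flags-cells ≫= λ sums-cells →
      total-runs sums-cells ≫= λ { refl →
      parConst {Q = λ i m → m ≡ writes i} s ≤-refl (λ {i} i<s → read flags-cells i<s ≫= λ { refl → tick $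
        branch (reflects-true (bits P? xs i ≡ᵇ 1))
          (λ t → read (words xs) i<s ≫= λ { refl → read sums-cells i<s ≫= λ { refl → tick (ret (kept i t)) } })
          (λ t → ret (dropped i t)) }) ≫= λ ws-cells →
      mapPost (λ { (refl , n≡ , h) → refl , packed n≡ h })
        (scatter-runs ws-cells
          (λ {i} i<s e → let b , a≡ , _ = writes-just i e in ≤-trans (≤-reflexive (cong suc a≡)) (position-< b i<s))
          (λ {i} {j} i<s j<s e e′ → let b , a≡ , _ = writes-just i e ; b′ , a≡′ , _ = writes-just j e′ in
            position-injective b b′ (trans (sym a≡) a≡′))
          ≤-refl) }
      where
      -- The prefix sums are inclusive and count the kept entry itself, which is why the program
      -- subtracts 1.
      kept : ∀ i → (bits P? xs i ≡ᵇ 1) ≡ true → just (position (suc i) ∸ 1 , at xs i) ≡ writes i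
      kept i t rewrite t | ≡ᵇ⇒≡ (bits P? xs i) 1 (subst T (sym t) tt) = cong (λ a → just (a , at xs i)) (m+n∸n≡m (position i) 1)
      dropped : ∀ i → (bits P? xs i ≡ᵇ 1) ≢ true → nothing ≡ writes i
      dropped i t with bits P? xs i ≡ᵇ 1
      ... | true  = contradiction refl t
      ... | false = refl
      packed : ∀ {out} → length out ≡ position s → (∀ {i a v} → i < s → writes i ≡ just (a , v) → at out a ≡ v) → out ≡ filter P? xs
      packed {out} n≡ h = at-ext out _ (trans n≡ (∑-bits P? xs)) λ j<n →
        let i , i<s , b , r , e = filter-source P? xs j<n
        in trans (cong (at out) (sym r)) (trans (h i<s (cong (λ t → if t ≡ᵇ 1 then just (position i , at xs i) else nothing) b)) e)

  sort-runs : ∀ {xs} → Unique xs →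
              Runs (suc (length xs) * suc (length xs)) (suc ⌈log₂ length xs ⌉) (sort xs) 110 50 (Silent (_≡ Sort.sort xs))
  sort-runs {xs} u = upTo $ tick $
    parEach {Q = λ i m → m ≡ just (rank xs (at xs i) , at xs i)} (suc s) s ≤-refl (λ {i} i<s → read (words xs) i<s ≫= λ { refl →
      parConst {Q = λ j v → v ≡ bits (_<? at xs i) xs j} s ≤-refl (λ j<s → read (words xs) j<s ≫= λ { refl → tick (ret refl) }) ≫= λ flags-cells →
      prefixSums-runs flags-cells ≫= λ sums-cells →
      total-runs sums-cells ≫= λ { refl → ret (cong (λ r → just (r , at xs i)) (∑-bits (_<? at xs i) xs)) } }) ≫= λ ws-cells →
    mapPost (λ { {out} (refl , n≡ , h) → refl , at-ext _ _ (trans n≡ (sym (↭-length (Sort.sort-↭ xs)))) (sorted {out} h) })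
      (scatter-runs ws-cells
        (λ { i<s refl → proj₁ (sorted-at-rank u (at-∈ xs i<s)) })
        (λ i<s j<s e e′ → at-injective u i<s j<s (same-rank i<s j<s (trans (cong proj₁ (just-injective e)) (sym (cong proj₁ (just-injective e′))))))
        (m≤m*n (suc s) (suc s)))
    where
    s = length xs
    same-rank : ∀ {i j} → i < s → j < s → rank xs (at xs i) ≡ rank xs (at xs j) → at xs i ≡ at xs j
    same-rank i<s j<s e = trans (sym (proj₂ (sorted-at-rank u (at-∈ xs i<s))))
      (trans (cong (at (Sort.sort xs)) e) (proj₂ (sorted-at-rank u (at-∈ xs j<s))))
    sorted : ∀ {out} → (∀ {i a v} → i < s → just (rank xs (at xs i) , at xs i) ≡ just (a , v) → at out a ≡ v) →
             ∀ {j} → j < length (Sort.sort xs) → at out j ≡ at (Sort.sort xs) j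
    sorted {out} h {j} j<n with ∈-at (∈-resp-↭ (Sort.sort-↭ xs) (at-∈ (Sort.sort xs) j<n))
    ... | i , i<s , e = trans (cong (at out) (sym rank≡j)) (trans (h i<s refl) e)
      where
      rank≡j : rank xs (at xs i) ≡ j
      rank≡j = trans (sym (↭-length (filter-↭ (_<? at xs i) (Sort.sort-↭ xs))))
        (trans (cong (rank (Sort.sort xs)) e) (rank-at (sort-ordered u) j<n))

  -- Only the slots of members are constrained. The others are uninitialised, and a lookup defends
  -- itself by comparing the position found with `members`.
  record IsTable (n : ℕ) (xs : List ℕ) (T : Table) : Set where
    field
      members≡ : members T ≡ xs
      slots#   : length (slots T) ≡ n
      slot     : ∀ {i} → i < length xs → at (slots T) (at xs i) ≡ i

  buildTable-runs : ∀ {n xs y} → .{{NonZero y}} → Unique xs → All (_< n) xs → Runs (suc (length xs)) y (buildTable n xs) 5 5 (Silent (IsTable n xs))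
  buildTable-runs {n} {xs} u below = upTo $ tick $
    parConst s ≤-refl (λ i<s → read (words xs) i<s ≫= λ { refl → ret refl }) ≫= λ ws-cells →
    scatter-runs {g = λ i → just (at xs i , i)} ws-cells
      (λ { i<s refl → All.lookup below (at-∈ xs i<s) })
      (λ i<s j<s e e′ → at-injective u i<s j<s (trans (cong proj₁ (just-injective e)) (sym (cong proj₁ (just-injective e′)))))
      ≤-refl ≫= λ { (n≡ , h) →
    ret (record { members≡ = refl ; slots# = n≡ ; slot = λ i<s → h i<s refl }) }
    where s = length xs

  Position : List ℕ → ℕ → Maybe ℕ → Set
  Position xs x (just p) = p < length xs × at xs p ≡ x
  Position xs x nothing  = x ∉ xs

  find-runs : ∀ {n xs T x v w} → .{{NonZero v}} → .{{NonZero w}} → IsTable n xs T → x < n → Runs v w (find T x) 5 5 (Silent (Position xs x))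
  find-runs {xs = xs} {table xs slots} {x} record { members≡ = refl ; slots# = refl ; slot = slot } x<n =
    read (words slots) x<n ≫= λ { refl → tick $ tick $ branch (<ᵇ-reflects-< k (length xs))
      (λ p<s → read (words xs) p<s ≫= λ { refl → tick (ret (hit p<s)) })
      -- The slot of a member holds a valid position, so an invalid one proves absence, whatever its
      -- origin.
      (λ p≮s → ret λ x∈ → p≮s (proj₁ (at-slot x∈))) }
    where
    k : ℕ
    k = at slots x
    at-slot : x ∈ xs → k < length xs × at xs k ≡ x
    at-slot x∈ with ∈-at x∈
    ... | i , i<s , refl rewrite slot i<s = i<s , refl
    hit : k < length xs → Position xs x (if at xs k ≡ᵇ x then just k else nothing)
    hit p<s with at xs k ≡ᵇ x | ≡ᵇ-reflects-≡ (at xs k) x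
    ... | true  | ofʸ e = p<s , e
    ... | false | ofⁿ e = λ x∈ → e (proj₂ (at-slot x∈))

  member-runs : ∀ {n xs T x v w} → .{{NonZero v}} → .{{NonZero w}} → IsTable n xs T → x < n → Runs v w (member T x) 5 5 (Silent (Reflects (x ∈ xs)))
  member-runs {xs = xs} {x = x} T-table x<n = find-runs T-table x<n ≫= λ r → ret (found r)
    where
    found : ∀ {r} → Position xs x r → Reflects (x ∈ xs) (is-just r)
    found {just p}  (p<s , refl) = ofʸ (at-∈ xs p<s)
    found {nothing} x∉           = ofⁿ x∉

unique-⊆-length : ∀ {xs ys : List A} → Unique xs → (∀ {x} → x ∈ xs → x ∈ ys) → length xs ≤ length ys
unique-⊆-length {xs = []}     _        _   = z≤n
unique-⊆-length {xs = x ∷ xs} (x≢ ∷ u) sub with ∈-∃++ (sub (here refl))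
... | as , bs , refl = ≤-trans (s≤s (unique-⊆-length u sub′)) (≤-reflexive (sym (↭-length (shift x as bs))))
  where
  sub′ : ∀ {y} → y ∈ xs → y ∈ as ++ bs
  sub′ y∈xs with ∈-resp-↭ (shift x as bs) (sub (there y∈xs))
  ... | here refl = contradiction refl (All.lookup x≢ y∈xs)
  ... | there y∈  = y∈

-- Enumerations of sets of lists

record Enumerates (P : List ℕ → Set) (rs : List (List ℕ)) : Set where
  constructor enumerates
  field
    unique   : Unique rs
    sound    : ∀ {o} → o ∈ rs → P o
    complete : ∀ {o} → P o → o ∈ rs
open Enumerates public

mapEnumerates : ∀ {P R : List ℕ → Set} {rs} → (∀ {o} → P o → R o) → (∀ {o} → R o → P o) → Enumerates P rs → Enumerates R rs
mapEnumerates P⇒R R⇒P e = enumerates (unique e) (P⇒R ∘ sound e) (complete e ∘ R⇒P)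

enumerates-none : ∀ {P : List ℕ → Set} → (∀ {o} → ¬ P o) → Enumerates P []
enumerates-none ¬P = enumerates [] (λ ()) (λ h → contradiction h ¬P)

enumerates-one : ∀ {P : List ℕ → Set} {r rs} → P r → (∀ {o} → P o → o ≡ r) → rs ≡ r ∷ [] → Enumerates P rs
enumerates-one Pr only refl = enumerates ([] ∷ []) (λ { (here refl) → Pr }) (here ∘ only)

-- Disjointness is expressed as: a report determines the processor it comes from. This keeps the
-- concatenation free of duplicates.
gathered-enumerates : ∀ {P : ℕ → List ℕ → Set} {n} {vs : List A} {rs} →
  (∀ {i j o} → i < n → j < n → P i o → P j o → i ≡ j) →
  Gathered (λ i _ → Enumerates (P i)) n vs rs → Enumerates (λ o → ∃[ i ] (i < n × P i o)) rs
gathered-enumerates disjoint [] = enumerates-none λ ()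
gathered-enumerates {P = P} {suc n} disjoint (_∷_ {rs = rs} {rs′ = rs′} e g) = enumerates
  (Unique.++⁺ (unique e) (unique e′) (λ { (o∈ , o∈′) → let i , i<n , h = sound e′ o∈′ in
    contradiction (disjoint (s≤s z≤n) (s≤s i<n) (sound e o∈) h) λ () }))
  (λ o∈ → split (∈-++⁻ rs o∈))
  λ { (zero , _ , h) → ∈-++⁺ˡ (complete e h) ; (suc i , s≤s i<n , h) → ∈-++⁺ʳ rs (complete e′ (i , i<n , h)) }
  where
  e′ : Enumerates (λ o → ∃[ i ] (i < n × P (suc i) o)) rs′
  e′ = gathered-enumerates (λ i<n j<n h h′ → suc-injective (disjoint (s≤s i<n) (s≤s j<n) h h′)) g
  split : ∀ {o} → o ∈ rs ⊎ o ∈ rs′ → ∃[ i ] (i < suc n × P i o)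
  split (inj₁ o∈) = 0 , s≤s z≤n , sound e o∈
  split (inj₂ o∈) = let i , i<n , h = sound e′ o∈ in suc i , s≤s i<n , h

-- Oriented graphs on ranks

-- The program computes with words, so the neighbours are a total function on ℕ. The last two fields
-- together force `out u` to be empty for `u ≥ n`.
record Digraph (n : ℕ) : Set where
  field
    out        : ℕ → List ℕ
    out-unique : ∀ u → Unique (out u)
    out-above  : ∀ u → All (u <_) (out u)
    out-below  : ∀ u → All (_< n) (out u)

module Cliques {n : ℕ} (D : Digraph n) where
  open Digraph D

  E : ℕ → ℕ → Set
  E u v = v ∈ out u

  E⇒< : ∀ {u v} → E u v → u < v
  E⇒< = All.lookup (out-above _)

  E⇒<n : ∀ {u v} → E u v → v < n
  E⇒<n = All.lookup (out-below _)

  degree : ℕ → ℕ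
  degree u = length (out u)

  degree≤n : ∀ u → degree u ≤ n
  degree≤n u = ≤-trans (unique-⊆-length (out-unique u) (∈-upTo⁺ ∘ E⇒<n)) (≤-reflexive (List.length-upTo n))

  unsortedCommunity : ℕ → ℕ → List ℕ
  unsortedCommunity u v = filter (λ w → v ∈? out w) (out u)

  C : ℕ → ℕ → List ℕ
  C u v = Sort.sort (unsortedCommunity u v)

  C-ordered : ∀ u v → IsOrdered (C u v)
  C-ordered u v = sort-ordered (Unique.filter⁺ (λ w → v ∈? out w) (out-unique u))

  C-length : ∀ u v → length (C u v) ≡ length (unsortedCommunity u v)
  C-length u v = ↭-length (Sort.sort-↭ (unsortedCommunity u v))

  ∈-C⁻ : ∀ {u v w} → w ∈ C u v → E u w × E w v
  ∈-C⁻ {u} {v} w∈ = ∈-filter⁻ (λ w → v ∈? out w) (∈-resp-↭ (Sort.sort-↭ (unsortedCommunity u v)) w∈)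

  ∈-C⁺ : ∀ {u v w} → E u w → E w v → w ∈ C u v
  ∈-C⁺ {u} {v} e e′ = ∈-resp-↭ (↭-sym (Sort.sort-↭ (unsortedCommunity u v))) (∈-filter⁺ (λ w → v ∈? out w) e e′)

  Adj : ℕ → ℕ → Set
  Adj u v = E u v ⊎ E v u

  Adj⇒≢ : ∀ {u v} → Adj u v → u ≢ v
  Adj⇒≢ (inj₁ e) refl = <-irrefl refl (E⇒< e)
  Adj⇒≢ (inj₂ e) refl = <-irrefl refl (E⇒< e)

  Between : (ℕ → Set) → ℕ → ℕ → ℕ → Set
  Between S x y w = S w × E x w × E w y

  -- A c-clique of vertices in S as the algorithm reports it: first the
  -- innermost vertex or edge, last the edge from its least to its greatest vertex.
  Onion : ℕ → (ℕ → Set) → List ℕ → Set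
  Onion 0             S q = q ≡ []
  Onion 1             S q = ∃[ x ] (S x × q ≡ x ∷ [])
  Onion (suc (suc c)) S q = ∃[ x ] ∃[ y ] ∃[ p ] (S x × S y × E x y × Onion c (Between S x y) p × q ≡ p ++ x ∷ y ∷ [])

  onion-mono : ∀ c {S S′ : ℕ → Set} {q} → (∀ {w} → S w → S′ w) → Onion c S q → Onion c S′ q
  onion-mono 0             S⇒ h = h
  onion-mono 1             S⇒ (x , Sx , e) = x , S⇒ Sx , e
  onion-mono (suc (suc c)) S⇒ (x , y , p , Sx , Sy , Exy , h , e) =
    x , y , p , S⇒ Sx , S⇒ Sy , Exy , onion-mono c (λ { (Sw , between) → S⇒ Sw , between }) h , e

  onion-length : ∀ c {S : ℕ → Set} {q} → Onion c S q → length q ≡ c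
  onion-length 0             refl = refl
  onion-length 1             (x , _ , refl) = refl
  onion-length (suc (suc c)) (x , y , p , _ , _ , _ , h , refl) =
    trans (List.length-++ p) (trans (cong (_+ 2) (onion-length c h)) (+-comm c 2))

  onion-⊆ : ∀ c {S : ℕ → Set} {q w} → Onion c S q → w ∈ q → S w
  onion-⊆ 0             refl ()
  onion-⊆ 1             (x , Sx , refl) (here refl) = Sx
  onion-⊆ (suc (suc c)) (x , y , p , Sx , Sy , _ , h , refl) w∈ with ∈-++⁻ p w∈
  ... | inj₁ w∈p                 = proj₁ (onion-⊆ c h w∈p)
  ... | inj₂ (here refl)         = Sx
  ... | inj₂ (there (here refl)) = Sy

  onion-adjacent : ∀ c {S : ℕ → Set} {q} → Onion c S q → AllPairs Adj q
  onion-adjacent 0             refl = []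
  onion-adjacent 1             (x , _ , refl) = [] ∷ []
  onion-adjacent (suc (suc c)) (x , y , p , _ , _ , Exy , h , refl) =
    AllPairs.++⁺ (onion-adjacent c h) ((inj₁ Exy ∷ []) ∷ [] ∷ [])
      (All.tabulate λ w∈ → let _ , Exw , Ewy = onion-⊆ c h w∈ in inj₂ Exw ∷ inj₁ Ewy ∷ [])

  -- This justifies the pruning of the algorithm: small communities and close pairs are skipped
  -- because a clique needs `c` distinct vertices to draw from.
  onion-size : ∀ c {S : ℕ → Set} {q ys} → Onion c S q → (∀ {w} → S w → w ∈ ys) → c ≤ length ys
  onion-size c {q = q} h S⊆ys = subst (_≤ _) (onion-length c h)
    (unique-⊆-length (AllPairs.map Adj⇒≢ (onion-adjacent c h)) (S⊆ys ∘ onion-⊆ c h))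

  onion-least : ∀ c {S : ℕ → Set} {p x y w} → E x y → Onion c (Between S x y) p → w ∈ p ++ x ∷ y ∷ [] → x ≤ w
  onion-least c {p = p} Exy h w∈ with ∈-++⁻ p w∈
  ... | inj₁ w∈p                 = <⇒≤ (E⇒< (proj₁ (proj₂ (onion-⊆ c h w∈p))))
  ... | inj₂ (here refl)         = ≤-refl
  ... | inj₂ (there (here refl)) = <⇒≤ (E⇒< Exy)

  onion-greatest : ∀ c {S : ℕ → Set} {p x y w} → E x y → Onion c (Between S x y) p → w ∈ p ++ x ∷ y ∷ [] → w ≤ y
  onion-greatest c {p = p} Exy h w∈ with ∈-++⁻ p w∈
  ... | inj₁ w∈p                 = <⇒≤ (E⇒< (proj₂ (proj₂ (onion-⊆ c h w∈p))))
  ... | inj₂ (here refl)         = <⇒≤ (E⇒< Exy)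
  ... | inj₂ (there (here refl)) = ≤-refl

  -- The outer edge joins the least and the greatest entry, and these depend on the set of entries
  -- alone. Deleting the common edge with `drop-mid` leaves inner parts that are again permutations
  -- of each other.
  onion-↭ : ∀ c {S S′ : ℕ → Set} {q q′} → Onion c S q → Onion c S′ q′ → q ↭ q′ → q ≡ q′
  onion-↭ 0 refl refl _ = refl
  onion-↭ 1 (x , _ , refl) (x′ , _ , refl) q↭q′ with ∈-resp-↭ q↭q′ (here refl)
  ... | here refl = refl
  onion-↭ (suc (suc c)) (x , y , p , _ , _ , e , h , refl) (x′ , y′ , p′ , _ , _ , e′ , h′ , refl) q↭q′
    with refl ← ≤-antisym (onion-least c e h (∈-resp-↭ (↭-sym q↭q′) (∈-++⁺ʳ p′ (here refl))))
                          (onion-least c e′ h′ (∈-resp-↭ q↭q′ (∈-++⁺ʳ p (here refl))))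
       | refl ← ≤-antisym (onion-greatest c e′ h′ (∈-resp-↭ q↭q′ (∈-++⁺ʳ p (there (here refl)))))
                          (onion-greatest c e h (∈-resp-↭ (↭-sym q↭q′) (∈-++⁺ʳ p′ (there (here refl)))))
    = cong (_++ x ∷ y ∷ []) (onion-↭ c h h′
        (subst₂ _↭_ (List.++-identityʳ p) (List.++-identityʳ p′) (drop-mid p p′ (drop-mid p p′ q↭q′))))

  -- An ascending clique is peeled from both ends: its first and last vertex form the outer edge,
  -- and all others lie in the community of that edge.
  onion-complete : ∀ c {S : ℕ → Set} {zs} → AllPairs E zs → length zs ≡ c → All S zs → ∃[ q ] (q ↭ zs × Onion c S q)
  onion-complete 0 {zs = []}        _ _ _ = [] , ↭-refl , refl
  onion-complete 1 {zs = x ∷ []} _ _ (Sx ∷ []) = x ∷ [] , ↭-refl , x , Sx , refl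
  onion-complete (suc (suc c)) {zs = x ∷ zs} (Ex ∷ pairs) len (Sx ∷ Ss) with initLast zs
  onion-complete (suc (suc c)) {zs = x ∷ .(zs ∷ʳ y)} (Ex ∷ pairs) len (Sx ∷ Ss) | zs ∷ʳ′ y
    with All.∷ʳ⁻ Ex | All.∷ʳ⁻ Ss
  ... | Exs , Exy | Szs , Sy with onion-complete c (proj₁ (split zs pairs)) len′
      (All.tabulate λ w∈ → All.lookup Szs w∈ , All.lookup Exs w∈ , All.lookup (proj₂ (split zs pairs)) w∈)
    where
    split : ∀ ws → AllPairs E (ws ∷ʳ y) → AllPairs E ws × All (λ w → E w y) ws
    split []       _        = [] , []
    split (w ∷ ws) (e ∷ es) = let Ews , Ewy = All.∷ʳ⁻ e ; ps , ys = split ws es in Ews ∷ ps , Ewy ∷ ys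
    len′ : length zs ≡ c
    len′ = suc-injective (suc-injective (trans (cong suc (trans (+-comm 1 _) (sym (List.length-++ zs)))) len))
  ... | p , p↭zs , h = p ++ x ∷ y ∷ [] , ↭-trans (shift x p (y ∷ [])) (prep x (++⁺ʳ (y ∷ []) p↭zs)) , x , y , p , Sx , Sy , Exy , h , refl

-- Binomial coefficients

-- The binomial coefficient (r + c choose c).
multi : ℕ → ℕ → ℕ
multi zero    c       = 1
multi (suc r) zero    = 1
multi (suc r) (suc c) = multi r (suc c) + multi (suc r) c

≤-by : ∀ {a b} c → b ≡ a + c → a ≤ b
≤-by {a} c refl = m≤m+n a c

multi-0 : ∀ r → multi r 0 ≡ 1
multi-0 zero    = refl
multi-0 (suc r) = refl

multi-pos : ∀ r c → 1 ≤ multi r c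
multi-pos zero    c       = ≤-refl
multi-pos (suc r) zero    = ≤-refl
multi-pos (suc r) (suc c) = ≤-trans (multi-pos r (suc c)) (m≤m+n _ _)

multi-monoˡ-suc : ∀ r c → multi r c ≤ multi (suc r) c
multi-monoˡ-suc r zero    = ≤-reflexive (multi-0 r)
multi-monoˡ-suc r (suc c) = m≤m+n _ _

multi-monoʳ-suc : ∀ r c → multi r c ≤ multi r (suc c)
multi-monoʳ-suc zero    c = ≤-refl
multi-monoʳ-suc (suc r) c = m≤n+m _ _

multi-monoˡ : ∀ {r r′} c → r ≤ r′ → multi r c ≤ multi r′ c
multi-monoˡ {r} {zero}   c z≤n = ≤-refl
multi-monoˡ {r} {suc r′} c r≤ with m≤n⇒m<n∨m≡n r≤
... | inj₁ r<   = ≤-trans (multi-monoˡ c (≤-pred r<)) (multi-monoˡ-suc r′ c)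
... | inj₂ refl = ≤-refl

-- The hockey-stick identity, where the sum misses only the term 1 of index 0. Applied first to the
-- pairs of a row and then to the rows, it raises the lower index by two, matching the drop of `c`
-- in a recursive call.
∑-multi : ∀ r c → ∑ (λ t → multi (suc t) c) r ≤ multi r (suc c)
∑-multi zero    c = z≤n
∑-multi (suc r) c = +-monoˡ-≤ (multi (suc r) c) (∑-multi r c)

multi-1 : ∀ r → multi r 1 ≡ suc r
multi-1 zero    = refl
multi-1 (suc r) = trans (cong (_+ 1) (multi-1 r)) (+-comm (suc r) 1)

-- The number of pairs in `r` rows, of which the longest has `r` pairs and the shortest has one.
triangle : ℕ → ℕ
triangle = ∑ suc

triangle-double : ∀ r → 2 * triangle r ≡ r * suc r
triangle-double zero    = refl
triangle-double (suc r) = trans (*-distribˡ-+ 2 (triangle r) (suc r)) (trans (cong (_+ 2 * suc r) (triangle-double r)) (eq r))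
  where
  eq : ∀ r → r * suc r + 2 * suc r ≡ suc r * suc (suc r)
  eq = solve-∀

multi-2-double : ∀ r → 2 * multi r 2 ≡ suc r * suc (suc r)
multi-2-double zero    = refl
multi-2-double (suc r) rewrite multi-1 (suc r) = trans (*-distribˡ-+ 2 (multi r 2) (suc (suc r))) (trans (cong (_+ 2 * suc (suc r)) (multi-2-double r)) (eq r))
  where
  eq : ∀ r → suc r * suc (suc r) + 2 * suc (suc r) ≡ suc (suc r) * suc (suc (suc r))
  eq = solve-∀

multi-2≤ : ∀ r c → multi r 2 ≤ multi r (2 + c)
multi-2≤ r zero    = ≤-refl
multi-2≤ r (suc c) = ≤-trans (multi-2≤ r c) (multi-monoʳ-suc r (2 + c))

triangle≤multi-2 : ∀ r → triangle r ≤ multi r 2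
triangle≤multi-2 r = *-cancelˡ-≤ 2 (begin
  2 * triangle r         ≡⟨ triangle-double r ⟩
  r * suc r              ≤⟨ *-mono-≤ (n≤1+n r) (n≤1+n (suc r)) ⟩
  suc r * suc (suc r)    ≡⟨ multi-2-double r ⟨
  2 * multi r 2          ∎)
  where open ≤-Reasoning

1+r≤multi-2 : ∀ r → suc r ≤ multi r 2
1+r≤multi-2 r = ≤-trans (≤-reflexive (sym (multi-1 r))) (multi-monoʳ-suc r 1)

-- The r³ term of a level. By Pascal's rule the right side grows by `3 * multi (suc r) 2` per row,
-- which is quadratic like the growth on the left.
triangle*r≤ : ∀ r → triangle r * r ≤ 3 * multi r 3
triangle*r≤ zero    = z≤n
triangle*r≤ (suc r) = begin
  (triangle r + suc r) * suc r                       ≡⟨ eq₁ (triangle r) r ⟩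
  triangle r * r + (triangle r + suc r * suc r)      ≤⟨ +-mono-≤ (triangle*r≤ r) step≤ ⟩
  3 * multi r 3 + 3 * multi (suc r) 2                ≡⟨ *-distribˡ-+ 3 (multi r 3) (multi (suc r) 2) ⟨
  3 * multi (suc r) 3                                ∎
  where
  open ≤-Reasoning
  eq₁ : ∀ t r → (t + suc r) * suc r ≡ t * r + (t + suc r * suc r)
  eq₁ = solve-∀
  swap₃ : ∀ m → 2 * (3 * m) ≡ 3 * (2 * m)
  swap₃ = solve-∀
  eq₂ : ∀ r → 3 * (suc (suc r) * suc (suc (suc r))) ≡ r * suc r + 2 * (suc r * suc r) + (10 * r + 16)
  eq₂ = solve-∀
  step≤ : triangle r + suc r * suc r ≤ 3 * multi (suc r) 2
  -- Doubling turns `triangle` and `multi (suc r) 2` into polynomials.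
  step≤ = *-cancelˡ-≤ 2 (begin
    2 * (triangle r + suc r * suc r)                ≡⟨ *-distribˡ-+ 2 (triangle r) (suc r * suc r) ⟩
    2 * triangle r + 2 * (suc r * suc r)            ≡⟨ cong (_+ 2 * (suc r * suc r)) (triangle-double r) ⟩
    r * suc r + 2 * (suc r * suc r)                 ≤⟨ ≤-by (10 * r + 16) (eq₂ r) ⟩
    3 * (suc (suc r) * suc (suc (suc r)))           ≡⟨ cong (3 *_) (multi-2-double (suc r)) ⟨
    3 * (2 * multi (suc r) 2)                       ≡⟨ swap₃ (multi (suc r) 2) ⟨
    2 * (3 * multi (suc r) 2)                       ∎)

1+r*c≤multi : ∀ r c → suc (r * c) ≤ multi r c
1+r*c≤multi zero    c       = ≤-refl
1+r*c≤multi (suc r) zero    = ≤-reflexive (cong suc (*-zeroʳ r))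
1+r*c≤multi (suc r) (suc c) = begin
  suc (suc r * suc c)                        ≤⟨ ≤-by (r * c) (eq r c) ⟩
  suc (r * suc c) + suc (suc r * c)          ≤⟨ +-mono-≤ (1+r*c≤multi r (suc c)) (1+r*c≤multi (suc r) c) ⟩
  multi r (suc c) + multi (suc r) c          ∎
  where
  open ≤-Reasoning
  eq : ∀ r c → suc (r * suc c) + suc (suc r * c) ≡ suc (suc r * suc c) + r * c
  eq = solve-∀

-- The c r² term of a level. A new row adds `suc r * (2 + c)` on the left, and Pascal's rule adds
-- `2 * multi (suc r) (1 + c)` on the right, for which the linear bound `1+r*c≤multi` is enough.
triangle*c≤ : ∀ r c → triangle r * (2 + c) ≤ 2 * multi r (2 + c)
triangle*c≤ zero    c = z≤n
triangle*c≤ (suc r) c = begin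
  (triangle r + suc r) * (2 + c)                         ≡⟨ *-distribʳ-+ (2 + c) (triangle r) (suc r) ⟩
  triangle r * (2 + c) + suc r * (2 + c)
    ≤⟨ +-mono-≤ (triangle*c≤ r c) (≤-by (2 + suc r * c) (eq r c)) ⟩
  2 * multi r (2 + c) + 2 * suc (suc r * (1 + c))
    ≤⟨ +-monoʳ-≤ (2 * multi r (2 + c)) (*-monoʳ-≤ 2 (1+r*c≤multi (suc r) (1 + c))) ⟩
  2 * multi r (2 + c) + 2 * multi (suc r) (1 + c)        ≡⟨ *-distribˡ-+ 2 (multi r (2 + c)) (multi (suc r) (1 + c)) ⟨
  2 * multi (suc r) (2 + c)                              ∎
  where
  open ≤-Reasoning
  eq : ∀ r c → 2 * suc (suc r * (1 + c)) ≡ suc r * (2 + c) + (2 + suc r * c)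
  eq = solve-∀

-- Work spent on one level of the recursion, for r rows of candidate pairs.
level-work : ∀ r c a e → 9 + 5 * a ≤ e →
             4 + r + 4 * triangle r + triangle r * ((r + (3 + c)) * a) ≤ e * multi r (3 + c)
level-work r c a e 9+5a≤e = begin
  4 + r + 4 * triangle r + triangle r * ((r + (3 + c)) * a)
    ≡⟨ eq₁ r (3 + c) a (triangle r) ⟩
  4 + r + 4 * triangle r + (triangle r * r + triangle r * (3 + c)) * a
    -- The summands give the coefficients 4 + 1 + 4 = 9 outside of, and 3 + 2 = 5 inside of, the
    -- product with `a`.
    ≤⟨ +-mono-≤ (+-mono-≤ (+-mono-≤ 4≤ r≤) (*-monoʳ-≤ 4 t≤)) (*-monoˡ-≤ a (+-mono-≤ tr≤ (triangle*c≤ r (1 + c)))) ⟩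
  4 * m + m + 4 * m + (3 * m + 2 * m) * a
    ≡⟨ eq₂ m a ⟩
  (9 + 5 * a) * m
    ≤⟨ *-monoˡ-≤ m 9+5a≤e ⟩
  e * m ∎
  where
  open ≤-Reasoning
  m = multi r (3 + c)
  m₂≤m : multi r 2 ≤ m
  m₂≤m = multi-2≤ r (1 + c)
  4≤ : 4 ≤ 4 * m
  4≤ = *-monoʳ-≤ 4 (multi-pos r (3 + c))
  r≤ : r ≤ m
  r≤ = ≤-trans (n≤1+n r) (≤-trans (1+r≤multi-2 r) m₂≤m)
  t≤ : triangle r ≤ m
  t≤ = ≤-trans (triangle≤multi-2 r) m₂≤m
  m₃≤m : ∀ c → multi r 3 ≤ multi r (3 + c)
  m₃≤m zero    = ≤-refl
  m₃≤m (suc c) = ≤-trans (m₃≤m c) (multi-monoʳ-suc r (3 + c))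
  tr≤ : triangle r * r ≤ 3 * m
  tr≤ = ≤-trans (triangle*r≤ r) (*-monoʳ-≤ 3 (m₃≤m c))
  eq₁ : ∀ r c a t → 4 + r + 4 * t + t * ((r + c) * a) ≡ 4 + r + 4 * t + (t * r + t * c) * a
  eq₁ = solve-∀
  eq₂ : ∀ m a → 4 * m + m + 4 * m + (3 * m + 2 * m) * a ≡ (9 + 5 * a) * m
  eq₂ = solve-∀

-- Binomial coefficients against powers of (r + 1)/2

2^c*multi-1≤ : ∀ c → 3 * (2 ^ c * multi 1 c) ≤ 4 * 3 ^ c
2^c*multi-1≤ 0       = ≤ᵇ⇒≤ _ _ tt
2^c*multi-1≤ 1       = ≤-refl
2^c*multi-1≤ (suc (suc c)) = begin
  -- The left side grows by 2 (1 + m)/m, which is at most 3 as soon as m ≥ 2. Equality holds for the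
  -- exponents 1 and 2.
  3 * (2 * z * (1 + m))          ≤⟨ ≤-by (3 * z * (m ∸ 2)) eq ⟩
  3 * (3 * (z * m))              ≤⟨ *-monoʳ-≤ 3 (2^c*multi-1≤ (suc c)) ⟩
  3 * (4 * 3 ^ suc c)            ≡⟨ eq₃ (3 ^ suc c) ⟩
  4 * 3 ^ suc (suc c)            ∎
  where
  open ≤-Reasoning
  z = 2 ^ suc c
  m = multi 1 (suc c)
  m≡ : m ≡ 2 + (m ∸ 2)
  m≡ = sym (m+[n∸m]≡n (≤-trans (s≤s (s≤s z≤n)) (1+r*c≤multi 1 (suc c))))
  eq₃ : ∀ t → 3 * (4 * t) ≡ 4 * (3 * t)
  eq₃ = solve-∀
  eq₄ : ∀ p d → 3 * (3 * (p * (2 + d))) ≡ 3 * (2 * p * (1 + (2 + d))) + 3 * p * d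
  eq₄ = solve-∀
  eq : 3 * (3 * (z * m)) ≡ 3 * (2 * z * (1 + m)) + 3 * z * (m ∸ 2)
  eq = subst (λ m′ → 3 * (3 * (z * m′)) ≡ 3 * (2 * z * (1 + m′)) + 3 * z * (m ∸ 2)) (sym m≡) (eq₄ z (m ∸ 2))

-- Base of the induction on r, as (r + 1)/2 exceeds 1 from r = 2 on. Pascal's rule leads down to row
-- 1, which has therefore been compared with powers of 3, the base that belongs to row 2.
2^c*multi-2≤ : ∀ c → 2 ^ c * multi 2 c ≤ 4 * 3 ^ c
2^c*multi-2≤ zero    = ≤ᵇ⇒≤ _ _ tt
2^c*multi-2≤ (suc c) = *-cancelˡ-≤ 3 (begin
  3 * (2 * 2 ^ c * (multi 1 (suc c) + multi 2 c))
    ≡⟨ eq₁ (2 ^ c) (multi 1 (suc c)) (multi 2 c) ⟩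
  3 * (2 ^ suc c * multi 1 (suc c)) + 6 * (2 ^ c * multi 2 c)
    ≤⟨ +-mono-≤ (2^c*multi-1≤ (suc c)) (*-monoʳ-≤ 6 (2^c*multi-2≤ c)) ⟩
  4 * 3 ^ suc c + 6 * (4 * 3 ^ c)                                          ≡⟨ eq₂ (3 ^ c) ⟩
  3 * (4 * 3 ^ suc c)                                                      ∎)
  where
  open ≤-Reasoning
  eq₁ : ∀ p m m′ → 3 * (2 * p * (m + m′)) ≡ 3 * (2 * p * m) + 6 * (p * m′)
  eq₁ = solve-∀
  eq₂ : ∀ t → 4 * (3 * t) + 6 * (4 * t) ≡ 3 * (4 * (3 * t))
  eq₂ = solve-∀

-- With x = r + 2 it trades one factor x for x - 1 while the base of the others rises to x + 1. The
-- exponent 3 is the least possible, since x² exceeds (x - 1)(x + 1); so exponent 2 is treated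
-- directly in the induction that follows.
power-step : ∀ r c → suc (suc r) ^ (3 + c) ≤ suc r * suc (suc (suc r)) ^ (2 + c)
power-step r zero    = ≤-by (r * r + 3 * r + 1) (eq r)
  where
  eq : ∀ r → suc r * (suc (suc (suc r)) * (suc (suc (suc r)) * 1)) ≡
             suc (suc r) * (suc (suc r) * (suc (suc r) * 1)) + (r * r + 3 * r + 1)
  eq = solve-∀
power-step r (suc c) = begin
  suc (suc r) * suc (suc r) ^ (3 + c)                   ≤⟨ *-mono-≤ (n≤1+n (suc (suc r))) (power-step r c) ⟩
  suc (suc (suc r)) * (suc r * suc (suc (suc r)) ^ (2 + c))
    ≡⟨ eq (suc (suc (suc r))) (suc r) (suc (suc (suc r)) ^ (2 + c)) ⟩
  suc r * (suc (suc (suc r)) * suc (suc (suc r)) ^ (2 + c))   ∎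
  where
  open ≤-Reasoning
  eq : ∀ x y z → x * (y * z) ≡ y * (x * z)
  eq = solve-∀

-- The factor (r + i)/i of (r + c choose c) is at most (r + 1)/2, except for
-- the first few i, which are paid for by the constant 4.
2^c*multi≤ : ∀ r c → 2 ^ (2 + c) * multi (2 + r) (2 + c) ≤ 4 * (3 + r) ^ (2 + c)
2^c*multi≤ zero    c       = 2^c*multi-2≤ (2 + c)
2^c*multi≤ (suc r) zero    = begin
  4 * multi (3 + r) 2                         ≡⟨ *-assoc 2 2 (multi (3 + r) 2) ⟩
  2 * (2 * multi (3 + r) 2)                   ≡⟨ cong (2 *_) (multi-2-double (3 + r)) ⟩
  2 * ((4 + r) * (5 + r))                     ≤⟨ ≤-by (2 * ((4 + r) * (3 + r))) (eq r) ⟩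
  4 * (4 + r) ^ 2                             ∎
  where
  open ≤-Reasoning
  eq : ∀ r → 4 * ((4 + r) * ((4 + r) * 1)) ≡ 2 * ((4 + r) * (5 + r)) + 2 * ((4 + r) * (3 + r))
  eq = solve-∀
2^c*multi≤ (suc r) (suc c) = begin
  2 * 2 ^ (2 + c) * (multi (2 + r) (3 + c) + multi (3 + r) (2 + c))
    ≡⟨ eq₁ (2 ^ (2 + c)) (multi (2 + r) (3 + c)) _ ⟩
  2 ^ (3 + c) * multi (2 + r) (3 + c) + 2 * (2 ^ (2 + c) * multi (3 + r) (2 + c))
    ≤⟨ +-mono-≤ (2^c*multi≤ r (suc c)) (*-monoʳ-≤ 2 (2^c*multi≤ (suc r) c)) ⟩
  -- The first term becomes 2 + r copies of the power of 4 + r and the second one supplies the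
  -- missing two.
  4 * (3 + r) ^ (3 + c) + 2 * (4 * (4 + r) ^ (2 + c))
    ≤⟨ +-monoˡ-≤ _ (*-monoʳ-≤ 4 (power-step (suc r) c)) ⟩
  4 * ((2 + r) * (4 + r) ^ (2 + c)) + 2 * (4 * (4 + r) ^ (2 + c))             ≡⟨ eq₂ r ((4 + r) ^ (2 + c)) ⟩
  4 * ((4 + r) * (4 + r) ^ (2 + c))                                           ∎
  where
  open ≤-Reasoning
  eq₁ : ∀ p m m′ → 2 * p * (m + m′) ≡ 2 * p * m + 2 * (p * m′)
  eq₁ = solve-∀
  eq₂ : ∀ r t → 4 * ((2 + r) * t) + 2 * (4 * t) ≡ 4 * ((4 + r) * t)
  eq₂ = solve-∀

-- Counting cliques recursively

-- At one level of the recursion all reports begin with equally many inner vertices, so the edge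
-- chosen there stands at the same place and can be read off.
split-injective : ∀ (ps qs : List ℕ) {x y x′ y′ zs} → length ps ≡ length qs →
                  ps ++ x ∷ y ∷ zs ≡ qs ++ x′ ∷ y′ ∷ zs → x ≡ x′ × y ≡ y′
split-injective []       []       _ refl = refl , refl
split-injective (_ ∷ ps) (_ ∷ qs) e e′   = split-injective ps qs (suc-injective e) (List.∷-injectiveʳ e′)

<∸⇒+< : ∀ a {s t} → t < s ∸ a → a + t < s
<∸⇒+< zero            t< = t<
<∸⇒+< (suc a) {suc s} t< = s≤s (<∸⇒+< a t<)

+<⇒<∸ : ∀ a {s t} → a + t < s → t < s ∸ a
+<⇒<∸ zero            t<       = t<
+<⇒<∸ (suc a) {suc s} (s≤s t<) = +<⇒<∸ a t<

-- The account of a call with parameter `3 + c` on `s` candidates. Per pair, `σ` covers the packing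
-- (110) and the single instructions (10), and `e` is the factor of the recursive call. `pair t`
-- belongs to the `t`-th pair of a row, whose call has at most `suc t` rows.
module StepWork (s c k : ℕ) where
  r σ e : ℕ
  r = s ∸ (2 + c)
  σ = suc s * 120
  e = (suc c + k) * 400

  pair row : ℕ → ℕ
  pair t = σ + multi (suc t) (suc c) * e
  row ρ  = 2 + (suc ρ + ∑ pair ρ)

  open ≤-Reasoning

  ∑-pair : ∀ ρ → ∑ pair ρ ≤ ρ * σ + multi ρ (2 + c) * e
  ∑-pair ρ = begin
    ∑ pair ρ
      ≡⟨ ∑-+ (λ _ → σ) (λ t → multi (suc t) (suc c) * e) ρ ⟩
    ∑ (λ _ → σ) ρ + ∑ (λ t → multi (suc t) (suc c) * e) ρ
      ≡⟨ cong₂ _+_ (∑-const σ ρ) (∑-*ʳ (λ t → multi (suc t) (suc c)) e ρ) ⟩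
    ρ * σ + ∑ (λ t → multi (suc t) (suc c)) ρ * e
      ≤⟨ +-monoʳ-≤ (ρ * σ) (*-monoˡ-≤ e (∑-multi ρ (suc c))) ⟩
    ρ * σ + multi ρ (2 + c) * e                                   ∎

  row≤ : ∀ t → row (suc t) ≤ suc t * (4 + σ) + multi (suc t) (2 + c) * e
  row≤ t = begin
    2 + (suc (suc t) + ∑ pair (suc t))
      ≤⟨ s≤s (s≤s (+-monoʳ-≤ (suc (suc t)) (∑-pair (suc t)))) ⟩
    2 + (suc (suc t) + (suc t * σ + multi (suc t) (2 + c) * e))
      ≤⟨ ≤-by (3 * t) (eq t σ (multi (suc t) (2 + c) * e)) ⟩
    suc t * (4 + σ) + multi (suc t) (2 + c) * e                           ∎
    where
    eq : ∀ t σ m → suc t * (4 + σ) + m ≡ 2 + (suc (suc t) + (suc t * σ + m)) + 3 * t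
    eq = solve-∀

  ∑-row : ∑ (λ i → row (r ∸ i)) r ≤ triangle r * (4 + σ) + multi r (3 + c) * e
  ∑-row = begin
    ∑ (λ i → row (r ∸ i)) r                                                       ≡⟨ ∑-reverse row r ⟩
    ∑ (λ t → row (suc t)) r                                                       ≤⟨ ∑-mono r (λ {t} _ → row≤ t) ⟩
    ∑ (λ t → suc t * (4 + σ) + multi (suc t) (2 + c) * e) r
      ≡⟨ ∑-+ (λ t → suc t * (4 + σ)) (λ t → multi (suc t) (2 + c) * e) r ⟩
    ∑ (λ t → suc t * (4 + σ)) r + ∑ (λ t → multi (suc t) (2 + c) * e) r
      ≡⟨ cong₂ _+_ (∑-*ʳ suc (4 + σ) r) (∑-*ʳ (λ t → multi (suc t) (2 + c)) e r) ⟩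
    triangle r * (4 + σ) + ∑ (λ t → multi (suc t) (2 + c)) r * e
      ≤⟨ +-monoʳ-≤ (triangle r * (4 + σ)) (*-monoˡ-≤ e (∑-multi r (2 + c))) ⟩
    triangle r * (4 + σ) + multi r (3 + c) * e                                    ∎

  -- If `r` is 0, the truncated subtraction has lost `s`, but there are no pairs to pay for.
  -- Otherwise `suc s` is exactly `r + (3 + c)`.
  triangle*σ : triangle r * σ ≤ triangle r * ((r + (3 + c)) * 120)
  triangle*σ with r ≟ 0
  ... | yes r≡0 = ≤-trans (≤-reflexive (cong (λ r → triangle r * σ) r≡0)) z≤n
  ... | no  r≢0 = *-monoʳ-≤ (triangle r) (*-monoˡ-≤ 120 (≤-reflexive
    (trans (cong suc (sym (m∸n+n≡m (<⇒≤ (m∸n≢0⇒n<m {s} {2 + c} r≢0))))) (sym (+-suc r (2 + c))))))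

  step-work : 3 + (suc r + ∑ (λ i → row (r ∸ i)) r) ≤ (3 + c + k) * multi r (3 + c) * 400
  step-work = begin
    3 + (suc r + ∑ (λ i → row (r ∸ i)) r)
      ≤⟨ s≤s (s≤s (s≤s (+-monoʳ-≤ (suc r) ∑-row))) ⟩
    3 + (suc r + (triangle r * (4 + σ) + multi r (3 + c) * e))
      ≡⟨ eq₁ r (triangle r) σ (multi r (3 + c) * e) ⟩
    4 + r + 4 * triangle r + triangle r * σ + multi r (3 + c) * e
      ≤⟨ +-monoˡ-≤ _ (+-monoʳ-≤ (4 + r + 4 * triangle r) triangle*σ) ⟩
    4 + r + 4 * triangle r + triangle r * ((r + (3 + c)) * 120) + multi r (3 + c) * e
      -- Here the choice of 400 is tested: the level costs 9 + 5 · 120 = 609 times the binomial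
      -- coefficient, and lowering the parameter by 2 frees 2 · 400.
      ≤⟨ +-monoˡ-≤ _ (level-work r c 120 (2 * 400) (≤ᵇ⇒≤ _ _ tt)) ⟩
    2 * 400 * multi r (3 + c) + multi r (3 + c) * e
      ≡⟨ eq₂ 400 (multi r (3 + c)) c k ⟩
    (3 + c + k) * multi r (3 + c) * 400                                                   ∎
    where
    eq₁ : ∀ r t σ m → 3 + (suc r + (t * (4 + σ) + m)) ≡ 4 + r + 4 * t + t * σ + m
    eq₁ = solve-∀
    eq₂ : ∀ E M c k → 2 * E * M + M * ((suc c + k) * E) ≡ (3 + c + k) * M * E
    eq₂ = solve-∀

module Recursion (init : ℕ → ℕ) {n : ℕ} (D : Digraph n) where
  open Algorithm init
  open Blocks init
  open Cliques D

  Entry : ℕ → ℕ → Maybe Table → Set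
  Entry x y (just T) = E x y × IsTable n (C x y) T
  Entry x y nothing  = ¬ E x y

  IsMatrix : List ℕ → Matrix → Set
  IsMatrix zs M = Cells (λ a row → Cells (λ b e → Entry (at zs a) (at zs b) e) (length zs) row) (length zs) M

  entry-runs : ∀ {zs M a b x y} → .{{NonZero x}} → .{{NonZero y}} → IsMatrix zs M → a < length zs → b < length zs →
               Runs x y (entry M a b) 2 2 (Silent (Entry (at zs a) (at zs b)))
  entry-runs M-matrix a< b< = read M-matrix a< ≫= λ row → read row b<

  -- `k` bounds the length of every report and `L` the logarithm of the size of every candidate set;
  -- both stay fixed while the parameter and the set shrink.
  module _ {zs : List ℕ} {M : Matrix} (zs-ordered : IsOrdered zs) (zs-below : All (_< n) zs) (M-matrix : IsMatrix zs M)
           (k L : ℕ) where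

    Candidate : List ℕ → ℕ → Set
    Candidate I w = ∃[ l ] (l ∈ I × at zs l ≡ w)

    Reports : ℕ → List ℕ → List ℕ → List ℕ → Set
    Reports c I chosen o = ∃[ q ] (Onion c (Candidate I) q × o ≡ q ++ chosen)

    module Level (I : List ℕ) (I-ordered : IsOrdered I) (I-below : All (_< length zs) I) (chosen : List ℕ) where
      s : ℕ
      s = length I

      vertex : ℕ → ℕ
      vertex i = at zs (at I i)

      position< : i < s → at I i < length zs
      position< i<s = All.lookup I-below (at-∈ I i<s)

      vertex-mono : ∀ {i j} → i < j → j < s → vertex i < vertex j
      vertex-mono i<j j<s = AllPairs-at zs-ordered (AllPairs-at I-ordered i<j j<s) (position< j<s)

      vertex-reflects-< : ∀ {i j} → i < s → vertex i < vertex j → i < j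
      vertex-reflects-< {i} {j} i<s v< with <-cmp i j
      ... | tri< i<j _ _  = i<j
      ... | tri≈ _ refl _ = contradiction v< (<-irrefl refl)
      ... | tri> _ _ j<i  = contradiction v< (<-asym (vertex-mono j<i i<s))

      vertex-injective : ∀ {i j} → i < s → j < s → vertex i ≡ vertex j → i ≡ j
      vertex-injective {i} {j} i<s j<s e with <-cmp i j
      ... | tri< i<j _ _ = contradiction e (<⇒≢ (vertex-mono i<j j<s))
      ... | tri≈ _ i≡j _ = i≡j
      ... | tri> _ _ j<i = contradiction (sym e) (<⇒≢ (vertex-mono j<i i<s))

      candidate : i < s → Candidate I (vertex i)
      candidate i<s = _ , at-∈ I i<s , refl

      candidate⁻ : ∀ {w} → Candidate I w → ∃[ i ] (i < s × vertex i ≡ w)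
      candidate⁻ (l , l∈ , e) with ∈-at l∈
      ... | i , i<s , refl = i , i<s , e

      between-∈ : ∀ (f : ℕ → ℕ) {i a j} → i < a → a < j → f a ∈ applyUpTo (λ t → f (suc i + t)) (j ∸ suc i)
      between-∈ f {i} {a} {j} i<a a<j = subst (λ b → f b ∈ _) (m+[n∸m]≡n i<a)
        (∈-applyUpTo⁺ (λ t → f (suc i + t)) (∸-monoˡ-< a<j i<a))

      PairReports : ℕ → ℕ → ℕ → List ℕ → Set
      PairReports c i j o = E (vertex i) (vertex j) ×
        ∃[ p ] (Onion c (Between (Candidate I) (vertex i) (vertex j)) p × o ≡ p ++ vertex i ∷ vertex j ∷ chosen)

      -- The inner vertices lie strictly between the endpoints, hence at indices strictly between
      -- `i` and `j`. So the restriction of the loops to δ ≥ c - 2 loses no clique.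
      pair-distance : ∀ c {i j p} → Onion c (Between (Candidate I) (vertex i) (vertex j)) p → i < s → j < s → c ≤ j ∸ suc i
      pair-distance c {i} {j} h i<s j<s = subst (c ≤_) (List.length-applyUpTo (λ t → vertex (suc i + t)) (j ∸ suc i))
        (onion-size c h λ { (w-cand , Eiw , Ewj) → inside w-cand (E⇒< Eiw) (E⇒< Ewj) })
        where
        inside : ∀ {w} → Candidate I w → vertex i < w → w < vertex j → w ∈ applyUpTo (λ t → vertex (suc i + t)) (j ∸ suc i)
        inside w-cand i<w w<j with candidate⁻ w-cand
        ... | a , a<s , refl = between-∈ vertex (vertex-reflects-< i<s i<w) (vertex-reflects-< a<s w<j)

      pair-disjoint : ∀ c {i j i′ j′ o} → i < s → j < s → i′ < s → j′ < s → PairReports c i j o → PairReports c i′ j′ o → i ≡ i′ × j ≡ j′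
      pair-disjoint c i<s j<s i′<s j′<s (_ , p , h , refl) (_ , p′ , h′ , e)
        with split-injective p p′ (trans (onion-length c h) (sym (onion-length c h′))) e
      ... | eᵢ , eⱼ = vertex-injective i<s i′<s eᵢ , vertex-injective j<s j′<s eⱼ

      pair⇒reports : ∀ c {i j o} → i < s → j < s → PairReports c i j o → Reports (2 + c) I chosen o
      pair⇒reports c i<s j<s (e , p , h , refl) =
        p ++ _ ∷ _ ∷ [] , (_ , _ , p , candidate i<s , candidate j<s , e , h , refl) , sym (List.++-assoc p _ chosen)

      reports⇒pair : ∀ c {o} → Reports (2 + c) I chosen o →
                     ∃[ i ] ∃[ t ] (i + suc c + t < s × PairReports c i (i + suc c + t) o)
      reports⇒pair c (_ , (x , y , p , x-cand , y-cand , Exy , h , refl) , refl) with candidate⁻ x-cand | candidate⁻ y-cand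
      ... | i , i<s , refl | j , j<s , refl =
        i , t , subst (_< s) (sym j≡) j<s ,
        subst (λ j′ → PairReports c i j′ ((p ++ vertex i ∷ vertex j ∷ []) ++ chosen)) (sym j≡) (Exy , p , h , List.++-assoc p _ chosen)
        where
        -- The excess of the distance over its minimum, well defined by `pair-distance`.
        t = (j ∸ suc i) ∸ c
        i<j : i < j
        i<j = vertex-reflects-< i<s (E⇒< Exy)
        j≡ : i + suc c + t ≡ j
        j≡ = begin
          i + suc c + t        ≡⟨ cong (_+ t) (+-suc i c) ⟩
          suc i + c + t        ≡⟨ +-assoc (suc i) c t ⟩
          suc i + (c + t)      ≡⟨ cong (suc i +_) (m+[n∸m]≡n (pair-distance c h i<s j<s)) ⟩
          suc i + (j ∸ suc i)  ≡⟨ m+[n∸m]≡n i<j ⟩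
          j                    ∎
          where open ≡-Reasoning

      inner? : ∀ x y → Decidable (λ l → at zs l ∈ C x y)
      inner? x y l = at zs l ∈? C x y

      inner : ℕ → ℕ → List ℕ
      inner x y = filter (inner? x y) I

      inner-ordered : ∀ x y → IsOrdered (inner x y)
      inner-ordered x y = AllPairs.filter⁺ (inner? x y) I-ordered

      inner-below : ∀ x y → All (_< length zs) (inner x y)
      inner-below x y = All.filter⁺ (inner? x y) I-below

      inner⇒between : ∀ {x y w} → Candidate (inner x y) w → Between (Candidate I) x y w
      inner⇒between {x} {y} (l , l∈ , refl) with ∈-filter⁻ (inner? x y) {xs = I} l∈
      ... | l∈I , in-C = (l , l∈I , refl) , ∈-C⁻ in-C

      between⇒inner : ∀ {x y w} → Between (Candidate I) x y w → Candidate (inner x y) w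
      between⇒inner {x} {y} ((l , l∈I , refl) , Exw , Ewy) = l , ∈-filter⁺ (inner? x y) l∈I (∈-C⁺ Exw Ewy) , refl

      inner-length : ∀ {i j} → i < s → j < s → length (inner (vertex i) (vertex j)) ≤ j ∸ suc i
      inner-length {i} {j} i<s j<s = ≤-trans
        (unique-⊆-length (AllPairs.map <⇒≢ (inner-ordered (vertex i) (vertex j))) inside)
        (≤-reflexive (List.length-applyUpTo (λ t → at I (suc i + t)) (j ∸ suc i)))
        where
        inside : ∀ {l} → l ∈ inner (vertex i) (vertex j) → l ∈ applyUpTo (λ t → at I (suc i + t)) (j ∸ suc i)
        inside l∈ with ∈-filter⁻ (inner? (vertex i) (vertex j)) {xs = I} l∈
        ... | l∈I , in-C with ∈-at l∈I
        ... | a , a<s , refl = between-∈ (at I) (vertex-reflects-< i<s (E⇒< (proj₁ (∈-C⁻ in-C)))) (vertex-reflects-< a<s (E⇒< (proj₂ (∈-C⁻ in-C))))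

    -- The first argument of `multi` is the number of rows. Without rows the binomial coefficient is
    -- still 1, which pays for the constant cost of an idle call.
    work-measure : ℕ → List ℕ → ℕ
    work-measure c I = (c + k) * multi (suc (length I) ∸ c) c

    -- `k` is for the final report. A level lowers the parameter by 2 and so releases `2 * suc L`,
    -- enough for its packing.
    depth-measure : ℕ → ℕ
    depth-measure c = suc c * suc L + k

    work-measure-pos : ∀ c I → NonZero (work-measure (suc c) I)
    work-measure-pos c I = >-nonZero (*-mono-≤ {1} {suc c + k} (s≤s z≤n) (multi-pos (length I ∸ c) (suc c)))

    k<depth-measure : ∀ c → k < depth-measure c
    k<depth-measure c = +-monoˡ-≤ k {1} {suc c * suc L} (s≤s z≤n)

    Counts : ℕ → List ℕ → List ℕ → Set
    Counts c I chosen = Runs (work-measure c I) (depth-measure c) (recursiveCount zs M c I chosen) 400 120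
                             (λ _ → Enumerates (Reports c I chosen))

    count-vertices : ∀ I chosen → IsOrdered I → All (_< length zs) I → 1 + length chosen ≤ k → Counts 1 I chosen
    count-vertices I chosen I-ordered I-below len≤k = upTo $ tick $ thenReturn $
      parallel {X = λ _ → suc k} s s<x ∑≤x
        (λ {i} i<s → read (words I) i<s ≫= λ { refl → read (words zs) (position< i<s) ≫= λ { refl →
          mapPost (enumerates-one refl id) (report-runs (s≤s len≤k) (≤-trans (s≤s len≤k) (k<depth-measure 1))) } })
        (mapEnumerates to from ∘ gathered-enumerates λ i<s j<s e e′ →
          vertex-injective i<s j<s (List.∷-injectiveˡ (trans (sym e) e′)))
      where
      open Level I I-ordered I-below chosen
      instance _ = work-measure-pos 0 I
      s<x : suc s ≤ work-measure 1 I
      s<x rewrite multi-1 s = m≤m+n (suc s) (k * suc s)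
      ∑≤x : ∑ (λ _ → suc k) s ≤ work-measure 1 I
      ∑≤x rewrite multi-1 s = ≤-trans (≤-reflexive (trans (∑-const (suc k) s) (*-comm s (suc k)))) (*-monoʳ-≤ (suc k) (n≤1+n s))
      to : ∀ {o} → ∃[ i ] (i < s × o ≡ vertex i ∷ chosen) → Reports 1 I chosen o
      to (i , i<s , refl) = vertex i ∷ [] , (vertex i , candidate i<s , refl) , refl
      from : ∀ {o} → Reports 1 I chosen o → ∃[ i ] (i < s × o ≡ vertex i ∷ chosen)
      from (_ , (x , x-cand , refl) , refl) with candidate⁻ x-cand
      ... | i , i<s , refl = i , i<s , refl

    count-edges : ∀ I chosen → IsOrdered I → All (_< length zs) I → 2 + length chosen ≤ k → Counts 2 I chosen
    count-edges I chosen I-ordered I-below len≤k = upTo $ tick $ thenReturn $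
      parallel {X = λ i → suc (s ∸ (i + 1)) * suc k} s s<x ∑≤x
        (λ {i} i<s → tick $ tick $ parallel {X = λ _ → suc k} (s ∸ (i + 1)) (m≤m*n _ (suc k))
          (≤-trans (≤-reflexive (∑-const (suc k) (s ∸ (i + 1)))) (m≤n+m _ (suc k)))
          (λ {t} t< → let j<s = index< i t< in
            tick $ read (words I) i<s ≫= λ { refl → read (words I) j<s ≫= λ { refl →
            entry-runs {zs} M-matrix (position< i<s) (position< j<s) ≫= λ
              { {just T} (e , _) → read (words zs) (position< i<s) ≫= λ { refl → read (words zs) (position< j<s) ≫= λ { refl →
                  mapPost (enumerates-one (e , [] , refl , refl) λ { (_ , _ , refl , e) → e })
                    (report-runs (s≤s len≤k) (≤-trans (s≤s len≤k) (k<depth-measure 2))) } }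
              ; {nothing} ¬e → within z≤n z≤n (mapPost (λ { (refl , _) → enumerates-none (¬e ∘ proj₁) }) (ret {Q′ = λ _ → ⊤} tt)) } } })
          (gathered-enumerates λ {t} {t′} t< t′< h h′ → +-cancelˡ-≡ (i + 1) t t′
            (proj₂ (pair-disjoint 0 i<s (index< i t<) i<s (index< i t′<) h h′))))
        (mapEnumerates to from ∘ gathered-enumerates λ { {i} {i′} i<s i′<s (t , t< , h) (t′ , t′< , h′) →
          proj₁ (pair-disjoint 0 i<s (index< i t<) i′<s (index< i′ t′<) h h′) })
      where
      open Level I I-ordered I-below chosen
      instance _ = work-measure-pos 1 I
      index< : ∀ i {t} → t < s ∸ (i + 1) → i + 1 + t < s
      index< i = <∸⇒+< (i + 1)
      open ≤-Reasoning
      s<x : ∀ {s} → suc s ≤ (2 + k) * multi (suc s ∸ 2) 2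
      s<x {zero}  = s≤s z≤n
      s<x {suc r} = begin
        suc (suc r)                 ≤⟨ ≤-by r (eq r) ⟩
        2 * suc r                   ≤⟨ *-mono-≤ (m≤m+n 2 k) (1+r≤multi-2 r) ⟩
        (2 + k) * multi r 2         ∎
        where
        eq : ∀ r → 2 * suc r ≡ suc (suc r) + r
        eq = solve-∀
      -- For `s = suc r` both sides are (r + 1)(r + 2)/2. With its start-up cost, row `i` is charged
      -- for `s ∸ i` pairs, which makes `triangle s` in all.
      triangle≤ : ∀ s → triangle s ≤ multi (suc s ∸ 2) 2
      triangle≤ zero    = z≤n
      triangle≤ (suc r) = ≤-reflexive (*-cancelˡ-≡ _ _ 2 (trans (triangle-double (suc r)) (sym (multi-2-double r))))
      ∑≤x : ∑ (λ i → suc (s ∸ (i + 1)) * suc k) s ≤ work-measure 2 I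
      ∑≤x = begin
        ∑ (λ i → suc (s ∸ (i + 1)) * suc k) s     ≡⟨ ∑-*ʳ (λ i → suc (s ∸ (i + 1))) (suc k) s ⟩
        ∑ (λ i → suc (s ∸ (i + 1))) s * suc k     ≡⟨ cong (_* suc k) (∑-cong s λ {i} i<s →
                                                        trans (sym (+-∸-assoc 1 (subst (_≤ s) (+-comm 1 i) i<s))) (cong (suc s ∸_) (+-comm i 1))) ⟩
        ∑ (λ i → s ∸ i) s * suc k                 ≡⟨ cong (_* suc k) (∑-reverse id s) ⟩
        triangle s * suc k                        ≤⟨ *-monoˡ-≤ (suc k) (triangle≤ s) ⟩
        multi (suc s ∸ 2) 2 * suc k               ≡⟨ *-comm (multi (suc s ∸ 2) 2) (suc k) ⟩
        suc k * multi (suc s ∸ 2) 2               ≤⟨ *-monoˡ-≤ (multi (suc s ∸ 2) 2) (n≤1+n (suc k)) ⟩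
        (2 + k) * multi (suc s ∸ 2) 2             ∎
      to : ∀ {o} → ∃[ i ] (i < s × ∃[ t ] (t < s ∸ (i + 1) × PairReports 0 i (i + 1 + t) o)) → Reports 2 I chosen o
      to (i , i<s , t , t< , h) = pair⇒reports 0 i<s (index< i t<) h
      from : ∀ {o} → Reports 2 I chosen o → ∃[ i ] (i < s × ∃[ t ] (t < s ∸ (i + 1) × PairReports 0 i (i + 1 + t) o))
      from r with reports⇒pair 0 r
      ... | i , t , j<s , h = i , ≤-trans (s≤s (≤-trans (m≤m+n i 1) (m≤m+n (i + 1) t))) j<s , t ,
        +<⇒<∸ (i + 1) j<s , h

    -- The recursive calls enter as a hypothesis with the same numerals 400 and 120, so the costs
    -- are added exactly and only the sum is compared with the measure. It also leaves `counts` as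
    -- the sole recursion, visibly structural.
    count-step : ∀ c →
      (∀ I chosen → IsOrdered I → All (_< length zs) I → suc c + length chosen ≤ k → ⌈log₂ length I ⌉ ≤ L → Counts (suc c) I chosen) →
      ∀ I chosen → IsOrdered I → All (_< length zs) I → 3 + c + length chosen ≤ k → ⌈log₂ length I ⌉ ≤ L → Counts (3 + c) I chosen
    count-step c recurse I chosen I-ordered I-below len≤k log≤L = bounded step-work depth≤ $ tick $ tick $ tick $ thenReturn $
      parallelExactly {Z = λ i → row (r ∸ i)} r
        (λ {i} i<r → tick $ tick $ parallelExactly {d = pair-depth} {Z = pair} (r ∸ i)
          (λ {t} t< → let i<s = <-≤-trans i<r (m∸n≤m s (2 + c)) ; j<s = index< i t< ; x = vertex i ; y = vertex (i + (2 + c) + t) in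
            within pair≤ pair-depth≤ $ tick $ read (words I) i<s ≫= λ { refl → read (words I) j<s ≫= λ { refl →
            entry-runs {zs} M-matrix (position< i<s) (position< j<s) ≫= λ
              { {just T} (e , T-table) →
                  exactly (pack-runs (inner? x y) I {test = λ l → zs ! l >>= λ w → member T w}
                    (λ l∈I → let l< = All.lookup I-below l∈I in
                      upTo (read (words zs) l< ≫= λ { refl → member-runs T-table (All.lookup zs-below (at-∈ zs l<)) }))) ≫= λ { refl →
                  read (words zs) (position< i<s) ≫= λ { refl → read (words zs) (position< j<s) ≫= λ { refl →
                  within (recurse-work≤ i i<s j<s) ≤-refl (exactly
                    (mapPost (mapEnumerates
                        (λ { (q , h , o≡) → e , q , onion-mono (suc c) inner⇒between h , o≡ })
                        (λ { (_ , q , h , o≡) → q , onion-mono (suc c) between⇒inner h , o≡ }))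
                      (recurse (inner x y) (x ∷ y ∷ chosen) (inner-ordered x y) (inner-below x y)
                        (≤-trans (≤-reflexive (trans (+-suc (suc c) (suc (length chosen))) (cong suc (+-suc (suc c) (length chosen))))) len≤k)
                        (≤-trans (⌈log₂⌉-mono-≤ (List.length-filter (inner? x y) I)) log≤L)))) } } }
              ; {nothing} ¬e → within z≤n z≤n (mapPost (λ { (refl , _) → enumerates-none (¬e ∘ proj₁) }) (ret {Q′ = λ _ → ⊤} tt)) } } })
          (gathered-enumerates λ {t} {t′} t< t′< h h′ → +-cancelˡ-≡ (i + (2 + c)) t t′
            (proj₂ (pair-disjoint (suc c) (i<s i<r) (index< i t<) (i<s i<r) (index< i t′<) h h′))))
        (mapEnumerates to from ∘ gathered-enumerates λ { {i} {i′} i<r i′<r (t , t< , h) (t′ , t′< , h′) →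
          proj₁ (pair-disjoint (suc c) (i<s i<r) (index< i t<) (i<s i′<r) (index< i′ t′<) h h′) })
      where
      open Level I I-ordered I-below chosen
      open StepWork s c k
      i<s : i < r → i < s
      i<s i<r = <-≤-trans i<r (m∸n≤m s (2 + c))
      index< : ∀ i {t} → t < r ∸ i → i + (2 + c) + t < s
      r∸i≡ : ∀ i → r ∸ i ≡ s ∸ (i + (2 + c))
      r∸i≡ i = trans (∸-+-assoc s (2 + c) i) (cong (s ∸_) (+-comm (2 + c) i))
      index< i t< = <∸⇒+< (i + (2 + c)) (<-≤-trans t< (≤-reflexive (r∸i≡ i)))
      pair-depth : ℕ
      pair-depth = suc L * 57 + depth-measure (suc c) * 120
      open ≤-Reasoning
      recurse-work≤ : ∀ i {t} → i < s → i + (2 + c) + t < s →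
        work-measure (suc c) (inner (vertex i) (vertex (i + (2 + c) + t))) * 400 ≤ multi (suc t) (suc c) * e
      recurse-work≤ i {t} i<s j<s = begin
        (suc c + k) * multi (length I′ ∸ c) (suc c) * 400
          ≤⟨ *-monoˡ-≤ 400 (*-monoʳ-≤ (suc c + k) (multi-monoˡ (suc c) rows≤)) ⟩
        (suc c + k) * multi (suc t) (suc c) * 400            ≡⟨ eq (suc c + k) (multi (suc t) (suc c)) 400 ⟩
        multi (suc t) (suc c) * ((suc c + k) * 400)          ∎
        where
        I′ = inner (vertex i) (vertex (i + (2 + c) + t))
        eq : ∀ x y z → x * y * z ≡ y * (x * z)
        eq = solve-∀
        eq′ : ∀ i c t → i + (2 + c) + t ≡ suc i + (suc c + t)
        eq′ = solve-∀
        -- At most `suc c + t` candidates lie between the endpoints, and with parameter `suc c`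
        -- these make at most `suc t` rows.
        rows≤ : length I′ ∸ c ≤ suc t
        rows≤ = begin
          length I′ ∸ c                          ≤⟨ ∸-monoˡ-≤ c (inner-length i<s j<s) ⟩
          i + (2 + c) + t ∸ suc i ∸ c            ≡⟨ cong (λ j → j ∸ suc i ∸ c) (eq′ i c t) ⟩
          suc i + (suc c + t) ∸ suc i ∸ c        ≡⟨ cong (_∸ c) (m+n∸m≡n (suc i) (suc c + t)) ⟩
          suc c + t ∸ c                          ≡⟨ cong (_∸ c) (+-suc c t) ⟨
          c + suc t ∸ c                          ≡⟨ m+n∸m≡n c (suc t) ⟩
          suc t                                  ∎
      eq₇ : ∀ x y → 5 + (x + (2 + y)) ≡ x + 7 + y
      eq₇ = solve-∀
      pair≤ : ∀ {w} → 5 + (suc s * 110 + (2 + w)) ≤ suc s * 120 + w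
      pair≤ {w} = begin
        5 + (suc s * 110 + (2 + w))        ≡⟨ eq₇ (suc s * 110) w ⟩
        suc s * 110 + 7 + w
          ≤⟨ +-monoˡ-≤ w (+-monoʳ-≤ (suc s * 110) (≤-trans (≤ᵇ⇒≤ 7 10 tt) (m≤n*m 10 (suc s)))) ⟩
        suc s * 110 + suc s * 10 + w       ≡⟨ cong (_+ w) (*-distribˡ-+ (suc s) 110 10) ⟨
        suc s * 120 + w                    ∎
      pair-depth≤ : 5 + (suc ⌈log₂ s ⌉ * 50 + (2 + depth-measure (suc c) * 120)) ≤ pair-depth
      pair-depth≤ = begin
        5 + (suc ⌈log₂ s ⌉ * 50 + (2 + e₁))     ≡⟨ eq₇ (suc ⌈log₂ s ⌉ * 50) e₁ ⟩
        suc ⌈log₂ s ⌉ * 50 + 7 + e₁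
          ≤⟨ +-monoˡ-≤ e₁ (+-mono-≤ (*-monoˡ-≤ 50 (s≤s log≤L)) (m≤n*m 7 (suc L))) ⟩
        suc L * 50 + suc L * 7 + e₁             ≡⟨ cong (_+ e₁) (*-distribˡ-+ (suc L) 50 7) ⟨
        suc L * 57 + e₁                         ∎
        where
        e₁ = depth-measure (suc c) * 120
      depth≤ : 3 + suc (2 + suc pair-depth) ≤ depth-measure (3 + c) * 120
      depth≤ = begin
        3 + suc (2 + suc (suc L * 57 + D′ * 120))        ≡⟨ eq₁ (suc L * 57) (D′ * 120) ⟩
        suc L * 57 + 7 + D′ * 120
          -- Of the released 2 · 120 = 240 units, 57 are spent on a pair; the remaining 183 dominate
          -- the constant 7.
          ≤⟨ +-monoˡ-≤ (D′ * 120) (+-monoʳ-≤ (suc L * 57) (≤-trans (≤ᵇ⇒≤ 7 183 tt) (m≤n*m 183 (suc L)))) ⟩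
        suc L * 57 + suc L * 183 + D′ * 120              ≡⟨ cong (_+ D′ * 120) (*-distribˡ-+ (suc L) 57 183) ⟨
        suc L * (2 * 120) + D′ * 120                     ≡⟨ eq₂ (suc L) c k 120 ⟩
        depth-measure (3 + c) * 120                      ∎
        where
        D′ = depth-measure (suc c)
        eq₁ : ∀ x y → 3 + suc (2 + suc (x + y)) ≡ x + 7 + y
        eq₁ = solve-∀
        eq₂ : ∀ u c k f → u * (2 * f) + ((2 + c) * u + k) * f ≡ ((4 + c) * u + k) * f
        eq₂ = solve-∀
      to : ∀ {o} → ∃[ i ] (i < r × ∃[ t ] (t < r ∸ i × PairReports (suc c) i (i + (2 + c) + t) o)) → Reports (3 + c) I chosen o
      to (i , i<r , t , t< , h) = pair⇒reports (suc c) (i<s i<r) (index< i t<) h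
      from : ∀ {o} → Reports (3 + c) I chosen o → ∃[ i ] (i < r × ∃[ t ] (t < r ∸ i × PairReports (suc c) i (i + (2 + c) + t) o))
      from h with reports⇒pair (suc c) h
      ... | i , t , j<s , h′ = i ,
        +<⇒<∸ (2 + c) (≤-<-trans (≤-trans (≤-reflexive (+-comm (2 + c) i)) (m≤m+n _ t)) j<s) , t ,
        <-≤-trans (+<⇒<∸ (i + (2 + c)) j<s) (≤-reflexive (sym (r∸i≡ i))) , h′

    counts : ∀ c I chosen → IsOrdered I → All (_< length zs) I → suc c + length chosen ≤ k → ⌈log₂ length I ⌉ ≤ L → Counts (suc c) I chosen
    counts 0             I chosen I-ordered I-below len≤k _     = count-vertices I chosen I-ordered I-below len≤k
    counts 1             I chosen I-ordered I-below len≤k _     = count-edges I chosen I-ordered I-below len≤k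
    counts (suc (suc c)) I chosen I-ordered I-below len≤k log≤L = count-step c (counts c) I chosen I-ordered I-below len≤k log≤L

-- Listing the cliques of a graph

module Listing (init : ℕ → ℕ) (adj : Array (Array ℕ)) (D : Digraph (length adj)) where
  open Algorithm init
  open Table
  open Blocks init
  open Recursion init D
  open Cliques D
  open Digraph D
  open IsTable

  N m : ℕ
  N = length adj
  m = ∑ degree N

  neighbour : ℕ → ℕ → ℕ
  neighbour u j = at (out u) j

  CommunityTable : ℕ → ℕ → Table → Set
  CommunityTable u j T = IsTable N (C u (neighbour u j)) T

  C-below : ∀ u v → All (_< N) (C u v)
  C-below u v = All.tabulate (E⇒<n ∘ proj₁ ∘ ∈-C⁻)

  C-unique : ∀ u v → Unique (C u v)
  C-unique u v = AllPairs.map <⇒≢ (C-ordered u v)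

  -- R and Y bound the work and the depth of the calls of recursiveCount.
  module _ (adj-cells : Cells (λ u ns → ns ≡ out u) N adj) {s̃ γ R Y : ℕ} (c : ℕ)
           (degree≤ : ∀ u → degree u ≤ s̃) (C≤ : ∀ {u v} → E u v → length (C u v) ≤ γ)
           (R-bound : ∀ {s} → 1 + c ≤ s → s ≤ γ → (1 + c + (3 + c)) * multi (suc s ∸ (1 + c)) (1 + c) ≤ R)
           (Y-bound : ∀ {s} → 1 + c ≤ s → s ≤ γ → (2 + c) * suc ⌈log₂ γ ⌉ + (3 + c) ≤ Y) where

    -- `e` is the preprocessing per edge. Each loop over the neighbours of a vertex has one unit of
    -- start-up beyond its degree, so the edges are charged as `N + m`.
    e W H : ℕ
    e = suc s̃ + suc γ * suc γ
    W = suc (N + m) * e + m * R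
    H = suc ⌈log₂ N ⌉ + Y

    neighbour-E : ∀ {u j} → j < degree u → E u (neighbour u j)
    neighbour-E j< = at-∈ (out _) j<

    C≤γ : ∀ {u j} → j < degree u → length (C u (neighbour u j)) ≤ γ
    C≤γ = C≤ ∘ neighbour-E

    ∑-degrees : ∑ (λ u → suc (degree u)) N ≡ N + m
    ∑-degrees = trans (∑-+ (λ _ → 1) degree N) (cong (_+ m) (trans (∑-const 1 N) (*-identityʳ N)))

    N<W : suc N ≤ W
    N<W = ≤-trans (s≤s (m≤m+n N m)) (≤-trans (m≤m*n (suc (N + m)) e) (m≤m+n _ (m * R)))

    ∑≤W : ∑ (λ u → suc (degree u) * e) N ≤ W
    ∑≤W = ≤-trans (≤-reflexive (trans (∑-*ʳ (λ u → suc (degree u)) e N) (cong (_* e) ∑-degrees)))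
      (≤-trans (*-monoˡ-≤ e (n≤1+n (N + m))) (m≤m+n _ (m * R)))

    ∑+≤W : ∑ (λ u → suc (degree u) * e + degree u * R) N ≤ W
    ∑+≤W = ≤-trans (≤-reflexive (trans (∑-+ (λ u → suc (degree u) * e) (λ u → degree u * R) N)
        (cong₂ _+_ (trans (∑-*ʳ (λ u → suc (degree u)) e N) (cong (_* e) ∑-degrees)) (∑-*ʳ degree R N))))
      (+-monoˡ-≤ (m * R) (*-monoˡ-≤ e (n≤1+n (N + m))))

    1+degree≤e : ∀ u → suc (degree u) ≤ e
    1+degree≤e u = ≤-trans (s≤s (degree≤ u)) (m≤m+n (suc s̃) _)

    square≤e : ∀ {t} → t ≤ γ → suc t * suc t ≤ e
    square≤e t≤ = ≤-trans (*-mono-≤ (s≤s t≤) (s≤s t≤)) (m≤n+m _ (suc s̃))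

    linear≤e : ∀ {t} → t ≤ γ → suc t ≤ e
    linear≤e t≤ = ≤-trans (m≤m*n _ (suc _)) (square≤e t≤)

    log-degree≤ : ∀ u → suc ⌈log₂ degree u ⌉ ≤ H
    log-degree≤ u = ≤-trans (s≤s (⌈log₂⌉-mono-≤ (degree≤n u))) (m≤m+n _ Y)

    log-C≤ : ∀ u v → suc ⌈log₂ length (unsortedCommunity u v) ⌉ ≤ H
    log-C≤ u v = ≤-trans (s≤s (⌈log₂⌉-mono-≤ (List.length-filter (λ w → v ∈? out w) (out u)))) (log-degree≤ u)

    castCells : ∀ {A : Set} {Q : ℕ → A → Set} {n n′ xs} → n ≡ n′ → Cells Q n xs → Cells Q n′ xs
    castCells refl xs-cells = xs-cells

    Through : ℕ → ℕ → List ℕ → Set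
    Through u j o = ∃[ q ] (Onion (1 + c) (_∈ C u (neighbour u j)) q × o ≡ q ++ u ∷ neighbour u j ∷ [])

    through-disjoint : ∀ {u u′ j j′ o} → j < degree u → j′ < degree u′ → Through u j o → Through u′ j′ o → u ≡ u′ × j ≡ j′
    through-disjoint j< j′< (q , h , refl) (q′ , h′ , e)
      with refl , v≡ ← split-injective q q′ (trans (onion-length (1 + c) h) (sym (onion-length (1 + c) h′))) e
      = refl , at-injective (out-unique _) j< j′< v≡

    through⇒onion : ∀ {o} → ∃[ u ] (u < N × ∃[ j ] (j < degree u × Through u j o)) → Onion (3 + c) (λ _ → ⊤) o
    through⇒onion (u , u<N , j , j< , q , h , o≡) =
      u , neighbour u j , q , tt , tt , neighbour-E j< , onion-mono (1 + c) (λ w∈ → tt , ∈-C⁻ w∈) h , o≡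

    onion⇒through : ∀ {o} → Onion (3 + c) (λ _ → ⊤) o → ∃[ u ] (u < N × ∃[ j ] (j < degree u × Through u j o))
    onion⇒through (u , v , q , _ , _ , Euv , h , o≡) with ∈-at Euv
    ... | j , j< , refl = u , <-trans (E⇒< Euv) (E⇒<n Euv) , j , j< , q ,
      onion-mono (1 + c) (λ { (_ , Euw , Ewv) → ∈-C⁺ Euw Ewv }) h , o≡

    count-community : ∀ {u j M I} → j < degree u → IsMatrix (C u (neighbour u j)) M →
      1 + c ≤ length (C u (neighbour u j)) → Cells (λ i v → v ≡ i) (length (C u (neighbour u j))) I →
      Runs (e + R) H (recursiveCount (C u (neighbour u j)) M (1 + c) I (u ∷ neighbour u j ∷ [])) 400 120 (λ _ → Enumerates (Through u j))
    count-community {u} {j} j< M-matrix c≤s I-cells with refl ← cells-applyUpTo I-cells =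
      widen (≤-trans (≤-reflexive (cong (λ s → (1 + c + (3 + c)) * multi (suc s ∸ (1 + c)) (1 + c)) length-I))
                     (≤-trans (R-bound c≤s (C≤γ j<)) (m≤n+m R e)))
            (≤-trans (Y-bound c≤s (C≤γ j<)) (m≤n+m Y _)) $
      mapPost (mapEnumerates
          (λ { (q , h , o≡) → q , onion-mono (1 + c) (λ { (l , l∈ , refl) → at-∈ zs (∈-upTo⁻ l∈) }) h , o≡ })
          (λ { (q , h , o≡) → q , onion-mono (1 + c) (λ w∈ → let l , l< , l≡ = ∈-at w∈ in l , ∈-upTo⁺ l< , l≡) h , o≡ }))
        (counts (C-ordered u (neighbour u j)) (C-below u (neighbour u j)) M-matrix (3 + c) ⌈log₂ γ ⌉ c
          (applyUpTo id (length zs)) (u ∷ neighbour u j ∷ [])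
          (AllPairs.applyUpTo⁺₁ id (length zs) (λ i<i′ _ → i<i′)) (All.applyUpTo⁺₁ id (length zs) id)
          (≤-reflexive (trans (+-comm (suc c) 2) refl)) (⌈log₂⌉-mono-≤ (≤-trans (≤-reflexive length-I) (C≤γ j<))))
      where
      zs = C u (neighbour u j)
      length-I = List.length-applyUpTo id (length zs)

    cliqueListOn-runs : Runs W H (cliqueListOn adj (3 + c)) 1000 600 (λ _ → Enumerates (Onion (3 + c) (λ _ → ⊤)))
    cliqueListOn-runs = upTo $ tick $
      parSum {X = λ u → suc (degree u) * e} {Q = λ u T → IsTable N (out u) T} N N<W ∑≤W (λ {u} u<N →
        read adj-cells u<N ≫= λ { refl → widen (m≤m*n _ e) ≤-refl (buildTable-runs (out-unique u) (out-below u)) }) ≫= λ {N⁺s} N⁺-tables →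

      parSum {X = λ u → suc (degree u) * e} {Q = λ u → Cells (CommunityTable u) (degree u)} N N<W ∑≤W (λ {u} u<N →
        read adj-cells u<N ≫= λ { refl → tick $ parEach e (degree u) ≤-refl λ {j} j< →
          read (words (out u)) j< ≫= λ { refl →
          widen (1+degree≤e u) (log-degree≤ u) (pack-runs (λ w → neighbour u j ∈? out w) (out u) {test = λ w → N⁺s ! w >>= λ T → member T (neighbour u j)}
            (λ w∈ → upTo (read N⁺-tables (E⇒<n w∈) ≫= λ T-table → member-runs T-table (E⇒<n (neighbour-E j<))))) ≫= λ { refl →
          widen (square≤e (subst (_≤ γ) (C-length u (neighbour u j)) (C≤γ j<))) (log-C≤ u (neighbour u j)) (sort-runs (Unique.filter⁺ _ (out-unique u))) ≫= λ { refl →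
          widen (linear≤e (C≤γ j<)) ≤-refl (buildTable-runs (C-unique u (neighbour u j)) (C-below u (neighbour u j))) } } } }) ≫= λ {Cs} C-tables →

      parSum {X = λ u → suc (degree u) * e} {Q = λ u → Cells (λ j → IsMatrix (C u (neighbour u j))) (degree u)} N N<W ∑≤W (λ {u} u<N →
        -- The program takes the loop bound from the stored row, whose length equals the degree only
        -- propositionally.
        read C-tables u<N ≫= λ {row} row-cells → tick $ mapPost (λ { (refl , c) → refl , castCells (extent row-cells) c }) $
        parEach e (length row) (*-monoˡ-≤ e (s≤s (≤-reflexive (extent row-cells)))) λ {j} j<′ → let j< = <-≤-trans j<′ (≤-reflexive (extent row-cells)) in
          read row-cells j< ≫= λ
            { {table zs slots} T-table@record { members≡ = refl } → tick $ parEach (suc (length zs)) (length zs) (square≤e (C≤γ j<)) λ {a} a< →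
              read (words zs) a< ≫= λ { refl → let Eux = proj₁ (∈-C⁻ (at-∈ zs a<)) in
              read N⁺-tables (E⇒<n Eux) ≫= λ x-table → read C-tables (E⇒<n Eux) ≫= λ x-row →
              parConst (length zs) ≤-refl λ {b} b< → read (words zs) b< ≫= λ { refl →
                find-runs x-table (E⇒<n (proj₁ (∈-C⁻ (at-∈ zs b<)))) ≫= λ
                  -- The position of `y` among the neighbours of `x` is also the address of the edge
                  -- (x , y), so the same index finds the table of its community.
                  { {just i} (i< , i≡) → read x-row i< ≫= λ xy-table → ret
                      (subst (_∈ out _) i≡ (at-∈ (out _) i<) , subst (λ z → IsTable N (C _ z) _) i≡ xy-table)
                  ; {nothing} y∉ → within z≤n z≤n (ret y∉) } } } }) ≫= λ {Ms} matrices →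

      (tick $ thenReturn $ parallel {X = λ u → suc (degree u) * e + degree u * R} N N<W ∑+≤W (λ {u} u<N →
        read adj-cells u<N ≫= λ { refl → read C-tables u<N ≫= λ row-cells → read matrices u<N ≫= λ matrix-cells → tick $
        parallel {X = λ _ → e + R} (degree u)
          (≤-trans (m≤m*n (suc (degree u)) e) (m≤m+n _ (degree u * R)))
          (≤-trans (≤-reflexive (trans (∑-const (e + R) (degree u)) (*-distribˡ-+ (degree u) e R))) (+-monoˡ-≤ (degree u * R) (m≤n+m _ e)))
          (λ {j} j< → read (words (out u)) j< ≫= λ { refl → read row-cells j< ≫= λ
            { {table zs slots} record { members≡ = refl } → read matrix-cells j< ≫= λ M-matrix → tick $ tick $
              branch (<ᵇ-reflects-< (length zs) (1 + c))
                -- A community with fewer than `1 + c` vertices contains no clique of that size, so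
                -- the empty output is correct.
                (λ s<c → mapPost (λ { (refl , _) → enumerates-none λ { (q , h , _) → <⇒≱ s<c (onion-size (1 + c) h id) } }) (ret {Q′ = λ _ → ⊤} tt))
                (λ s≮c → parConst (length zs) (≤-trans (linear≤e (C≤γ j<)) (m≤m+n e R)) (λ _ → ret refl) ≫= λ I-cells →
                  count-community j< M-matrix (≮⇒≥ s≮c) I-cells) } })
          (gathered-enumerates λ j< j′< h h′ → proj₂ (through-disjoint j< j′< h h′)) })
        (mapEnumerates through⇒onion onion⇒through ∘ gathered-enumerates λ { _ _ (j , j< , h) (j′ , j′< , h′) → proj₁ (through-disjoint j< j′< h h′) }))

-- Rational bounds

ℕ→ℚ-* : ∀ x y → ℕ→ℚ (x * y) ≡ ℕ→ℚ x ℚ.* ℕ→ℚ y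
ℕ→ℚ-* x y = ℚ.toℚᵘ-injective (begin
  toℚᵘ (ℕ→ℚ (x * y))                     ≈⟨ ℚ.toℚᵘ-fromℚᵘ (mkℚᵘ (ℤ.+ (x * y)) 0) ⟩
  mkℚᵘ (ℤ.+ (x * y)) 0                     ≈⟨ ℚᵘ.*≡* (cong (ℤ._* ℤ.+ 1) (ℤ.pos-* x y)) ⟩
  mkℚᵘ (ℤ.+ x) 0 ℚᵘ.* mkℚᵘ (ℤ.+ y) 0
    ≈⟨ ℚᵘ.*-cong (ℚ.toℚᵘ-fromℚᵘ (mkℚᵘ (ℤ.+ x) 0)) (ℚ.toℚᵘ-fromℚᵘ (mkℚᵘ (ℤ.+ y) 0)) ⟨
  toℚᵘ (ℕ→ℚ x) ℚᵘ.* toℚᵘ (ℕ→ℚ y)         ≈⟨ ℚ.toℚᵘ-homo-* (ℕ→ℚ x) (ℕ→ℚ y) ⟨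
  toℚᵘ (ℕ→ℚ x ℚ.* ℕ→ℚ y)                 ∎)
  where open ℚᵘ.≃-Reasoning

ℕ→ℚ-+ : ∀ x y → ℕ→ℚ (x + y) ≡ ℕ→ℚ x ℚ.+ ℕ→ℚ y
ℕ→ℚ-+ x y = ℚ.toℚᵘ-injective (begin
  toℚᵘ (ℕ→ℚ (x + y))                     ≈⟨ ℚ.toℚᵘ-fromℚᵘ (mkℚᵘ (ℤ.+ (x + y)) 0) ⟩
  mkℚᵘ (ℤ.+ (x + y)) 0
    ≈⟨ ℚᵘ.*≡* (cong (ℤ._* ℤ.+ 1) (cong₂ ℤ._+_ (sym (ℤ.*-identityʳ (ℤ.+ x))) (sym (ℤ.*-identityʳ (ℤ.+ y))))) ⟩
  mkℚᵘ (ℤ.+ x) 0 ℚᵘ.+ mkℚᵘ (ℤ.+ y) 0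
    ≈⟨ ℚᵘ.+-cong (ℚ.toℚᵘ-fromℚᵘ (mkℚᵘ (ℤ.+ x) 0)) (ℚ.toℚᵘ-fromℚᵘ (mkℚᵘ (ℤ.+ y) 0)) ⟨
  toℚᵘ (ℕ→ℚ x) ℚᵘ.+ toℚᵘ (ℕ→ℚ y)         ≈⟨ ℚ.toℚᵘ-homo-+ (ℕ→ℚ x) (ℕ→ℚ y) ⟨
  toℚᵘ (ℕ→ℚ x ℚ.+ ℕ→ℚ y)                 ∎)
  where open ℚᵘ.≃-Reasoning

ℕ→ℚ-mono : ∀ {x y} → x ≤ y → ℕ→ℚ x ℚ.≤ ℕ→ℚ y
ℕ→ℚ-mono {x} {y} x≤y = ℚ.toℚᵘ-cancel-≤ (ℚᵘ.≤-respˡ-≃ (ℚᵘ.≃-sym (ℚ.toℚᵘ-fromℚᵘ (mkℚᵘ (ℤ.+ x) 0)))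
  (ℚᵘ.≤-respʳ-≃ (ℚᵘ.≃-sym (ℚ.toℚᵘ-fromℚᵘ (mkℚᵘ (ℤ.+ y) 0))) (ℚᵘ.*≤* (ℤ.*-monoʳ-≤-nonNeg (ℤ.+ 1) (ℤ.+≤+ x≤y)))))

x/2*2≡x : ∀ x → (ℤ.+ x) / 2 ℚ.* ℕ→ℚ 2 ≡ ℕ→ℚ x
x/2*2≡x x = ℚ.toℚᵘ-injective (begin
  toℚᵘ ((ℤ.+ x) / 2 ℚ.* ℕ→ℚ 2)             ≈⟨ ℚ.toℚᵘ-homo-* ((ℤ.+ x) / 2) (ℕ→ℚ 2) ⟩
  toℚᵘ ((ℤ.+ x) / 2) ℚᵘ.* toℚᵘ (ℕ→ℚ 2)
    ≈⟨ ℚᵘ.*-cong (ℚ.toℚᵘ-fromℚᵘ (mkℚᵘ (ℤ.+ x) 1)) (ℚ.toℚᵘ-fromℚᵘ (mkℚᵘ (ℤ.+ 2) 0)) ⟩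
  mkℚᵘ (ℤ.+ x) 1 ℚᵘ.* mkℚᵘ (ℤ.+ 2) 0         ≈⟨ ℚᵘ.*≡* (ℤ.*-identityʳ (ℤ.+ x ℤ.* ℤ.+ 2)) ⟩
  mkℚᵘ (ℤ.+ x) 0                           ≈⟨ ℚ.toℚᵘ-fromℚᵘ (mkℚᵘ (ℤ.+ x) 0) ⟨
  toℚᵘ (ℕ→ℚ x)                           ∎)
  where open ℚᵘ.≃-Reasoning

open CommutativeSemigroup (CommutativeMonoid.commutativeSemigroup ℚ.*-1-commutativeMonoid) using ()
  renaming (interchange to ℚ-interchange)

[x/2]^d*2^d≡x^d : ∀ x d → ((ℤ.+ x) / 2) ^ℚ d ℚ.* ℕ→ℚ (2 ^ d) ≡ ℕ→ℚ (x ^ d)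
[x/2]^d*2^d≡x^d x zero    = refl
[x/2]^d*2^d≡x^d x (suc d) = begin
  (h ℚ.* h ^ℚ d) ℚ.* ℕ→ℚ (2 * 2 ^ d)                 ≡⟨ cong ((h ℚ.* h ^ℚ d) ℚ.*_) (ℕ→ℚ-* 2 (2 ^ d)) ⟩
  (h ℚ.* h ^ℚ d) ℚ.* (ℕ→ℚ 2 ℚ.* ℕ→ℚ (2 ^ d))         ≡⟨ ℚ-interchange h (h ^ℚ d) (ℕ→ℚ 2) (ℕ→ℚ (2 ^ d)) ⟩
  (h ℚ.* ℕ→ℚ 2) ℚ.* (h ^ℚ d ℚ.* ℕ→ℚ (2 ^ d))         ≡⟨ cong₂ ℚ._*_ (x/2*2≡x x) ([x/2]^d*2^d≡x^d x d) ⟩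
  ℕ→ℚ x ℚ.* ℕ→ℚ (x ^ d)                              ≡⟨ ℕ→ℚ-* x (x ^ d) ⟨
  ℕ→ℚ (x * x ^ d)                                    ∎
  where
  open ≡-Reasoning
  h = (ℤ.+ x) / 2

-- Multiplying by the positive number 2^d clears the denominator of (x/2)^d, which reduces the claim
-- to natural numbers.
rational-bound : ∀ K w a b x d → w * 2 ^ d ≤ K * (a * 2 ^ d + b * x ^ d) →
                 ℕ→ℚ w ℚ.≤ ℕ→ℚ K ℚ.* (ℕ→ℚ a ℚ.+ ℕ→ℚ b ℚ.* ((ℤ.+ x) / 2) ^ℚ d)
rational-bound K w a b x d w≤ = ℚ.*-cancelʳ-≤-pos (ℕ→ℚ (2 ^ d)) (begin
  ℕ→ℚ w ℚ.* z                                                ≡⟨ ℕ→ℚ-* w (2 ^ d) ⟨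
  ℕ→ℚ (w * 2 ^ d)                                            ≤⟨ ℕ→ℚ-mono w≤ ⟩
  ℕ→ℚ (K * (a * 2 ^ d + b * x ^ d))
    ≡⟨ trans (ℕ→ℚ-* K _) (cong (ℕ→ℚ K ℚ.*_) (trans (ℕ→ℚ-+ (a * 2 ^ d) (b * x ^ d)) (cong₂ ℚ._+_ (ℕ→ℚ-* a (2 ^ d)) (ℕ→ℚ-* b (x ^ d))))) ⟩
  ℕ→ℚ K ℚ.* (ℕ→ℚ a ℚ.* z ℚ.+ ℕ→ℚ b ℚ.* ℕ→ℚ (x ^ d))
    ≡⟨ cong (λ t → ℕ→ℚ K ℚ.* (ℕ→ℚ a ℚ.* z ℚ.+ t)) (trans (cong (ℕ→ℚ b ℚ.*_) (sym ([x/2]^d*2^d≡x^d x d))) (sym (ℚ.*-assoc (ℕ→ℚ b) h z))) ⟩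
  ℕ→ℚ K ℚ.* (ℕ→ℚ a ℚ.* z ℚ.+ ℕ→ℚ b ℚ.* h ℚ.* z)
    ≡⟨ cong (ℕ→ℚ K ℚ.*_) (ℚ.*-distribʳ-+ z (ℕ→ℚ a) (ℕ→ℚ b ℚ.* h)) ⟨
  ℕ→ℚ K ℚ.* ((ℕ→ℚ a ℚ.+ ℕ→ℚ b ℚ.* h) ℚ.* z)                  ≡⟨ ℚ.*-assoc (ℕ→ℚ K) _ z ⟨
  ℕ→ℚ K ℚ.* (ℕ→ℚ a ℚ.+ ℕ→ℚ b ℚ.* h) ℚ.* z                    ∎)
  where
  open ℚ.≤-Reasoning
  z = ℕ→ℚ (2 ^ d)
  h = ((ℤ.+ x) / 2) ^ℚ d
  instance
    2^d≢0 : NonZero (2 ^ d)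
    2^d≢0 = m^n≢0 2 d
    z-positive : ℚ.Positive z
    z-positive = ℚ.normalize-pos (2 ^ d) 1

-- Collecting the bounds

multi-1ʳ : ∀ c → multi 1 c ≡ suc c
multi-1ʳ zero    = refl
multi-1ʳ (suc c) = cong suc (multi-1ʳ c)

-- The factor 8 is 2 · 4, from d + k ≤ 2k and from the 4 of `2^c*multi≤`. For `j = 0` there is a
-- single row with binomial coefficient d + 1, and then γ = d makes the quadratic term sufficient.
recursion-work : ∀ c j → let d = 2 + c ; k = 4 + c ; γ = d + j in
                 (d + k) * multi (suc j) d * 2 ^ d ≤ 8 * (γ ^ 2 * 2 ^ d + k * (2 + j) ^ d)
recursion-work c zero = begin
  (2 + c + (4 + c)) * multi 1 (2 + c) * 2 ^ (2 + c)
    ≡⟨ cong (λ t → (2 + c + (4 + c)) * t * 2 ^ (2 + c)) (multi-1ʳ (2 + c)) ⟩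
  (2 + c + (4 + c)) * (3 + c) * 2 ^ (2 + c)
    ≤⟨ *-monoˡ-≤ (2 ^ (2 + c)) (≤-by (14 + 20 * c + 6 * (c * c)) (eq c)) ⟩
  8 * (2 + c) ^ 2 * 2 ^ (2 + c)                       ≡⟨ *-assoc 8 ((2 + c) ^ 2) (2 ^ (2 + c)) ⟩
  8 * ((2 + c) ^ 2 * 2 ^ (2 + c))
    ≤⟨ *-monoʳ-≤ 8 (≤-trans (*-monoˡ-≤ (2 ^ (2 + c)) (^-monoˡ-≤ 2 (m≤m+n (2 + c) 0))) (m≤m+n _ _)) ⟩
  8 * ((2 + c + 0) ^ 2 * 2 ^ (2 + c) + (4 + c) * 2 ^ (2 + c)) ∎
  where
  open ≤-Reasoning
  eq : ∀ c → 8 * ((2 + c) * ((2 + c) * 1)) ≡ (2 + c + (4 + c)) * (3 + c) + (14 + 20 * c + 6 * (c * c))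
  eq = solve-∀
recursion-work c (suc j) = begin
  (2 + c + (4 + c)) * multi (2 + j) (2 + c) * 2 ^ (2 + c)
    ≡⟨ trans (*-assoc (2 + c + (4 + c)) (multi (2 + j) (2 + c)) (2 ^ (2 + c)))
                                                                         (cong ((2 + c + (4 + c)) *_) (*-comm (multi (2 + j) (2 + c)) (2 ^ (2 + c)))) ⟩
  (2 + c + (4 + c)) * (2 ^ (2 + c) * multi (2 + j) (2 + c))      ≤⟨ *-monoʳ-≤ (2 + c + (4 + c)) (2^c*multi≤ j c) ⟩
  (2 + c + (4 + c)) * (4 * z)                                    ≤⟨ ≤-by (8 * z) (eq c z) ⟩
  8 * ((4 + c) * z)
    ≤⟨ *-monoʳ-≤ 8 (m≤n+m _ ((2 + c + suc j) ^ 2 * 2 ^ (2 + c))) ⟩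
  8 * ((2 + c + suc j) ^ 2 * 2 ^ (2 + c) + (4 + c) * z)          ∎
  where
  open ≤-Reasoning
  z = (3 + j) ^ (2 + c)
  eq : ∀ c z → 8 * ((4 + c) * z) ≡ (2 + c + (4 + c)) * (4 * z) + 8 * z
  eq = solve-∀

1≤log : ∀ {n} → 2 ≤ n → 1 ≤ ⌈log₂ n ⌉
1≤log 2≤n = ⌈log₂⌉-mono-≤ {2} 2≤n

-- For γ < k - 2 no recursive call is made, and `ρ` and `δ` are chosen as 0, since for γ = 0 the
-- right sides of `ρ≤` and `δ≤` vanish. Otherwise γ ≥ 2, so the logarithm is positive and absorbs
-- the additive constants of the depth.
record RecursionBounds (γ c : ℕ) : Set where
  field
    ρ δ     : ℕ
    ρ-bound : ∀ {s} → 2 + c ≤ s → s ≤ γ → (2 + c + (4 + c)) * multi (suc s ∸ (2 + c)) (2 + c) ≤ ρ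
    δ-bound : ∀ {s} → 2 + c ≤ s → s ≤ γ → (3 + c) * suc ⌈log₂ γ ⌉ + (4 + c) ≤ δ
    ρ≤      : ρ * 2 ^ (2 + c) ≤ 8 * (γ ^ 2 * 2 ^ (2 + c) + (4 + c) * (γ + 4 ∸ (4 + c)) ^ (2 + c))
    δ≤      : δ ≤ 3 * ((4 + c) * ⌈log₂ γ ⌉)

recursion-bounds : ∀ γ c → RecursionBounds γ c
recursion-bounds γ c with 2 + c ≤? γ
... | no d≰γ = record
  { ρ = 0 ; δ = 0
  ; ρ-bound = λ d≤s s≤γ → contradiction (≤-trans d≤s s≤γ) d≰γ
  ; δ-bound = λ d≤s s≤γ → contradiction (≤-trans d≤s s≤γ) d≰γ
  ; ρ≤ = z≤n ; δ≤ = z≤n }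
... | yes d≤γ with j , refl ← m≤n⇒∃[o]m+o≡n d≤γ = record
  { ρ = (2 + c + (4 + c)) * multi (suc j) (2 + c)
  ; δ = (3 + c) * suc l + (4 + c)
  ; ρ-bound = λ {s} _ s≤γ → *-monoʳ-≤ (2 + c + (4 + c)) (multi-monoˡ (2 + c)
      (≤-trans (∸-monoˡ-≤ (2 + c) (s≤s s≤γ)) (≤-reflexive (trans (cong (_∸ (2 + c)) (sym (+-suc (2 + c) j))) (m+n∸m≡n (2 + c) (suc j))))))
  ; δ-bound = λ _ _ → ≤-refl
  ; ρ≤ = subst (λ x → (2 + c + (4 + c)) * multi (suc j) (2 + c) * 2 ^ (2 + c) ≤
                      8 * ((2 + c + j) ^ 2 * 2 ^ (2 + c) + (4 + c) * x ^ (2 + c))) (sym x≡) (recursion-work c j)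
  ; δ≤ = depth≤ (1≤log (≤-trans (m≤m+n 2 c) d≤γ)) }
  where
  l = ⌈log₂ 2 + c + j ⌉
  shuffle : ∀ c j → 2 + c + j + 4 ≡ 4 + c + (2 + j)
  shuffle = solve-∀
  x≡ : 2 + c + j + 4 ∸ (4 + c) ≡ 2 + j
  x≡ = trans (cong (_∸ (4 + c)) (shuffle c j)) (m+n∸m≡n (4 + c) (2 + j))
  depth≤ : ∀ {l} → 1 ≤ l → (3 + c) * suc l + (4 + c) ≤ 3 * ((4 + c) * l)
  depth≤ {suc l} _ = ≤-by (2 + 9 * l + c * l + c * l + (c * 0)) (eq c l)
    where
    eq : ∀ c l → 3 * ((4 + c) * suc l) ≡ (3 + c) * suc (suc l) + (4 + c) + (2 + 9 * l + c * l + c * l + (c * 0))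
    eq = solve-∀

-- The constant is 4 · 3 + 8: `suc (n + m)` is at most 4 m, the preprocessing per edge at most 3 (s̃
-- + γ²) because s̃ ≥ 1, and the recursion contributes 8.
total-work : ∀ {n m s̃ γ k R z x^d} → n ≤ 2 * m → 1 ≤ m → 1 ≤ s̃ → R * z ≤ 8 * (γ ^ 2 * z + k * x^d) →
             (suc (n + m) * (suc s̃ + suc γ * suc γ) + m * R) * z ≤ 20 * (m * (s̃ + γ ^ 2) * z + k * m * x^d)
total-work {n} {m} {s̃} {γ} {k} {R} {z} {q} n≤2m 1≤m 1≤s̃ R≤ = begin
  (suc (n + m) * (suc s̃ + suc γ * suc γ) + m * R) * z
    ≤⟨ *-monoˡ-≤ z (+-monoˡ-≤ (m * R) (*-mono-≤ n+m≤ e≤)) ⟩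
  (m * 4 * (3 * (s̃ + γ ^ 2)) + m * R) * z                               ≡⟨ eq₁ m (s̃ + γ ^ 2) R z ⟩
  12 * (m * (s̃ + γ ^ 2) * z) + m * (R * z)                              ≤⟨ +-monoʳ-≤ _ (*-monoʳ-≤ m R≤) ⟩
  12 * (m * (s̃ + γ ^ 2) * z) + m * (8 * (γ ^ 2 * z + k * q))
    ≤⟨ ≤-by (8 * (m * s̃ * z) + 12 * (k * m * q)) (eq₂ m s̃ (γ ^ 2) z k q) ⟩
  20 * (m * (s̃ + γ ^ 2) * z + k * m * q)                                ∎
  where
  open ≤-Reasoning
  eq₁ : ∀ m t R z → (m * 4 * (3 * t) + m * R) * z ≡ 12 * (m * t * z) + m * (R * z)
  eq₁ = solve-∀
  eq₂ : ∀ m s g z k q → 20 * (m * (s + g) * z + k * m * q) ≡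
                        12 * (m * (s + g) * z) + m * (8 * (g * z + k * q)) + (8 * (m * s * z) + 12 * (k * m * q))
  eq₂ = solve-∀
  eq₃ : ∀ m → m + (2 * m + m) ≡ m * 4
  eq₃ = solve-∀
  n+m≤ : suc (n + m) ≤ m * 4
  n+m≤ = ≤-trans (+-mono-≤ 1≤m (+-monoˡ-≤ m n≤2m)) (≤-reflexive (eq₃ m))
  γ≤γ² : ∀ γ → γ ≤ γ ^ 2
  γ≤γ² zero    = z≤n
  γ≤γ² (suc γ) = m≤m*n (suc γ) (suc γ * 1)
  eq₄ : ∀ s γ → suc s + suc γ * suc γ ≡ 1 + (1 + (s + (γ + (γ + γ * (γ * 1)))))
  eq₄ = solve-∀
  eq₅ : ∀ s g → s + (s + (s + (g + (g + g)))) ≡ 3 * (s + g)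
  eq₅ = solve-∀
  e≤ : suc s̃ + suc γ * suc γ ≤ 3 * (s̃ + γ ^ 2)
  e≤ = begin
    suc s̃ + suc γ * suc γ                                 ≡⟨ eq₄ s̃ γ ⟩
    1 + (1 + (s̃ + (γ + (γ + γ ^ 2))))
      ≤⟨ +-mono-≤ 1≤s̃ (+-mono-≤ 1≤s̃ (+-monoʳ-≤ s̃ (+-mono-≤ (γ≤γ² γ) (+-monoˡ-≤ (γ ^ 2) (γ≤γ² γ))))) ⟩
    s̃ + (s̃ + (s̃ + (γ ^ 2 + (γ ^ 2 + γ ^ 2))))             ≡⟨ eq₅ s̃ (γ ^ 2) ⟩
    3 * (s̃ + γ ^ 2)                                       ∎

total-depth : ∀ {l Y z} → 1 ≤ l → Y ≤ 3 * z → suc l + Y ≤ 3 * (l ^ 2 + z)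
total-depth {suc l} {Y} {z} _ Y≤ = begin
  suc (suc l) + Y                      ≤⟨ +-mono-≤ (≤-by (1 + 5 * l + 3 * (l * l)) (eq l)) Y≤ ⟩
  3 * suc l ^ 2 + 3 * z                ≡⟨ *-distribˡ-+ 3 (suc l ^ 2) z ⟨
  3 * (suc l ^ 2 + z)                  ∎
  where
  open ≤-Reasoning
  eq : ∀ l → 3 * (suc l * (suc l * 1)) ≡ suc (suc l) + (1 + 5 * l + 3 * (l * l))
  eq = solve-∀

-- From vertices to ranks

cells-tabulate : ∀ {A : Set} {Q : ℕ → A → Set} {n} (g : Fin n → A) → (∀ u → Q (toℕ u) (g u)) → Cells Q n (tabulate g)
cells-tabulate {n = zero}  g q = cells refl λ ()
cells-tabulate {Q = Q} {suc n} g q = cells (cong suc (extent tail)) λ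
  { {zero} _ → g Fin.zero , refl , q Fin.zero ; {suc i} (s≤s i<n) → cell tail i<n }
  where
  tail : Cells (λ i → Q (suc i)) n (tabulate (g ∘ Fin.suc))
  tail = cells-tabulate (g ∘ Fin.suc) (q ∘ Fin.suc)

length-concatMap-tabulate : ∀ {A B : Set} {n} (g : Fin n → A) (h : A → List B) (l : ℕ → ℕ) →
                            (∀ u → length (h (g u)) ≡ l (toℕ u)) → length (concatMap h (tabulate g)) ≡ ∑ l n
length-concatMap-tabulate {n = zero}  g h l eq = refl
length-concatMap-tabulate {n = suc n} g h l eq = begin
  length (h (g Fin.zero) ++ concatMap h (tabulate (g ∘ Fin.suc)))             ≡⟨ List.length-++ (h (g Fin.zero)) ⟩
  length (h (g Fin.zero)) + length (concatMap h (tabulate (g ∘ Fin.suc)))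
    ≡⟨ cong₂ _+_ (eq Fin.zero) (length-concatMap-tabulate (g ∘ Fin.suc) h (l ∘ suc) (eq ∘ Fin.suc)) ⟩
  l 0 + ∑ (l ∘ suc) n                                                         ≡⟨ ∑-suc l n ⟨
  ∑ l (suc n)                                                                 ∎
  where open ≡-Reasoning

AllPairs-map-∈ : ∀ {A : Set} {R S : A → A → Set} {xs} → (∀ {x y} → x ∈ xs → y ∈ xs → R x y → S x y) → AllPairs R xs → AllPairs S xs
AllPairs-map-∈ R⇒S []       = []
AllPairs-map-∈ R⇒S (r ∷ rs) =
  All.tabulate (λ y∈ → R⇒S (here refl) (there y∈) (All.lookup r y∈)) ∷ AllPairs-map-∈ (λ x∈ y∈ → R⇒S (there x∈) (there y∈)) rs

another : ∀ {n} → 2 ≤ n → (u : Fin n) → ∃[ v ] u ≢ v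
another {suc (suc n)} _ Fin.zero    = Fin.suc Fin.zero , λ ()
another {suc (suc n)} _ (Fin.suc u) = Fin.zero , λ ()
another {suc zero} (s≤s ())

-- Here `adj` is a variable, so the equation between its length and `n` can be matched, as the type
-- of `D` in `Listing` demands.
listing-runs : ∀ init {n} (D : Digraph n) (adj : Array (Array ℕ)) → let open Cliques D in
  Cells (λ u ns → ns ≡ Digraph.out D u) n adj → ∀ {s̃ γ R Y} c →
  (∀ u → degree u ≤ s̃) → (∀ {u v} → E u v → length (C u v) ≤ γ) →
  (∀ {s} → 1 + c ≤ s → s ≤ γ → (1 + c + (3 + c)) * multi (suc s ∸ (1 + c)) (1 + c) ≤ R) →
  (∀ {s} → 1 + c ≤ s → s ≤ γ → (2 + c) * suc ⌈log₂ γ ⌉ + (3 + c) ≤ Y) →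
  Runs (suc (n + ∑ degree n) * (suc s̃ + suc γ * suc γ) + ∑ degree n * R) (suc ⌈log₂ n ⌉ + Y)
       (Algorithm.cliqueListOn init adj (3 + c)) 1000 600 (λ _ → Enumerates (Onion (3 + c) (λ _ → ⊤)))
listing-runs init D adj adj-cells with refl ← extent adj-cells = Listing.cliqueListOn-runs init adj D adj-cells

module Ranks {n : ℕ} (G : OrientedGraph n) where
  open OrientedGraph G
  open DecMembership (Fin._≟_ {n}) using () renaming (_∈?_ to _∈ᶠ?_)

  out : ℕ → List ℕ
  out x with x <? n
  ... | yes x<n = map toℕ (N⁺ (fromℕ< x<n))
  ... | no  _   = []

  out-elim : ∀ (P : ℕ → List ℕ → Set) → (∀ u → P (toℕ u) (map toℕ (N⁺ u))) → (∀ x → P x []) → ∀ x → P x (out x)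
  out-elim P h h₀ x with x <? n
  ... | yes x<n = subst (λ z → P z (map toℕ (N⁺ (fromℕ< x<n)))) (Fin.toℕ-fromℕ< x<n) (h (fromℕ< x<n))
  ... | no  _   = h₀ x

  out-toℕ : ∀ u → out (toℕ u) ≡ map toℕ (N⁺ u)
  out-toℕ u with toℕ u <? n
  ... | yes u<n = cong (map toℕ ∘ N⁺) (Fin.fromℕ<-toℕ u u<n)
  ... | no  u≮n = contradiction (Fin.toℕ<n u) u≮n

  D : Digraph n
  D = record
    { out        = out
    ; out-unique = out-elim (λ _ → Unique) (λ u → Unique.map⁺ Fin.toℕ-injective (N⁺-unique u)) (λ _ → [])
    ; out-above  = out-elim (λ x → All (x <_)) (λ u → All.map⁺ (N⁺-above u)) (λ _ → [])
    ; out-below  = out-elim (λ _ → All (_< n)) (λ u → All.map⁺ (All.tabulate λ {v} _ → Fin.toℕ<n v)) (λ _ → [])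
    }

  open Cliques D

  E⁺ : ∀ {u v} → Edge G u v → E (toℕ u) (toℕ v)
  E⁺ {u} e = subst (_ ∈_) (sym (out-toℕ u)) (∈-map⁺ toℕ e)

  E⁻ : ∀ {u v} → E (toℕ u) (toℕ v) → Edge G u v
  E⁻ {u} e with ∈-map⁻ toℕ (subst (_ ∈_) (out-toℕ u) e)
  ... | w , w∈ , v≡w rewrite Fin.toℕ-injective v≡w = w∈

  E-source : ∀ {x y} → E x y → ∃[ u ] toℕ u ≡ x
  E-source {x} e = out-elim (λ x ys → _ ∈ ys → ∃[ u ] toℕ u ≡ x) (λ u _ → u , refl) (λ _ ()) x e

  E-target : ∀ {x y} → E x y → ∃[ v ] toℕ v ≡ y
  E-target e = fromℕ< (E⇒<n e) , Fin.toℕ-fromℕ< (E⇒<n e)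

  adj : Array (Array ℕ)
  adj = map (λ u → map toℕ (N⁺ u)) (allFin n)

  adj-cells : Cells (λ u ns → ns ≡ out u) n adj
  adj-cells = subst (Cells _ n) (sym (List.map-tabulate id (λ u → map toℕ (N⁺ u)))) (cells-tabulate _ (λ u → sym (out-toℕ u)))

  degree≤ : ∀ x → degree x ≤ maxOutDegree G
  degree≤ = out-elim (λ _ xs → length xs ≤ maxOutDegree G)
    (λ u → ≤-trans (≤-reflexive (List.length-map toℕ (N⁺ u)))
      (All.lookup (xs≤max 0 (map (λ u → length (N⁺ u)) (allFin n))) (∈-map⁺ (λ u → length (N⁺ u)) (∈-allFin u))))
    (λ _ → z≤n)

  ∈-edges : ∀ {u v} → Edge G u v → (u , v) ∈ edges G
  ∈-edges {u} e = ∈-concatMap⁺ (λ u → map (u ,_) (N⁺ u)) (lose (∈-allFin u) (∈-map⁺ (u ,_) e))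

  community≤ : ∀ {x y} → E x y → length (C x y) ≤ maxCommunitySize G
  community≤ Exy with E-source Exy | E-target Exy
  ... | u , refl | v , refl = begin
    length (C (toℕ u) (toℕ v))                          ≡⟨ C-length (toℕ u) (toℕ v) ⟩
    length (unsortedCommunity (toℕ u) (toℕ v))
      ≤⟨ unique-⊆-length (Unique.filter⁺ (λ w → toℕ v ∈? out w) (Digraph.out-unique D (toℕ u))) inside ⟩
    length (map toℕ (community G u v))                  ≡⟨ List.length-map toℕ (community G u v) ⟩
    length (community G u v)
      ≤⟨ All.lookup (xs≤max 0 (map size-of (edges G))) (∈-map⁺ size-of (∈-edges (E⁻ Exy))) ⟩
    maxCommunitySize G                                  ∎
    where
    open ≤-Reasoning
    size-of : Fin n × Fin n → ℕ
    size-of e = length (community G (proj₁ e) (proj₂ e))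
    inside : ∀ {w} → w ∈ unsortedCommunity (toℕ u) (toℕ v) → w ∈ map toℕ (community G u v)
    inside w∈ with ∈-filter⁻ (λ w → toℕ v ∈? out w) {xs = out (toℕ u)} w∈
    ... | Euw , Ewv with E-target Euw
    ... | w , refl = ∈-map⁺ toℕ (∈-filter⁺ (_∈ᶠ? N⁻ G v) (E⁻ Euw) (∈-filter⁺ (λ u → v ∈ᶠ? N⁺ u) (∈-allFin w) (E⁻ Ewv)))

  edgeCount≡ : edgeCount G ≡ ∑ degree n
  edgeCount≡ = length-concatMap-tabulate id (λ u → map (u ,_) (N⁺ u)) degree λ u →
    trans (List.length-map (u ,_) (N⁺ u)) (trans (sym (List.length-map toℕ (N⁺ u))) (cong length (sym (out-toℕ u))))

  endpoints : List (Fin n)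
  endpoints = map proj₁ (edges G) ++ map proj₂ (edges G)

  -- A walk to some other vertex has to leave `u` along an edge at `u`.
  ∈-endpoints : 2 ≤ n → Connected G → ∀ u → u ∈ endpoints
  ∈-endpoints 2≤n connected u with another 2≤n u
  ... | v , u≢v with connected u v
  ... | ε         = contradiction refl u≢v
  ... | fwd e ◅ _ = ∈-++⁺ˡ (∈-map⁺ proj₁ (∈-edges e))
  ... | bwd e ◅ _ = ∈-++⁺ʳ (map proj₁ (edges G)) (∈-map⁺ proj₂ (∈-edges e))

  n≤2m : 2 ≤ n → Connected G → n ≤ 2 * edgeCount G
  n≤2m 2≤n connected = begin
    n                                                                  ≡⟨ List.length-tabulate id ⟨
    length (allFin n)
      ≤⟨ unique-⊆-length (Unique.allFin⁺ n) (λ {u} _ → ∈-endpoints 2≤n connected u) ⟩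
    length endpoints                                                   ≡⟨ List.length-++ (map proj₁ (edges G)) ⟩
    length (map proj₁ (edges G)) + length (map proj₂ (edges G))
      ≡⟨ cong₂ _+_ (List.length-map proj₁ (edges G)) (List.length-map proj₂ (edges G)) ⟩
    edgeCount G + edgeCount G
      ≡⟨ cong (edgeCount G +_) (+-identityʳ (edgeCount G)) ⟨
    2 * edgeCount G                                                    ∎
    where open ≤-Reasoning

  1≤maxOutDegree : 1 ≤ edgeCount G → 1 ≤ maxOutDegree G
  1≤maxOutDegree 1≤m with maxOutDegree G in s̃≡
  ... | suc _ = s≤s z≤n
  ... | zero  = contradiction
    (≤-trans 1≤m (≤-trans (≤-reflexive edgeCount≡)
      (≤-trans (∑-≤ n (λ {x} _ → ≤-trans (degree≤ x) (≤-reflexive s̃≡))) (≤-reflexive (*-zeroʳ n))))) λ ()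

  onion-below : ∀ c {S : ℕ → Set} {q} → Onion (2 + c) S q → All (_< n) q
  onion-below c {q = q} (x , y , p , Sx , Sy , Exy , h , refl) = All.tabulate λ w∈ → below (∈-++⁻ p w∈)
    where
    below : ∀ {w} → w ∈ p ⊎ w ∈ x ∷ y ∷ [] → w < n
    below (inj₁ w∈p)                 = E⇒<n (proj₁ (proj₂ (onion-⊆ c h w∈p)))
    below (inj₂ (here refl))         = <-trans (E⇒< Exy) (E⇒<n Exy)
    below (inj₂ (there (here refl))) = E⇒<n Exy

  vertices : ∀ {q} → All (_< n) q → ∃[ vs ] q ≡ map (toℕ {n}) vs
  vertices []         = [] , refl
  vertices (x<n ∷ qs) = let vs , e = vertices qs in fromℕ< x<n ∷ vs , cong₂ _∷_ (sym (Fin.toℕ-fromℕ< x<n)) e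

  onion⇒clique : ∀ c {S : ℕ → Set} {q} → Onion (2 + c) S q → ∃[ vs ] (IsClique G (2 + c) vs × q ≡ map toℕ vs)
  onion⇒clique c h with vertices (onion-below c h)
  ... | vs , e = vs ,
    ( trans (sym (List.length-map toℕ vs)) (trans (cong length (sym e)) (onion-length (2 + c) h))
    , AllPairs.map (λ { (inj₁ e) → inj₁ (E⁻ e) ; (inj₂ e) → inj₂ (E⁻ e) }) (AllPairs.map⁻ (subst (AllPairs Adj) e (onion-adjacent (2 + c) h)))) , e

  -- Adjacency is symmetric and therefore survives sorting; in increasing order it can only point
  -- forward, which gives the ascending chain that `onion-complete` peels.
  clique⇒onion : ∀ c {vs} → IsClique G c vs → ∃[ q ] (map toℕ vs ↭ q × Onion c (λ _ → ⊤) q)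
  clique⇒onion c {vs} (len , pairs) =
    let q , q↭ , h = onion-complete c {λ _ → ⊤} ordered-edges
          (trans (↭-length (Sort.sort-↭ (map toℕ vs))) (trans (List.length-map toℕ vs) len)) (All.tabulate λ _ → tt)
    in q , ↭-trans (↭-sym (Sort.sort-↭ (map toℕ vs))) (↭-sym q↭) , h
    where
    adjacent : AllPairs Adj (map toℕ vs)
    adjacent = AllPairs.map⁺ (AllPairs.map (λ { (inj₁ e) → inj₁ (E⁺ e) ; (inj₂ e) → inj₂ (E⁺ e) }) pairs)
    oriented : ∀ {x y} → x < y × Adj x y → E x y
    oriented (x<y , inj₁ e) = e
    oriented (x<y , inj₂ e) = contradiction (E⇒< e) (<-asym x<y)
    ordered-edges : AllPairs E (Sort.sort (map toℕ vs))
    ordered-edges = AllPairs.zipWith oriented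
      ( sort-ordered (AllPairs.map Adj⇒≢ adjacent)
      , PermutationSetoid.AllPairs-resp-↭ (setoid ℕ) (λ { (inj₁ e) → inj₂ e ; (inj₂ e) → inj₁ e }) (resp₂ Adj)
          (↭⇒↭ₛ (↭-sym (Sort.sort-↭ (map toℕ vs)))) adjacent)

  lists-all : ∀ c {rs} → Enumerates (Onion (2 + c) (λ _ → ⊤)) rs → ListsAllCliques G (2 + c) rs
  lists-all c e =
    All.tabulate (λ o∈ → onion⇒clique c (sound e o∈)) ,
    (λ vs clique → let q , vs↭q , h = clique⇒onion (2 + c) clique in lose (complete e h) vs↭q) ,
    AllPairs-map-∈ (λ o∈ o∈′ o≢o′ o↭o′ → o≢o′ (onion-↭ (2 + c) (sound e o∈) (sound e o∈′) o↭o′)) (unique e)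

-- Assembling the theorem

overall-work : ∀ a K {v} n m s̃ γ k R z q → a * 20 ≤ K → n ≤ 2 * m → 1 ≤ m → 1 ≤ s̃ → R * z ≤ 8 * (γ ^ 2 * z + k * q) →
               v ≤ (suc (n + m) * (suc s̃ + suc γ * suc γ) + m * R) * a → v * z ≤ K * (m * (s̃ + γ ^ 2) * z + k * m * q)
overall-work a K {v} n m s̃ γ k R z q ≤K n≤2m 1≤m 1≤s̃ R≤ v≤ = begin
  v * z              ≤⟨ *-monoˡ-≤ z v≤ ⟩
  w₀ * a * z         ≡⟨ trans (cong (_* z) (*-comm w₀ a)) (*-assoc a w₀ z) ⟩
  a * (w₀ * z)       ≤⟨ *-monoʳ-≤ a (total-work {n} {m} {s̃} {γ} {k} {R} {z} {q} n≤2m 1≤m 1≤s̃ R≤) ⟩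
  a * (20 * t)       ≡⟨ *-assoc a 20 t ⟨
  a * 20 * t         ≤⟨ *-monoˡ-≤ t ≤K ⟩
  K * t              ∎
  where
  open ≤-Reasoning
  w₀ = suc (n + m) * (suc s̃ + suc γ * suc γ) + m * R
  t = m * (s̃ + γ ^ 2) * z + k * m * q

overall-depth : ∀ a K {v} l Y z → a * 3 ≤ K → 1 ≤ l → Y ≤ 3 * z → v ≤ (suc l + Y) * a → v ≤ K * (l ^ 2 + z)
overall-depth a K {v} l Y z ≤K 1≤l Y≤ v≤ = begin
  v                      ≤⟨ v≤ ⟩
  (suc l + Y) * a        ≡⟨ *-comm (suc l + Y) a ⟩
  a * (suc l + Y)        ≤⟨ *-monoʳ-≤ a (total-depth 1≤l Y≤) ⟩
  a * (3 * (l ^ 2 + z))  ≡⟨ *-assoc a 3 (l ^ 2 + z) ⟨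
  a * 3 * (l ^ 2 + z)    ≤⟨ *-monoˡ-≤ (l ^ 2 + z) ≤K ⟩
  K * (l ^ 2 + z)        ∎
  where open ≤-Reasoning

module Bounds {n : ℕ} (G : OrientedGraph n) (c : ℕ) (init : ℕ → ℕ) (2≤n : 2 ≤ n) (connected : Connected G) where
  open Ranks G
  open RecursionBounds (recursion-bounds (maxCommunitySize G) c)

  m γ s̃ : ℕ
  m = edgeCount G
  γ = maxCommunitySize G
  s̃ = maxOutDegree G

  1≤m : 1 ≤ m
  1≤m = *-cancelˡ-≤ 2 (≤-trans 2≤n (n≤2m 2≤n connected))

  cliqueList-runs : Runs (suc (n + ∑ (Cliques.degree D) n) * (suc s̃ + suc γ * suc γ) + ∑ (Cliques.degree D) n * ρ) (suc ⌈log₂ n ⌉ + δ)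
                         (cliqueList init G (4 + c)) 1000 600 (λ _ → Enumerates (Cliques.Onion D (4 + c) (λ _ → ⊤)))
  cliqueList-runs = listing-runs init D (map (λ u → map toℕ (OrientedGraph.N⁺ G u)) (allFin n)) adj-cells (1 + c) degree≤ community≤ ρ-bound δ-bound

  work-bound : ∀ a K {w} → a * 20 ≤ K →
    w ≤ (suc (n + ∑ (Cliques.degree D) n) * (suc s̃ + suc γ * suc γ) + ∑ (Cliques.degree D) n * ρ) * a →
    w * 2 ^ (2 + c) ≤ K * (m * (s̃ + γ ^ 2) * 2 ^ (2 + c) + (4 + c) * m * (γ + 4 ∸ (4 + c)) ^ (2 + c))
  work-bound a K {w} ≤K w≤ = overall-work a K n m s̃ γ (4 + c) ρ (2 ^ (2 + c)) ((γ + 4 ∸ (4 + c)) ^ (2 + c))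
    ≤K (n≤2m 2≤n connected) 1≤m (1≤maxOutDegree 1≤m) ρ≤
    (subst (λ m → w ≤ (suc (n + m) * (suc s̃ + suc γ * suc γ) + m * ρ) * a) (sym edgeCount≡) w≤)

  depth-bound : ∀ a K {d} → a * 3 ≤ K → d ≤ (suc ⌈log₂ n ⌉ + δ) * a → d ≤ K * (⌈log₂ n ⌉ ^ 2 + (4 + c) * ⌈log₂ γ ⌉)
  depth-bound a K ≤K d≤ = overall-depth a K ⌈log₂ n ⌉ δ ((4 + c) * ⌈log₂ γ ⌉) ≤K (1≤log 2≤n) δ≤ d≤

open import Data.Integer using (+_)

theorem2p1 :
  ∃[ K ] (∀ {n : ℕ} (G : OrientedGraph n) (k : ℕ) (init : ℕ → ℕ) →
    2 ≤ n → Connected G → 3 < k →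
    let m = edgeCount G
        γ = maxCommunitySize G
        s̃ = maxOutDegree G
    in ∃[ cliques ] ∃[ work ] ∃[ depth ]
         ( cliqueList init G k ≡ just (outcome tt cliques work depth)
         × ListsAllCliques G k cliques
         × ℕ→ℚ work ℚ.≤ ℕ→ℚ K ℚ.* (ℕ→ℚ (m * (s̃ + γ ^ 2)) ℚ.+ ℕ→ℚ (k * m) ℚ.* ((+ (γ + 4 ∸ k)) / 2) ^ℚ (k ∸ 2))
         × depth ≤ K * (⌈log₂ n ⌉ ^ 2 + k * ⌈log₂ γ ⌉) ))
theorem2p1 = 20000 , λ G k init 2≤n connected 3<k →
  -- The 1000 of the program meets the 20 of `total-work`; the depth asks for 600 · 3 only.
  conclude 20000 (≤ᵇ⇒≤ (1000 * 20) 20000 tt) (≤ᵇ⇒≤ (600 * 3) 20000 tt) G k init 2≤n connected (m≤n⇒∃[o]m+o≡n 3<k)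
  where
  -- With `K` a variable, products such as `K * t` stay folded.
  conclude : ∀ K → 1000 * 20 ≤ K → 600 * 3 ≤ K → ∀ {n : ℕ} (G : OrientedGraph n) (k : ℕ) (init : ℕ → ℕ) →
    2 ≤ n → Connected G → ∃[ c ] 4 + c ≡ k →
    let m = edgeCount G
        γ = maxCommunitySize G
        s̃ = maxOutDegree G
    in ∃[ cliques ] ∃[ work ] ∃[ depth ]
         ( cliqueList init G k ≡ just (outcome tt cliques work depth)
         × ListsAllCliques G k cliques
         × ℕ→ℚ work ℚ.≤ ℕ→ℚ K ℚ.* (ℕ→ℚ (m * (s̃ + γ ^ 2)) ℚ.+ ℕ→ℚ (k * m) ℚ.* ((+ (γ + 4 ∸ k)) / 2) ^ℚ (k ∸ 2))
         × depth ≤ K * (⌈log₂ n ⌉ ^ 2 + k * ⌈log₂ γ ⌉) )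
  conclude K 20000≤K 1800≤K G k init 2≤n connected (c , refl) =
    let open Bounds G c init 2≤n connected
        open Ranks G
        open Runs cliqueList-runs
    in reported , work , depth , equation , lists-all (2 + c) holds ,
       rational-bound K work (m * (s̃ + γ ^ 2)) ((4 + c) * m) (γ + 4 ∸ (4 + c)) (2 + c) (work-bound 1000 K 20000≤K work≤) ,
       depth-bound 600 K 1800≤K depth≤
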